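{- Let $V$ be a finite set (case $q=1$) or a finite-dimensional $\mathbb{F}_q$-vector space (case $q\ge 2$ a prime power) with $n=\operatorname{rk}V\ge1$. Let $P\in{V\brack 1}$ be a point and $1\le k\le n$. Then $$\Phi:\mathbb{R}^{{V/P\brack k-1}}\to\mathbb{R}^{{V\brack k}},\qquad \Phi(f):K\mapsto\begin{cases}f(K/P)&\text{if }P\le K,\\0&\text{if }P\nleq K\end{cases}$$ is an injective $\mathbb{R}$-linear map with image $$\operatorname{im}(\Phi)=\Big\{g\in\mathbb{R}^{{V\brack k}}\ \Big|\ \operatorname{supp}g\subseteq\{K\in{V\brack k}\mid P\le K\}\Big\},$$ and for all $f:{V/P\brack k-1}\to\mathbb{R}$ $$\deg_V(\Phi(f))=\min(\deg_{V/P}(f)+1,\;n-k).$$ Moreover, for all $e\in\{\max(\deg_{V/P}(f),0)+1,\ldots,\min(k,n-k)\}$ and $E\in{V\brack e}$, $$\operatorname{wt}^{(e)}_{\Phi(f)}(E)=\begin{cases}\operatorname{wt}^{(e-1)}_f(E/P)&\text{if }P\le E,\\0&\text{if }P\nleq E.\end{cases}$$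
   Context: For $q=1$, "subspaces" of $V$ are subsets, $\operatorname{rk}U=\#U$, and $U/P$ means $U\setminus P$ for $P\subseteq U$; for $q\ge2$ they are $\mathbb{F}_q$-linear subspaces, $\operatorname{rk}U=\dim U$, and $U/P$ is the quotient space. $U\le W$ means inclusion. For any ambient space $W$ of rank $m$ (here $W=V$ with $m=n$, or $W=V/P$ with $m=n-1$), ${W\brack k}$ is the set of all subspaces of $W$ of rank $k$. For a subspace $U$ of $W$, $\boldsymbol{x}_U^{(k)}:{W\brack k}\to\mathbb{R}$ is the characteristic function of $\{K\in{W\brack k}\mid U\le K\}$. For $0\le k\le m$ and $i\in\{0,\ldots,\min(k,m-k)\}$, let $\bar V_i^{(k)}(W)\subseteq\mathbb{R}^{{W\brack k}}$ be the real span of $\{\boldsymbol{x}_I^{(k)}\mid I\in{W\brack i}\}$; this set is a basis of $\bar V_i^{(k)}(W)$ (a known fact), and these spaces form an increasing chain ending in $\mathbb{R}^{{W\brack k}}$ for $i=\min(k,m-k)$. For $f\in\bar V_i^{(k)}(W)$, the $i$-weight distribution $\operatorname{wt}_f^{(i)}:{W\brack i}\to\mathbb{R}$ is the unique function with $f=\sum_{I\in{W\brack i}}\operatorname{wt}_f^{(i)}(I)\,\boldsymbol{x}_I^{(k)}$. The degree $\deg_W(f)$ of a non-zero $f:{W\brack k}\to\mathbb{R}$ is the smallest $t\in\{0,\ldots,\min(k,m-k)\}$ with $f\in\bar V_t^{(k)}(W)$; $\deg_W(\boldsymbol 0)=-\infty$, with $-\infty+1=-\infty$. -}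

module Defs where

open import Level using (0ℓ)
open import Algebra.Bundles using (CommutativeRing)
open import Algebra.Module.Bundles using (LeftModule)
open import Algebra.Module.Bundles.Raw using (RawLeftModule)
import Algebra.Module.Properties.LeftModule as LeftModuleProperties
import Algebra.Properties.AbelianGroup as AbelianGroupProperties
import Algebra.Properties.CommutativeMonoid.Sum as Sums
import Algebra.Properties.Ring as RingProperties
import Algebra.Solver.CommutativeMonoid as CommutativeMonoidSolver
open import Data.Bool.Base using (Bool; true; false; T; not; if_then_else_)
open import Data.Bool.Properties using (T-irrelevant; T?)
open import Data.Empty using (⊥-elim)
open import Data.Fin.Base using (Fin; zero; suc; punchIn; punchOut)
import Data.Fin.Properties as Finₚ
open import Data.Maybe.Base as Maybe using (fromMaybe)
open import Data.Nat.Base as ℕ using (ℕ; zero; suc; _∸_; _⊓_)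
import Data.Nat.Properties as ℕₚ
open import Data.Product using (Σ; Σ-syntax; ∃; _×_; _,_; proj₁; proj₂)
open import Data.Rational.Base as ℚ using (ℚ; 0ℚ; 1ℚ; ½)
import Data.Rational.Properties as ℚₚ
open import Data.Rational.Solver using (module +-*-Solver)
open import Data.Unit.Base using (tt)
open import Data.Vec.Functional using (Vector; insertAt; removeAt)
open import Data.Vec.Functional.Properties using (insertAt-lookup; insertAt-punchIn)
open import Function.Base using (_∘_)
open import Function.Bundles using (Func; Inverse; _↔_; mk↔ₛ′; _⟨$⟩_)
open import Relation.Binary.Bundles using (Setoid)
open import Relation.Binary.Structures using (IsEquivalence)
import Relation.Binary.Reasoning.Setoid as SetoidReasoning
open import Relation.Binary.PropositionalEquality as ≡ using (_≡_; refl; cong; subst)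
open import Relation.Nullary using (Dec; yes; no; does; ¬_; ¬?)
open import Relation.Nullary.Decidable as Dec using (map′)
open import Relation.Nullary.Construct.Add.Infimum using (_₋; ⊥₋; [_])

-- Reals are Cauchy sequences of rationals; two of them are equal (_≈ᴿ_)
-- when their difference tends to zero.

Near : ℚ → ℚ → ℚ → Set
Near ε p q = ℚ.∣ p ℚ.- q ∣ ℚ.< ε

record ℝ : Set where
  constructor mkℝ
  field
    seq    : ℕ → ℚ
    cauchy : ∀ ε → 0ℚ ℚ.< ε →
             Σ[ N ∈ ℕ ] ∀ m n → N ℕ.≤ m → N ℕ.≤ n → Near ε (seq m) (seq n)

open ℝ public

infix 4 _≈ᴿ_

_≈ᴿ_ : ℝ → ℝ → Set
x ≈ᴿ y = ∀ ε → 0ℚ ℚ.< ε → Σ[ N ∈ ℕ ] ∀ n → N ℕ.≤ n → Near ε (seq x n) (seq y n)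

near-refl : ∀ {ε p q} → 0ℚ ℚ.< ε → p ≡ q → Near ε p q
near-refl {ε} {p} 0<ε refl = subst (λ r → ℚ.∣ r ∣ ℚ.< ε) (≡.sym (ℚₚ.+-inverseʳ p)) 0<ε

near-sym : ∀ {ε p q} → Near ε p q → Near ε q p
near-sym {ε} {p} {q} = subst (ℚ._< ε) (≡.trans (≡.sym (ℚₚ.∣-p∣≡∣p∣ (p ℚ.- q))) (cong ℚ.∣_∣ lem))
  where
  lem : ℚ.- (p ℚ.- q) ≡ q ℚ.- p
  lem = +-*-Solver.solve 2 (λ a b → :- (a :- b) := b :- a) refl p q
    where open +-*-Solver

half-pos : ∀ {ε} → 0ℚ ℚ.< ε → 0ℚ ℚ.< ½ ℚ.* ε
half-pos {ε} 0<ε = subst (ℚ._< ½ ℚ.* ε) (ℚₚ.*-zeroʳ ½) (ℚₚ.*-monoʳ-<-pos ½ 0<ε)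

half+half : ∀ ε → ½ ℚ.* ε ℚ.+ ½ ℚ.* ε ≡ ε
half+half ε = ≡.trans (≡.sym (ℚₚ.*-distribʳ-+ ε ½ ½)) (ℚₚ.*-identityˡ ε)

∣+∣< : ∀ {δ₁ δ₂ ε r} p q → δ₁ ℚ.+ δ₂ ≡ ε → p ℚ.+ q ≡ r →
       ℚ.∣ p ∣ ℚ.< δ₁ → ℚ.∣ q ∣ ℚ.< δ₂ → ℚ.∣ r ∣ ℚ.< ε
∣+∣< p q refl refl h₁ h₂ = ℚₚ.≤-<-trans (ℚₚ.∣p+q∣≤∣p∣+∣q∣ p q) (ℚₚ.+-mono-< h₁ h₂)

near-trans : ∀ {ε p q r} → Near (½ ℚ.* ε) p q → Near (½ ℚ.* ε) q r → Near ε p r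
near-trans {ε} {p} {q} {r} = ∣+∣< (p ℚ.- q) (q ℚ.- r) (half+half ε)
  (+-*-Solver.solve 3 (λ a b c → (a :- b) :+ (b :- c) := a :- c) refl p q r)
  where open +-*-Solver

near-+ : ∀ {ε p p′ q q′} → Near (½ ℚ.* ε) p p′ → Near (½ ℚ.* ε) q q′ →
         Near ε (p ℚ.+ q) (p′ ℚ.+ q′)
near-+ {ε} {p} {p′} {q} {q′} = ∣+∣< (p ℚ.- p′) (q ℚ.- q′) (half+half ε)
  (+-*-Solver.solve 4 (λ a b c d → (a :- b) :+ (c :- d) := (a :+ c) :- (b :+ d)) refl p p′ q q′)
  where open +-*-Solver

near-neg : ∀ {ε p q} → Near ε p q → Near ε (ℚ.- p) (ℚ.- q)
near-neg {ε} {p} {q} h = subst (λ r → ℚ.∣ r ∣ ℚ.< ε)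
  (+-*-Solver.solve 2 (λ a b → b :- a := (:- a) :- (:- b)) refl p q) (near-sym {p = p} h)
  where open +-*-Solver

module Scale (B : ℚ) (0<B : 0ℚ ℚ.< B) where
  instance
    B-pos : ℚ.Positive B
    B-pos = ℚ.positive 0<B
    B-nonZero : ℚ.NonZero B
    B-nonZero = ℚₚ.pos⇒nonZero B

  scale : ℚ → ℚ
  scale ε = (ℚ.1/ B) ℚ.* ε

  scale-pos : ∀ {ε} → 0ℚ ℚ.< ε → 0ℚ ℚ.< scale ε
  scale-pos {ε} 0<ε = subst (ℚ._< scale ε) (ℚₚ.*-zeroʳ (ℚ.1/ B))
    (ℚₚ.*-monoʳ-<-pos (ℚ.1/ B) {{ℚₚ.1/pos⇒pos B}} 0<ε)

  *-scale : ∀ ε → B ℚ.* scale ε ≡ ε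
  *-scale ε = ≡.trans (≡.sym (ℚₚ.*-assoc B (ℚ.1/ B) ε))
    (≡.trans (cong (ℚ._* ε) (ℚₚ.*-inverseʳ B)) (ℚₚ.*-identityˡ ε))

  ∣*∣< : ∀ {ε} p q → ℚ.∣ p ∣ ℚ.< B → ℚ.∣ q ∣ ℚ.< scale ε → ℚ.∣ p ℚ.* q ∣ ℚ.< ε
  ∣*∣< {ε} p q p<B q<δ = begin-strict
    ℚ.∣ p ℚ.* q ∣         ≡⟨ ℚₚ.∣p*q∣≡∣p∣*∣q∣ p q ⟩
    ℚ.∣ p ∣ ℚ.* ℚ.∣ q ∣   ≤⟨ ℚₚ.*-monoʳ-≤-nonNeg ℚ.∣ q ∣ {{ℚₚ.∣-∣-nonNeg q}} (ℚₚ.<⇒≤ p<B) ⟩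
    B ℚ.* ℚ.∣ q ∣         <⟨ ℚₚ.*-monoʳ-<-pos B q<δ ⟩
    B ℚ.* scale ε         ≡⟨ *-scale ε ⟩
    ε                     ∎
    where open ℚₚ.≤-Reasoning

near-* : ∀ {ε B C p p′ q q′} (0<B : 0ℚ ℚ.< B) (0<C : 0ℚ ℚ.< C) →
         ℚ.∣ p ∣ ℚ.< B → ℚ.∣ q′ ∣ ℚ.< C →
         Near (Scale.scale C 0<C (½ ℚ.* ε)) p p′ → Near (Scale.scale B 0<B (½ ℚ.* ε)) q q′ →
         Near ε (p ℚ.* q) (p′ ℚ.* q′)
near-* {ε} {B} {C} {p} {p′} {q} {q′} 0<B 0<C p<B q′<C pp′ qq′ =
  ∣+∣< (q′ ℚ.* (p ℚ.- p′)) (p ℚ.* (q ℚ.- q′)) (half+half ε)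
    (+-*-Solver.solve 4 (λ a b c d → (d :* (a :- b)) :+ (a :* (c :- d)) := (a :* c) :- (b :* d))
      refl p p′ q q′)
    (Scale.∣*∣< C 0<C q′ (p ℚ.- p′) q′<C pp′)
    (Scale.∣*∣< B 0<B p (q ℚ.- q′) p<B qq′)
  where open +-*-Solver

record EventuallyBounded (x : ℝ) : Set where
  field
    bound : ℚ
    pos   : 0ℚ ℚ.< bound
    from  : ℕ
    below : ∀ n → from ℕ.≤ n → ℚ.∣ seq x n ∣ ℚ.< bound

eventuallyBounded : ∀ x → EventuallyBounded x
eventuallyBounded x = record
  { bound = 1ℚ ℚ.+ ℚ.∣ a ∣
  ; pos   = ℚₚ.+-mono-<-≤ 0<1 (ℚₚ.0≤∣p∣ a)
  ; from  = N
  ; below = λ n N≤n → subst (λ r → ℚ.∣ r ∣ ℚ.< 1ℚ ℚ.+ ℚ.∣ a ∣)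
      (+-*-Solver.solve 2 (λ s t → (s :- t) :+ t := s) refl (seq x n) a)
      (ℚₚ.≤-<-trans (ℚₚ.∣p+q∣≤∣p∣+∣q∣ (seq x n ℚ.- a) a)
        (ℚₚ.+-monoˡ-< ℚ.∣ a ∣ (proj₂ (cauchy x 1ℚ 0<1) n N N≤n ℕₚ.≤-refl)))
  }
  where
  open +-*-Solver
  0<1 : 0ℚ ℚ.< 1ℚ
  0<1 = ℚₚ.positive⁻¹ 1ℚ
  N = proj₁ (cauchy x 1ℚ 0<1)
  a = seq x N

⊔-≤ˡ : ∀ {a b n} → a ℕ.⊔ b ℕ.≤ n → a ℕ.≤ n
⊔-≤ˡ {a} {b} = ℕₚ.≤-trans (ℕₚ.m≤m⊔n a b)

⊔-≤ʳ : ∀ {a b n} → a ℕ.⊔ b ℕ.≤ n → b ℕ.≤ n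
⊔-≤ʳ {a} {b} = ℕₚ.≤-trans (ℕₚ.m≤n⊔m a b)

fromℚ : ℚ → ℝ
fromℚ p = mkℝ (λ _ → p) (λ ε 0<ε → 0 , λ _ _ _ _ → near-refl {p = p} 0<ε refl)

0ᴿ 1ᴿ : ℝ
0ᴿ = fromℚ 0ℚ
1ᴿ = fromℚ 1ℚ

infixl 6 _+ᴿ_
infixl 7 _*ᴿ_
infix  8 -ᴿ_

_+ᴿ_ : ℝ → ℝ → ℝ
seq (x +ᴿ y) n = seq x n ℚ.+ seq y n
cauchy (x +ᴿ y) ε 0<ε with cauchy x (½ ℚ.* ε) (half-pos 0<ε) | cauchy y (½ ℚ.* ε) (half-pos 0<ε)
... | M , hx | N , hy = M ℕ.⊔ N , λ m n l l′ →
  near-+ {p = seq x m} {q = seq y m} (hx m n (⊔-≤ˡ l) (⊔-≤ˡ l′)) (hy m n (⊔-≤ʳ {M} l) (⊔-≤ʳ {M} l′))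

-ᴿ_ : ℝ → ℝ
seq (-ᴿ x) n = ℚ.- seq x n
cauchy (-ᴿ x) ε 0<ε with cauchy x ε 0<ε
... | N , hx = N , λ m n l l′ → near-neg {p = seq x m} (hx m n l l′)

_*ᴿ_ : ℝ → ℝ → ℝ
seq (x *ᴿ y) n = seq x n ℚ.* seq y n
cauchy (x *ᴿ y) ε 0<ε =
  (X.from ℕ.⊔ Y.from) ℕ.⊔ (proj₁ cx ℕ.⊔ proj₁ cy) , λ m n l l′ →
  near-* {p = seq x m} {q = seq y m} X.pos Y.pos
    (X.below m (⊔-≤ˡ {X.from} (⊔-≤ˡ l)))
    (Y.below n (⊔-≤ʳ {X.from} (⊔-≤ˡ l′)))
    (proj₂ cx m n (⊔-≤ˡ {proj₁ cx} (⊔-≤ʳ {X.from ℕ.⊔ Y.from} l))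
                  (⊔-≤ˡ {proj₁ cx} (⊔-≤ʳ {X.from ℕ.⊔ Y.from} l′)))
    (proj₂ cy m n (⊔-≤ʳ {proj₁ cx} (⊔-≤ʳ {X.from ℕ.⊔ Y.from} l))
                  (⊔-≤ʳ {proj₁ cx} (⊔-≤ʳ {X.from ℕ.⊔ Y.from} l′)))
  where
  module X = EventuallyBounded (eventuallyBounded x)
  module Y = EventuallyBounded (eventuallyBounded y)
  cx = cauchy x _ (Scale.scale-pos Y.bound Y.pos (half-pos 0<ε))
  cy = cauchy y _ (Scale.scale-pos X.bound X.pos (half-pos 0<ε))

pointwise : ∀ {x y} → (∀ n → seq x n ≡ seq y n) → x ≈ᴿ y
pointwise {x} eq ε 0<ε = 0 , λ n _ → near-refl {p = seq x n} 0<ε (eq n)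

≈ᴿ-isEquivalence : IsEquivalence _≈ᴿ_
≈ᴿ-isEquivalence = record
  { refl  = λ {x} → pointwise {x} {x} (λ _ → refl)
  ; sym   = λ {x} h ε 0<ε → proj₁ (h ε 0<ε) , λ n l →
      near-sym {p = seq x n} (proj₂ (h ε 0<ε) n l)
  ; trans = λ {x} h h′ ε 0<ε →
      let M , p = h (½ ℚ.* ε) (half-pos 0<ε) ; N , q = h′ (½ ℚ.* ε) (half-pos 0<ε) in
      M ℕ.⊔ N , λ n l → near-trans {p = seq x n} (p n (⊔-≤ˡ l)) (q n (⊔-≤ʳ {M} l))
  }

+ᴿ-cong : ∀ {x x′ y y′} → x ≈ᴿ x′ → y ≈ᴿ y′ → x +ᴿ y ≈ᴿ x′ +ᴿ y′
+ᴿ-cong {x} {y = y} h h′ ε 0<ε =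
  let M , p = h (½ ℚ.* ε) (half-pos 0<ε) ; N , q = h′ (½ ℚ.* ε) (half-pos 0<ε) in
  M ℕ.⊔ N , λ n l → near-+ {p = seq x n} {q = seq y n} (p n (⊔-≤ˡ l)) (q n (⊔-≤ʳ {M} l))

-ᴿ-cong : ∀ {x x′} → x ≈ᴿ x′ → -ᴿ x ≈ᴿ -ᴿ x′
-ᴿ-cong {x} h ε 0<ε = proj₁ (h ε 0<ε) , λ n l → near-neg {p = seq x n} (proj₂ (h ε 0<ε) n l)

*ᴿ-cong : ∀ {x x′ y y′} → x ≈ᴿ x′ → y ≈ᴿ y′ → x *ᴿ y ≈ᴿ x′ *ᴿ y′
*ᴿ-cong {x} {x′} {y} {y′} h h′ ε 0<ε =
  (X.from ℕ.⊔ Y.from) ℕ.⊔ (proj₁ cx ℕ.⊔ proj₁ cy) , λ n l →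
  near-* {p = seq x n} {q = seq y n} X.pos Y.pos
    (X.below n (⊔-≤ˡ {X.from} (⊔-≤ˡ l)))
    (Y.below n (⊔-≤ʳ {X.from} (⊔-≤ˡ l)))
    (proj₂ cx n (⊔-≤ˡ {proj₁ cx} (⊔-≤ʳ {X.from ℕ.⊔ Y.from} l)))
    (proj₂ cy n (⊔-≤ʳ {proj₁ cx} (⊔-≤ʳ {X.from ℕ.⊔ Y.from} l)))
  where
  module X = EventuallyBounded (eventuallyBounded x)
  module Y = EventuallyBounded (eventuallyBounded y′)
  cx = h _ (Scale.scale-pos Y.bound Y.pos (half-pos 0<ε))
  cy = h′ _ (Scale.scale-pos X.bound X.pos (half-pos 0<ε))

ℝ-commutativeRing : CommutativeRing 0ℓ 0ℓ
ℝ-commutativeRing = record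
  { Carrier = ℝ ; _≈_ = _≈ᴿ_ ; _+_ = _+ᴿ_ ; _*_ = _*ᴿ_ ; -_ = -ᴿ_ ; 0# = 0ᴿ ; 1# = 1ᴿ
  ; isCommutativeRing = record
    { isRing = record
      { +-isAbelianGroup = record
        { isGroup = record
          { isMonoid = record
            { isSemigroup = record
              { isMagma = record { isEquivalence = ≈ᴿ-isEquivalence
                                 ; ∙-cong = λ {x x′ y y′} → +ᴿ-cong {x} {x′} {y} {y′} }
              ; assoc = λ x y z → pointwise {(x +ᴿ y) +ᴿ z} {x +ᴿ (y +ᴿ z)}
                  (λ n → ℚₚ.+-assoc (seq x n) (seq y n) (seq z n)) }
            ; identity = (λ x → pointwise {0ᴿ +ᴿ x} {x} (λ n → ℚₚ.+-identityˡ (seq x n)))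
                       , (λ x → pointwise {x +ᴿ 0ᴿ} {x} (λ n → ℚₚ.+-identityʳ (seq x n))) }
          ; inverse = (λ x → pointwise { -ᴿ x +ᴿ x} {0ᴿ} (λ n → ℚₚ.+-inverseˡ (seq x n)))
                    , (λ x → pointwise {x +ᴿ -ᴿ x} {0ᴿ} (λ n → ℚₚ.+-inverseʳ (seq x n)))
          ; ⁻¹-cong = λ {x x′} → -ᴿ-cong {x} {x′} }
        ; comm = λ x y → pointwise {x +ᴿ y} {y +ᴿ x} (λ n → ℚₚ.+-comm (seq x n) (seq y n)) }
      ; *-cong = λ {x x′ y y′} → *ᴿ-cong {x} {x′} {y} {y′}
      ; *-assoc = λ x y z → pointwise {(x *ᴿ y) *ᴿ z} {x *ᴿ (y *ᴿ z)}
          (λ n → ℚₚ.*-assoc (seq x n) (seq y n) (seq z n))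
      ; *-identity = (λ x → pointwise {1ᴿ *ᴿ x} {x} (λ n → ℚₚ.*-identityˡ (seq x n)))
                   , (λ x → pointwise {x *ᴿ 1ᴿ} {x} (λ n → ℚₚ.*-identityʳ (seq x n)))
      ; distrib = (λ x y z → pointwise {x *ᴿ (y +ᴿ z)} {x *ᴿ y +ᴿ x *ᴿ z}
                      (λ n → ℚₚ.*-distribˡ-+ (seq x n) (seq y n) (seq z n)))
                , (λ x y z → pointwise {(y +ᴿ z) *ᴿ x} {y *ᴿ x +ᴿ z *ᴿ x}
                      (λ n → ℚₚ.*-distribʳ-+ (seq x n) (seq y n) (seq z n))) }
    ; *-comm = λ x y → pointwise {x *ᴿ y} {y *ᴿ x} (λ n → ℚₚ.*-comm (seq x n) (seq y n)) }
  }

module Subsets where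

  Subset : Set → Set
  Subset X = X → Bool

  module _ {X : Set} where

    infix 4 _∈_ _⊆_

    _∈_ : X → Subset X → Set
    x ∈ U = T (U x)

    _⊆_ : Subset X → Subset X → Set
    U ⊆ W = ∀ x → x ∈ U → x ∈ W

    full : Subset X
    full _ = true

    Size : Subset X → ℕ → Set
    Size U r = Fin r ↔ (Σ[ x ∈ X ] x ∈ U)

    Minus : Subset X → Set
    Minus P = Σ[ x ∈ X ] T (not (P x))

    _∖_ : Subset X → (P : Subset X) → Subset (Minus P)
    (U ∖ P) (x , _) = U x

  module _ {X : Set} where

    ⊆-dec : ∀ {r} (U W : Subset X) → Size U r → Dec (U ⊆ W)
    ⊆-dec U W e = map′
      (λ h x x∈U → subst (λ y → proj₁ y ∈ W) (strictlyInverseˡ (x , x∈U)) (h (from (x , x∈U))))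
      (λ h i → h _ (proj₂ (to i)))
      (Finₚ.all? (λ i → T? (W (proj₁ (to i)))))
      where open Inverse e

    T-not : ∀ {b} → ¬ T b → T (not b)
    T-not {false} _ = tt
    T-not {true}  h = h tt

    not-T : ∀ {b} → T (not b) → ¬ T b
    not-T {true} ()
    not-T {false} _ ()

    ∈-≡ : ∀ {B : X → Bool} {x y : Σ[ x ∈ X ] T (B x)} → proj₁ x ≡ proj₁ y → x ≡ y
    ∈-≡ {B} {x , p} {_ , q} refl = cong (x ,_) (T-irrelevant p q)

    ∖-size : ∀ {r} (U P : Subset X) → Size U r → Size P 1 → P ⊆ U → Size (U ∖ P) (r ∸ 1)
    ∖-size {zero} U P eU eP P⊆U =
      ⊥-elim (Finₚ.¬Fin0 (Inverse.from eU (_ , P⊆U _ (proj₂ (Inverse.to eP zero)))))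
    ∖-size {suc r} U P eU eP P⊆U = mk↔ₛ′ to′ from′ to∘from from∘to
      where
      open Inverse eU
      p : X
      p = proj₁ (Inverse.to eP zero)

      p∈P : p ∈ P
      p∈P = proj₂ (Inverse.to eP zero)

      pU : Σ[ x ∈ X ] x ∈ U
      pU = p , P⊆U p p∈P

      P-unique : ∀ x → x ∈ P → x ≡ p
      P-unique x x∈P with Inverse.from eP (x , x∈P) | Inverse.strictlyInverseˡ eP (x , x∈P)
      ... | zero | eq = cong proj₁ (≡.sym eq)

      j : Fin (suc r)
      j = from pU

      avoids : ∀ i → ¬ proj₁ (to (punchIn j i)) ∈ P
      avoids i h = Finₚ.punchInᵢ≢i j i (≡.trans (≡.sym (strictlyInverseʳ (punchIn j i)))
        (cong from (∈-≡ {x = to (punchIn j i)} {y = pU} (P-unique _ h))))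

      j≢ : ∀ x (x∈U : x ∈ U) → T (not (P x)) → ¬ j ≡ from (x , x∈U)
      j≢ x x∈U x∉P eq = not-T x∉P (subst (_∈ P) (cong proj₁ (begin
        pU                     ≡⟨ strictlyInverseˡ pU ⟨
        to j                   ≡⟨ cong to eq ⟩
        to (from (x , x∈U))    ≡⟨ strictlyInverseˡ (x , x∈U) ⟩
        (x , x∈U)              ∎)) p∈P)
        where open ≡.≡-Reasoning

      to′ : Fin r → Σ[ y ∈ Minus P ] y ∈ (U ∖ P)
      to′ i = (proj₁ (to (punchIn j i)) , T-not (avoids i)) , proj₂ (to (punchIn j i))

      from′ : (Σ[ y ∈ Minus P ] y ∈ (U ∖ P)) → Fin r
      from′ ((x , x∉P) , x∈U) = punchOut (j≢ x x∈U x∉P)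

      ext : {a b : Σ[ y ∈ Minus P ] y ∈ (U ∖ P)} → proj₁ (proj₁ a) ≡ proj₁ (proj₁ b) → a ≡ b
      ext {(x , s) , t} {(_ , s′) , t′} refl with T-irrelevant s s′ | T-irrelevant t t′
      ... | refl | refl = refl

      to∘from : ∀ y → to′ (from′ y) ≡ y
      to∘from ((x , x∉P) , x∈U) = ext (cong proj₁ (≡.trans
        (cong to (Finₚ.punchIn-punchOut (j≢ x x∈U x∉P))) (strictlyInverseˡ (x , x∈U))))

      from∘to : ∀ i → from′ (to′ i) ≡ i
      from∘to i = ≡.trans
        (Finₚ.punchOut-cong j (strictlyInverseʳ (punchIn j i)))
        (Finₚ.punchOut-punchIn j)

record FiniteField : Set₁ where
  field
    commutativeRing : CommutativeRing 0ℓ 0ℓ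
  open CommutativeRing commutativeRing public
  field
    0≉1         : ¬ 0# ≈ 1#
    inverse     : ∀ x → ¬ x ≈ 0# → ∃ λ y → x * y ≈ 1#
    q           : ℕ
    enumeration : Inverse (≡.setoid (Fin q)) setoid

VectorSpace : FiniteField → Set₁
VectorSpace F = LeftModule (FiniteField.ring F) 0ℓ 0ℓ

module Linear (F : FiniteField) where

  private
    module F = FiniteField F
    open F using (_≈_; 0#; 1#)

    _≈?_ : ∀ x y → Dec (x ≈ y)
    x ≈? y = map′
      (λ eq → F.trans (F.sym (E.strictlyInverseˡ x)) (F.trans (E.to-cong eq) (E.strictlyInverseˡ y)))
      E.from-cong
      (E.from x Finₚ.≟ E.from y)
      where module E = Inverse F.enumeration

  module _ (V : VectorSpace F) where

    open LeftModule V
    open Sums +ᴹ-commutativeMonoid using (sum)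

    record Subspace : Set where
      field
        member   : Carrierᴹ → Bool
        resp     : ∀ {x y} → x ≈ᴹ y → T (member x) → T (member y)
        0-closed : T (member 0ᴹ)
        +-closed : ∀ {x y} → T (member x) → T (member y) → T (member (x +ᴹ y))
        *-closed : ∀ a {x} → T (member x) → T (member (a *ₗ x))

    combination : ∀ {r} → Vector F.Carrier r → Vector Carrierᴹ r → Carrierᴹ
    combination c b = sum (λ i → c i *ₗ b i)

    record Basis (U : Subspace) (r : ℕ) : Set where
      open Subspace U using (member)
      field
        vectors     : Vector Carrierᴹ r
        inside      : ∀ i → T (member (vectors i))
        independent : ∀ c → combination c vectors ≈ᴹ 0ᴹ → ∀ i → c i ≈ 0#
        spanning    : ∀ x → T (member x) → ∃ λ c → x ≈ᴹ combination c vectors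

  module _ {V : VectorSpace F} where

    open LeftModule V
    open Subspace
    open Sums +ᴹ-commutativeMonoid
    open LeftModuleProperties V
    open AbelianGroupProperties +ᴹ-abelianGroup using (⁻¹-∙-comm; ⁻¹-anti-homo‿-)

    infix 4 _∈_ _⊆_

    _∈_ : Carrierᴹ → Subspace V → Set
    x ∈ U = T (member U x)

    _⊆_ : Subspace V → Subspace V → Set
    U ⊆ W = ∀ x → x ∈ U → x ∈ W

    full : Subspace V
    full = record { member = λ _ → true ; resp = λ _ _ → tt ; 0-closed = tt
                  ; +-closed = λ _ _ → tt ; *-closed = λ _ _ → tt }

    combination-closed : ∀ U {r} (c : Vector F.Carrier r) b → (∀ i → b i ∈ U) → combination V c b ∈ U
    combination-closed U {zero}  c b h = 0-closed U
    combination-closed U {suc r} c b h =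
      +-closed U (*-closed U (c zero) (h zero)) (combination-closed U (c ∘ suc) (b ∘ suc) (h ∘ suc))

    combination-+* : ∀ {r} (c d : Vector F.Carrier r) a b →
      combination V c b +ᴹ a *ₗ combination V d b ≈ᴹ combination V (λ i → c i F.+ a F.* d i) b
    combination-+* {zero} c d a b = ≈ᴹ-trans (+ᴹ-identityˡ _) (*ₗ-zeroʳ a)
    combination-+* {suc r} c d a b = begin
      (c₀ +ᴹ cs) +ᴹ a *ₗ (d₀ +ᴹ ds)           ≈⟨ +ᴹ-congˡ (*ₗ-distribˡ a d₀ ds) ⟩
      (c₀ +ᴹ cs) +ᴹ (a *ₗ d₀ +ᴹ a *ₗ ds)      ≈⟨ interchange c₀ cs (a *ₗ d₀) (a *ₗ ds) ⟩
      (c₀ +ᴹ a *ₗ d₀) +ᴹ (cs +ᴹ a *ₗ ds)      ≈⟨ +ᴹ-cong step (combination-+* (c ∘ suc) (d ∘ suc) a (b ∘ suc)) ⟩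
      _                                       ∎
      where
      open SetoidReasoning ≈ᴹ-setoid
      c₀ = c zero *ₗ b zero
      d₀ = d zero *ₗ b zero
      cs = combination V (c ∘ suc) (b ∘ suc)
      ds = combination V (d ∘ suc) (b ∘ suc)
      interchange : ∀ w x y z → (w +ᴹ x) +ᴹ (y +ᴹ z) ≈ᴹ (w +ᴹ y) +ᴹ (x +ᴹ z)
      interchange = solve 4 (λ w x y z → (w ⊕ x) ⊕ (y ⊕ z) ⊜ (w ⊕ y) ⊕ (x ⊕ z)) ≈ᴹ-refl
        where open CommutativeMonoidSolver +ᴹ-commutativeMonoid
      step : c₀ +ᴹ a *ₗ d₀ ≈ᴹ (c zero F.+ a F.* d zero) *ₗ b zero
      step = ≈ᴹ-sym (≈ᴹ-trans (*ₗ-distribʳ (b zero) (c zero) (a F.* d zero))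
                              (+ᴹ-congˡ (*ₗ-assoc a (d zero) (b zero))))

    combination-cong : ∀ {r} {c d : Vector F.Carrier r} b → (∀ i → c i ≈ d i) →
                       combination V c b ≈ᴹ combination V d b
    combination-cong b h = sum-cong-≋ (λ i → *ₗ-congʳ (h i))

    combination-0 : ∀ {r} (c : Vector F.Carrier r) b → (∀ i → c i ≈ 0#) → combination V c b ≈ᴹ 0ᴹ
    combination-0 {r} c b h =
      ≈ᴹ-trans (sum-cong-≋ (λ i → ≈ᴹ-trans (*ₗ-congʳ (h i)) (*ₗ-zeroˡ (b i)))) (sum-replicate-zero r)

    cancel : ∀ a x → a *ₗ x +ᴹ (F.- a) *ₗ x ≈ᴹ 0ᴹ
    cancel a x = ≈ᴹ-trans (≈ᴹ-sym (*ₗ-distribʳ x a (F.- a)))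
                          (≈ᴹ-trans (*ₗ-congʳ (F.-‿inverseʳ a)) (*ₗ-zeroˡ x))

    neg-scale : ∀ a x → (F.- a) *ₗ x ≈ᴹ -ᴹ (a *ₗ x)
    neg-scale a x = inverseʳ-uniqueᴹ (a *ₗ x) _ (cancel a x)

    neg-closed : ∀ U {x} → x ∈ U → (-ᴹ x) ∈ U
    neg-closed U {x} h = resp U (≈ᴹ-trans (neg-scale 1# x) (-ᴹ‿cong (*ₗ-identityˡ x)))
                                (*-closed U (F.- 1#) h)

    ⊆-dec : ∀ {r} U W → Basis V U r → Dec (U ⊆ W)
    ⊆-dec U W B = map′
      (λ h x x∈U → let c , eq = spanning x x∈U in
        resp W (≈ᴹ-sym eq) (combination-closed W c vectors h))
      (λ h i → h _ (inside i))
      (Finₚ.all? (λ i → T? (member W (vectors i))))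
      where open Basis B

    -- The quotient space has the same vectors, with x and y identified
    -- when x - y ∈ P.
    quotient : Subspace V → VectorSpace F
    quotient P = record
      { Carrierᴹ = Carrierᴹ ; _≈ᴹ_ = _~_ ; _+ᴹ_ = _+ᴹ_ ; _*ₗ_ = _*ₗ_ ; 0ᴹ = 0ᴹ ; -ᴹ_ = -ᴹ_
      ; isLeftModule = record
        { isLeftSemimodule = record
          { +ᴹ-isCommutativeMonoid = record
            { isMonoid = record
              { isSemigroup = record
                { isMagma = record
                  { isEquivalence = record
                    { refl = ≈⇒~ ≈ᴹ-refl
                    ; sym = λ {x} {y} h → resp P (⁻¹-anti-homo‿- x y) (neg-closed P h)
                    ; trans = λ {x} {y} {z} h h′ → resp P (telescope x y z) (+-closed P h h′) }
                  ; ∙-cong = λ {x} {y} {u} {v} h h′ → resp P (difference-+ x y u v) (+-closed P h h′) }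
                ; assoc = λ x y z → ≈⇒~ (+ᴹ-assoc x y z) }
              ; identity = (λ x → ≈⇒~ (+ᴹ-identityˡ x)) , (λ x → ≈⇒~ (+ᴹ-identityʳ x)) }
            ; comm = λ x y → ≈⇒~ (+ᴹ-comm x y) }
          ; isPreleftSemimodule = record
            { *ₗ-cong = λ {a} {b} {x} {y} a≈b h → resp P (difference-* a b x y a≈b) (*-closed P a h)
            ; *ₗ-zeroˡ = λ x → ≈⇒~ (*ₗ-zeroˡ x)
            ; *ₗ-distribʳ = λ x a b → ≈⇒~ (*ₗ-distribʳ x a b)
            ; *ₗ-identityˡ = λ x → ≈⇒~ (*ₗ-identityˡ x)
            ; *ₗ-assoc = λ a b x → ≈⇒~ (*ₗ-assoc a b x)
            ; *ₗ-zeroʳ = λ a → ≈⇒~ (*ₗ-zeroʳ a)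
            ; *ₗ-distribˡ = λ a x y → ≈⇒~ (*ₗ-distribˡ a x y) } }
        ; -ᴹ‿cong = λ {x} {y} h → resp P (≈ᴹ-sym (⁻¹-∙-comm x (-ᴹ y))) (neg-closed P h)
        ; -ᴹ‿inverse = (λ x → ≈⇒~ (-ᴹ‿inverseˡ x)) , (λ x → ≈⇒~ (-ᴹ‿inverseʳ x)) } }
      where
      open SetoidReasoning ≈ᴹ-setoid
      open CommutativeMonoidSolver +ᴹ-commutativeMonoid

      _~_ : Carrierᴹ → Carrierᴹ → Set
      x ~ y = (x +ᴹ -ᴹ y) ∈ P

      ≈⇒~ : ∀ {x y} → x ≈ᴹ y → x ~ y
      ≈⇒~ {x} {y} h = resp P
        (≈ᴹ-sym (≈ᴹ-trans (+ᴹ-congʳ h) (-ᴹ‿inverseʳ y))) (0-closed P)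

      telescope : ∀ x y z → (x +ᴹ -ᴹ y) +ᴹ (y +ᴹ -ᴹ z) ≈ᴹ x +ᴹ -ᴹ z
      telescope x y z = begin
        (x +ᴹ -ᴹ y) +ᴹ (y +ᴹ -ᴹ z)   ≈⟨ solve 4 (λ a b c d → (a ⊕ b) ⊕ (c ⊕ d) ⊜ (a ⊕ d) ⊕ (b ⊕ c)) ≈ᴹ-refl x (-ᴹ y) y (-ᴹ z) ⟩
        (x +ᴹ -ᴹ z) +ᴹ (-ᴹ y +ᴹ y)   ≈⟨ +ᴹ-congˡ (-ᴹ‿inverseˡ y) ⟩
        (x +ᴹ -ᴹ z) +ᴹ 0ᴹ            ≈⟨ +ᴹ-identityʳ _ ⟩
        x +ᴹ -ᴹ z                    ∎

      difference-+ : ∀ x y u v → (x +ᴹ -ᴹ y) +ᴹ (u +ᴹ -ᴹ v) ≈ᴹ (x +ᴹ u) +ᴹ -ᴹ (y +ᴹ v)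
      difference-+ x y u v = begin
        (x +ᴹ -ᴹ y) +ᴹ (u +ᴹ -ᴹ v)   ≈⟨ solve 4 (λ a b c d → (a ⊕ b) ⊕ (c ⊕ d) ⊜ (a ⊕ c) ⊕ (b ⊕ d)) ≈ᴹ-refl x (-ᴹ y) u (-ᴹ v) ⟩
        (x +ᴹ u) +ᴹ (-ᴹ y +ᴹ -ᴹ v)   ≈⟨ +ᴹ-congˡ (⁻¹-∙-comm y v) ⟩
        (x +ᴹ u) +ᴹ -ᴹ (y +ᴹ v)      ∎

      scale-neg : ∀ a x → a *ₗ (-ᴹ x) ≈ᴹ -ᴹ (a *ₗ x)
      scale-neg a x = inverseʳ-uniqueᴹ (a *ₗ x) _ (begin
        a *ₗ x +ᴹ a *ₗ (-ᴹ x)        ≈⟨ *ₗ-distribˡ a x (-ᴹ x) ⟨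
        a *ₗ (x +ᴹ -ᴹ x)             ≈⟨ *ₗ-congˡ (-ᴹ‿inverseʳ x) ⟩
        a *ₗ 0ᴹ                      ≈⟨ *ₗ-zeroʳ a ⟩
        0ᴹ                           ∎)

      difference-* : ∀ a b x y → a ≈ b → a *ₗ (x +ᴹ -ᴹ y) ≈ᴹ a *ₗ x +ᴹ -ᴹ (b *ₗ y)
      difference-* a b x y a≈b = begin
        a *ₗ (x +ᴹ -ᴹ y)             ≈⟨ *ₗ-distribˡ a x (-ᴹ y) ⟩
        a *ₗ x +ᴹ a *ₗ (-ᴹ y)        ≈⟨ +ᴹ-congˡ (scale-neg a y) ⟩
        a *ₗ x +ᴹ -ᴹ (a *ₗ y)        ≈⟨ +ᴹ-congˡ (-ᴹ‿cong (*ₗ-congʳ a≈b)) ⟩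
        a *ₗ x +ᴹ -ᴹ (b *ₗ y)        ∎

    -- This is { u + P ∣ u ∈ U }, which for P ⊆ U has the members of U itself
    quotientSubspace : ∀ U P → P ⊆ U → Subspace (quotient P)
    quotientSubspace U P P⊆U = record
      { member = member U
      ; resp = λ {x} {y} h x∈U → resp U (back x y) (+-closed U x∈U (neg-closed U (P⊆U _ h)))
      ; 0-closed = 0-closed U ; +-closed = +-closed U ; *-closed = *-closed U }
      where
      back : ∀ x y → x +ᴹ -ᴹ (x +ᴹ -ᴹ y) ≈ᴹ y
      back x y = begin
        x +ᴹ -ᴹ (x +ᴹ -ᴹ y)   ≈⟨ +ᴹ-congˡ (⁻¹-anti-homo‿- x y) ⟩
        x +ᴹ (y +ᴹ -ᴹ x)      ≈⟨ solve 3 (λ a b c → a ⊕ (b ⊕ c) ⊜ b ⊕ (a ⊕ c)) ≈ᴹ-refl x y (-ᴹ x) ⟩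
        y +ᴹ (x +ᴹ -ᴹ x)      ≈⟨ +ᴹ-congˡ (-ᴹ‿inverseʳ x) ⟩
        y +ᴹ 0ᴹ               ≈⟨ +ᴹ-identityʳ y ⟩
        y                     ∎
        where
        open SetoidReasoning ≈ᴹ-setoid
        open CommutativeMonoidSolver +ᴹ-commutativeMonoid

    module Exchange {r} U P (BU : Basis V U r) (BP : Basis V P 1) (P⊆U : P ⊆ U) where
      open Basis BU using () renaming (vectors to b)

      p : Carrierᴹ
      p = Basis.vectors BP zero

      p∈P : p ∈ P
      p∈P = Basis.inside BP zero

      p≉0 : ¬ p ≈ᴹ 0ᴹ
      p≉0 h = F.0≉1 (F.sym (Basis.independent BP (λ _ → 1#)
        (≈ᴹ-trans (+ᴹ-identityʳ _) (≈ᴹ-trans (*ₗ-identityˡ p) h)) zero))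

      P-multiple : ∀ x → x ∈ P → ∃ λ a → x ≈ᴹ a *ₗ p
      P-multiple x h = let c , eq = Basis.spanning BP x h in c zero , ≈ᴹ-trans eq (+ᴹ-identityʳ _)

      c : Vector F.Carrier r
      c = proj₁ (Basis.spanning BU p (P⊆U p p∈P))

      p≈ : p ≈ᴹ combination V c b
      p≈ = proj₂ (Basis.spanning BU p (P⊆U p p∈P))

      pivot : Σ[ j ∈ Fin r ] ¬ c j ≈ 0#
      pivot with Finₚ.any? (λ j → ¬? (c j ≈? 0#))
      ... | yes h = h
      ... | no  h = ⊥-elim (p≉0 (≈ᴹ-trans p≈ (combination-0 c b
              (λ j → Dec.decidable-stable (c j ≈? 0#) (λ n → h (j , n))))))

      combination-add : ∀ {x} e a → x ≈ᴹ combination V e b →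
                        x +ᴹ a *ₗ p ≈ᴹ combination V (λ i → e i F.+ a F.* c i) b
      combination-add e a h = ≈ᴹ-trans (+ᴹ-cong h (*ₗ-congˡ p≈)) (combination-+* e c a b)

    quotient-basis : ∀ {r} U P → Basis V U r → Basis V P 1 → (P⊆U : P ⊆ U) →
                     Basis (quotient P) (quotientSubspace U P P⊆U) (r ∸ 1)
    quotient-basis {zero} U P BU BP P⊆U = ⊥-elim (Finₚ.¬Fin0 (proj₁ (Exchange.pivot U P BU BP P⊆U)))
    quotient-basis {suc r} U P BU BP P⊆U = record
      { vectors     = removeAt b j
      ; inside      = λ i → Basis.inside BU (punchIn j i)
      ; independent = independent
      ; spanning    = spanning }
      where
      open Exchange U P BU BP P⊆U
      open Basis BU using () renaming (vectors to b; independent to b-independent)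
      open RingProperties F.ring using (-0#≈0#; -‿distribˡ-*)

      j = proj₁ pivot
      cⱼ≉0 = proj₂ pivot

      c⁻¹ : F.Carrier
      c⁻¹ = proj₁ (F.inverse (c j) cⱼ≉0)

      cc⁻¹ : c j F.* c⁻¹ ≈ 1#
      cc⁻¹ = proj₂ (F.inverse (c j) cⱼ≉0)

      independent : ∀ d → LeftModule._≈ᴹ_ (quotient P) (combination V d (removeAt b j)) 0ᴹ →
                    ∀ i → d i ≈ 0#
      independent d h i = begin
        d i                                   ≈⟨ F.+-identityʳ (d i) ⟨
        d i F.+ 0#                            ≈⟨ F.+-congˡ (F.zeroˡ _) ⟨
        d i F.+ 0# F.* c (punchIn j i)        ≈⟨ F.+-congˡ (F.*-congʳ -a≈0) ⟨
        d i F.+ (F.- a) F.* c (punchIn j i)   ≡⟨ cong (F._+ ((F.- a) F.* c (punchIn j i))) (insertAt-punchIn d j 0# i) ⟨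
        e (punchIn j i)                       ≈⟨ e≈0 (punchIn j i) ⟩
        0#                                    ∎
        where
        open SetoidReasoning F.setoid
        multiple = P-multiple _ h
        a = proj₁ multiple

        d′ : Vector F.Carrier (suc r)
        d′ = insertAt d j 0#

        e : Vector F.Carrier (suc r)
        e i = d′ i F.+ (F.- a) F.* c i

        d′-combination : combination V d′ b ≈ᴹ a *ₗ p
        d′-combination = M.begin
          combination V d′ b                                          M.≈⟨ sum-remove {i = j} (λ i → d′ i *ₗ b i) ⟩
          d′ j *ₗ b j +ᴹ combination V (removeAt d′ j) (removeAt b j) M.≈⟨ +ᴹ-cong
            (≈ᴹ-trans (*ₗ-congʳ (F.reflexive (insertAt-lookup d j 0#))) (*ₗ-zeroˡ (b j)))
            (combination-cong (removeAt b j) (λ i → F.reflexive (insertAt-punchIn d j 0# i))) ⟩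
          0ᴹ +ᴹ combination V d (removeAt b j)                        M.≈⟨ +ᴹ-comm 0ᴹ _ ⟩
          combination V d (removeAt b j) +ᴹ 0ᴹ                        M.≈⟨ +ᴹ-congˡ -0≈0 ⟨
          combination V d (removeAt b j) +ᴹ -ᴹ 0ᴹ                     M.≈⟨ proj₂ multiple ⟩
          a *ₗ p                                                      M.∎
          where
          module M = SetoidReasoning ≈ᴹ-setoid
          -0≈0 : -ᴹ 0ᴹ ≈ᴹ 0ᴹ
          -0≈0 = ≈ᴹ-trans (≈ᴹ-sym (+ᴹ-identityˡ (-ᴹ 0ᴹ))) (-ᴹ‿inverseʳ 0ᴹ)

        e≈0 : ∀ i → e i ≈ 0#
        e≈0 = b-independent e (≈ᴹ-trans (≈ᴹ-sym (combination-add d′ (F.- a) ≈ᴹ-refl))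
                (≈ᴹ-trans (+ᴹ-congʳ d′-combination) (cancel a p)))

        -a≈0 : F.- a ≈ 0#
        -a≈0 = begin
          F.- a                          ≈⟨ F.*-identityʳ _ ⟨
          (F.- a) F.* 1#                 ≈⟨ F.*-congˡ cc⁻¹ ⟨
          (F.- a) F.* (c j F.* c⁻¹)      ≈⟨ F.*-assoc _ _ _ ⟨
          ((F.- a) F.* c j) F.* c⁻¹      ≈⟨ F.*-congʳ (F.+-identityˡ _) ⟨
          (0# F.+ (F.- a) F.* c j) F.* c⁻¹ ≡⟨ cong (λ z → (z F.+ (F.- a) F.* c j) F.* c⁻¹) (insertAt-lookup d j 0#) ⟨
          e j F.* c⁻¹                    ≈⟨ F.*-congʳ (e≈0 j) ⟩
          0# F.* c⁻¹                     ≈⟨ F.zeroˡ c⁻¹ ⟩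
          0#                             ∎

      spanning : ∀ x → x ∈ U → ∃ λ d → LeftModule._≈ᴹ_ (quotient P) x (combination V d (removeAt b j))
      spanning x x∈U = removeAt e′ j , resp P x-tp (*-closed P t p∈P)
        where
        e = proj₁ (Basis.spanning BU x x∈U)
        t = e j F.* c⁻¹

        e′ : Vector F.Carrier (suc r)
        e′ i = e i F.+ (F.- t) F.* c i

        e′ⱼ≈0 : e′ j ≈ 0#
        e′ⱼ≈0 = begin
          e j F.+ (F.- t) F.* c j               ≈⟨ F.+-congˡ (-‿distribˡ-* t (c j)) ⟨
          e j F.+ F.- ((e j F.* c⁻¹) F.* c j)   ≈⟨ F.+-congˡ (F.-‿cong (F.*-assoc _ _ _)) ⟩
          e j F.+ F.- (e j F.* (c⁻¹ F.* c j))   ≈⟨ F.+-congˡ (F.-‿cong (F.*-congˡ (F.trans (F.*-comm _ _) cc⁻¹))) ⟩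
          e j F.+ F.- (e j F.* 1#)              ≈⟨ F.+-congˡ (F.-‿cong (F.*-identityʳ _)) ⟩
          e j F.+ F.- e j                       ≈⟨ F.-‿inverseʳ _ ⟩
          0#                                    ∎
          where open SetoidReasoning F.setoid

        rest = combination V (removeAt e′ j) (removeAt b j)

        x-tp≈rest : x +ᴹ (F.- t) *ₗ p ≈ᴹ rest
        x-tp≈rest = begin
          x +ᴹ (F.- t) *ₗ p        ≈⟨ combination-add e (F.- t) (proj₂ (Basis.spanning BU x x∈U)) ⟩
          combination V e′ b       ≈⟨ sum-remove {i = j} (λ i → e′ i *ₗ b i) ⟩
          e′ j *ₗ b j +ᴹ rest      ≈⟨ +ᴹ-congʳ (≈ᴹ-trans (*ₗ-congʳ e′ⱼ≈0) (*ₗ-zeroˡ (b j))) ⟩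
          0ᴹ +ᴹ rest               ≈⟨ +ᴹ-identityˡ rest ⟩
          rest                     ∎
          where open SetoidReasoning ≈ᴹ-setoid

        x-tp : t *ₗ p ≈ᴹ x +ᴹ -ᴹ rest
        x-tp = begin
          t *ₗ p                                     ≈⟨ back x (t *ₗ p) ⟨
          x +ᴹ -ᴹ (x +ᴹ -ᴹ (t *ₗ p))                 ≈⟨ +ᴹ-congˡ (-ᴹ‿cong (+ᴹ-congˡ (neg-scale t p))) ⟨
          x +ᴹ -ᴹ (x +ᴹ (F.- t) *ₗ p)                ≈⟨ +ᴹ-congˡ (-ᴹ‿cong x-tp≈rest) ⟩
          x +ᴹ -ᴹ rest                               ∎
          where
          open SetoidReasoning ≈ᴹ-setoid
          back : ∀ x y → x +ᴹ -ᴹ (x +ᴹ -ᴹ y) ≈ᴹ y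
          back x y = ≈ᴹ-trans (+ᴹ-congˡ (⁻¹-anti-homo‿- x y))
            (≈ᴹ-trans (≈ᴹ-sym (+ᴹ-assoc x y (-ᴹ x)))
              (≈ᴹ-trans (+ᴹ-congʳ (+ᴹ-comm x y))
                (≈ᴹ-trans (+ᴹ-assoc y x (-ᴹ x))
                  (≈ᴹ-trans (+ᴹ-congˡ (-ᴹ‿inverseʳ x)) (+ᴹ-identityʳ y)))))

-- The two constructors are the cases q = 1 and q ≥ 2; in both, the last
-- argument says that the whole space has rank n.
data Ambient : Set₁ where
  finiteSet   : (X : Set) (n : ℕ) → Subsets.Size {X} Subsets.full n → Ambient
  vectorSpace : (F : FiniteField) (V : VectorSpace F) (n : ℕ) →
                Linear.Basis F V (Linear.full F) n → Ambient

rk : Ambient → ℕ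
rk (finiteSet _ n _)     = n
rk (vectorSpace _ _ n _) = n

Sub : Ambient → Set
Sub (finiteSet X _ _)     = Subsets.Subset X
Sub (vectorSpace F V _ _) = Linear.Subspace F V

HasRank : (W : Ambient) → Sub W → ℕ → Set
HasRank (finiteSet _ _ _)     U r = Subsets.Size U r
HasRank (vectorSpace F V _ _) U r = Linear.Basis F V U r

Inclusion : (W : Ambient) → Sub W → Sub W → Set
Inclusion (finiteSet _ _ _)     = Subsets._⊆_
Inclusion (vectorSpace F _ _ _) = Linear._⊆_ F

-- Two elements are regarded as the same subspace when they include each
-- other (Gr-setoid); the witness of the rank plays no role.
record Gr (W : Ambient) (k : ℕ) : Set where
  constructor gr
  field
    sub     : Sub W
    hasRank : HasRank W sub k

open Gr public

infix 4 _≤_ _≤?_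

_≤_ : ∀ {W i k} → Gr W i → Gr W k → Set
_≤_ {W} U K = Inclusion W (sub U) (sub K)

_≤?_ : ∀ {W i k} (U : Gr W i) (K : Gr W k) → Dec (U ≤ K)
_≤?_ {finiteSet _ _ _}     U K = Subsets.⊆-dec (sub U) (sub K) (hasRank U)
_≤?_ {vectorSpace F _ _ _} U K = Linear.⊆-dec F (sub U) (sub K) (hasRank U)

≤-refl : ∀ {W k} (K : Gr W k) → K ≤ K
≤-refl {finiteSet _ _ _}     K x h = h
≤-refl {vectorSpace _ _ _ _} K x h = h

≤-trans : ∀ {W i j k} (I : Gr W i) (J : Gr W j) (K : Gr W k) → I ≤ J → J ≤ K → I ≤ K
≤-trans {finiteSet _ _ _}     I J K p q x h = q x (p x h)
≤-trans {vectorSpace _ _ _ _} I J K p q x h = q x (p x h)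

Gr-setoid : Ambient → ℕ → Setoid 0ℓ 0ℓ
Gr-setoid W k = record
  { Carrier = Gr W k
  ; _≈_ = λ K L → (K ≤ L) × (L ≤ K)
  ; isEquivalence = record
    { refl  = λ {K} → ≤-refl K , ≤-refl K
    ; sym   = λ (p , q) → q , p
    ; trans = λ {K} {L} {M} (p , q) (p′ , q′) → ≤-trans K L M p p′ , ≤-trans M L K q′ q
    }
  }

infixl 7 _/_

_/_ : (W : Ambient) → Gr W 1 → Ambient
finiteSet X n e / P =
  finiteSet (Subsets.Minus (sub P)) (n ∸ 1)
    (Subsets.∖-size Subsets.full (sub P) e (hasRank P) (λ _ _ → tt))
vectorSpace F V n B / P =
  vectorSpace F (Linear.quotient F (sub P)) (n ∸ 1)
    (record { Linear.Basis (Linear.quotient-basis F (Linear.full F) (sub P) B (hasRank P) (λ _ _ → tt)) })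

quotientBy : ∀ {W k} (K : Gr W k) (P : Gr W 1) → P ≤ K → Gr (W / P) (k ∸ 1)
quotientBy {finiteSet _ _ _} (gr K e) (gr P p) P≤K =
  gr (K Subsets.∖ P) (Subsets.∖-size K P e p P≤K)
quotientBy {vectorSpace F _ _ _} (gr K B) (gr P p) P≤K =
  gr (Linear.quotientSubspace F K P P≤K) (Linear.quotient-basis F K P B p P≤K)

quotientBy-mono : ∀ {W k l} (K : Gr W k) (L : Gr W l) (P : Gr W 1) (P≤K : P ≤ K) (P≤L : P ≤ L) →
                  K ≤ L → quotientBy K P P≤K ≤ quotientBy L P P≤L
quotientBy-mono {finiteSet _ _ _}     K L P _ _ h (x , _) = h x
quotientBy-mono {vectorSpace _ _ _ _} K L P _ _ h x       = h x

open CommutativeRing ℝ-commutativeRing using ()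
  renaming (setoid to ℝ-setoid; refl to ≈ᴿ-refl; sym to ≈ᴿ-sym; trans to ≈ᴿ-trans)

open Sums (CommutativeRing.+-commutativeMonoid ℝ-commutativeRing) using () renaming (sum to ∑)

Fun : Ambient → ℕ → Set
Fun W k = Func (Gr-setoid W k) ℝ-setoid

infix 4 _≗_

_≗_ : ∀ {W k} → Fun W k → Fun W k → Set
f ≗ g = ∀ K → f ⟨$⟩ K ≈ᴿ g ⟨$⟩ K

𝟎 : ∀ {W k} → Fun W k
𝟎 = record { to = λ _ → 0ᴿ ; cong = λ _ → ≈ᴿ-refl {0ᴿ} }

ℝ^Gr : (W : Ambient) (k : ℕ) → RawLeftModule ℝ 0ℓ 0ℓ
ℝ^Gr W k = record
  { Carrierᴹ = Fun W k
  ; _≈ᴹ_ = _≗_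
  ; _+ᴹ_ = λ f g → record
    { to = λ K → (f ⟨$⟩ K) +ᴿ (g ⟨$⟩ K)
    ; cong = λ {K} {L} eq → R.+-cong {f ⟨$⟩ K} {f ⟨$⟩ L} {g ⟨$⟩ K} {g ⟨$⟩ L} (Func.cong f eq) (Func.cong g eq) }
  ; _*ₗ_ = λ a f → record
    { to = λ K → a *ᴿ (f ⟨$⟩ K)
    ; cong = λ {K} {L} eq → R.*-cong {a} {a} {f ⟨$⟩ K} {f ⟨$⟩ L} (≈ᴿ-refl {a}) (Func.cong f eq) }
  ; 0ᴹ = 𝟎
  ; -ᴹ_ = λ f → record
    { to = λ K → -ᴿ (f ⟨$⟩ K)
    ; cong = λ {K} {L} eq → R.-‿cong {f ⟨$⟩ K} {f ⟨$⟩ L} (Func.cong f eq) }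
  }
  where module R = CommutativeRing ℝ-commutativeRing

χ : ∀ {W i} k → Gr W i → Fun W k
χ {W} k U = record { to = λ K → indicator (U ≤? K) ; cong = λ {K} {L} → indicator-cong K L }
  where
  indicator : ∀ {A : Set} → Dec A → ℝ
  indicator d = if does d then 1ᴿ else 0ᴿ

  indicator-cong : ∀ (K L : Gr W k) → (K ≤ L) × (L ≤ K) → indicator (U ≤? K) ≈ᴿ indicator (U ≤? L)
  indicator-cong K L (p , q) with U ≤? K | U ≤? L
  ... | yes _ | yes _ = ≈ᴿ-refl {1ᴿ}
  ... | yes h | no ¬h = ⊥-elim (¬h (≤-trans U K L h p))
  ... | no ¬h | yes h = ⊥-elim (¬h (≤-trans U L K h q))
  ... | no _  | no _  = ≈ᴿ-refl {0ᴿ}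

InSpan : ∀ {W k} → ℕ → Fun W k → Set
InSpan {W} {k} i f =
  Σ[ r ∈ ℕ ] Σ[ I ∈ Vector (Gr W i) r ] Σ[ c ∈ Vector ℝ r ]
  ∀ K → f ⟨$⟩ K ≈ᴿ ∑ (λ j → c j *ᴿ (χ k (I j) ⟨$⟩ K))

-- f = Σ_I w(I) χ k I over all I of rank i; the inverse to Gr-setoid W i
-- lists every such I exactly once.
HasWeights : ∀ {W k} i → Fun W k → Fun W i → Set
HasWeights {W} {k} i f w =
  Σ[ N ∈ ℕ ] Σ[ I ∈ Inverse (≡.setoid (Fin N)) (Gr-setoid W i) ]
  ∀ K → f ⟨$⟩ K ≈ᴿ ∑ (λ j → (w ⟨$⟩ Inverse.to I j) *ᴿ (χ k (Inverse.to I j) ⟨$⟩ K))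

record IsWeightDistribution {W k} i (f : Fun W k) (w : Fun W i) : Set where
  field
    hasWeights : HasWeights i f w
    unique     : ∀ w′ → HasWeights i f w′ → w′ ≗ w

-- A relation rather than a function, since membership in a span of real
-- functions is not decidable; ⊥₋ is the degree -∞ of the zero function.
IsDegree : ∀ {W k} → Fun W k → ℕ ₋ → Set
IsDegree         f ⊥₋    = f ≗ 𝟎
IsDegree {W} {k} f [ t ] =
  ¬ f ≗ 𝟎 × t ℕ.≤ k ⊓ (rk W ∸ k) × InSpan t f × (∀ s → s ℕ.< t → ¬ InSpan s f)

suc₋ : ℕ ₋ → ℕ ₋
suc₋ = Maybe.map suc

infixl 7 _⊓₋_

_⊓₋_ : ℕ ₋ → ℕ → ℕ ₋
d ⊓₋ m = Maybe.map (_⊓ m) d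

max₀ : ℕ ₋ → ℕ
max₀ = fromMaybe 0

Support : ∀ {W k} → Fun W k → Gr W k → Set
Support g K = ¬ g ⟨$⟩ K ≈ᴿ 0ᴿ

Φ : ∀ {V} (P : Gr V 1) k → Fun (V / P) (k ∸ 1) → Fun V k
Φ {V} P k f = record { to = λ K → value K (P ≤? K) ; cong = λ {K} {L} → value-cong K L (P ≤? K) (P ≤? L) }
  where
  value : (K : Gr V k) → Dec (P ≤ K) → ℝ
  value K (yes P≤K) = f ⟨$⟩ quotientBy K P P≤K
  value K (no  P≰K) = 0ᴿ

  value-cong : ∀ K L (d : Dec (P ≤ K)) (d′ : Dec (P ≤ L)) → (K ≤ L) × (L ≤ K) → value K d ≈ᴿ value L d′
  value-cong K L (yes h) (yes h′) (p , q) =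
    Func.cong f (quotientBy-mono K L P h h′ p , quotientBy-mono L K P h′ h q)
  value-cong K L (yes h) (no ¬h)  (p , q) = ⊥-elim (¬h (≤-trans P K L h p))
  value-cong K L (no ¬h) (yes h)  (p , q) = ⊥-elim (¬h (≤-trans P L K h q))
  value-cong K L (no _)  (no _)   _       = ≈ᴿ-refl {0ᴿ}

{-# OPTIONS --safe #-}
module Submission where

-- The elements of a finite set and the vectors of a finite vector space are
-- treated alike, as points; a subspace of rank k has size k = k, resp. q ^ k,
-- points.  Counting incident pairs (point , hyperplane) shows that the number
-- of hyperplanes of J through I depends only on the ranks and strictly
-- decreases with that of I.  Hence the condition "t ∈ I" on I is a linear
-- combination of conditions "I ≤ H", H a hyperplane of J, and iterating this
-- recovers each weight of a series from its values (weights-vanish).  Dually,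
-- "K ≤ H" is a combination of conditions "x ∈ K", which expands every function
-- in rank n - k when n - k ≤ k (expansion-all).  For the theorem, Φ carries a
-- series on V / P to the series on V whose weights are extended by zero; and
-- conversely, a series for Φ(f) in a rank below n - k vanishes in all the
-- hyperplanes that avoid P, so that its weights live on subspaces through P.

open import Defs
open import Level using (0ℓ)
open import Algebra.Bundles using (CommutativeRing)
open import Algebra.Module.Bundles using (LeftModule)
open import Algebra.Module.Bundles.Raw using (RawLeftModule)
open import Algebra.Module.Morphism.Structures using (module LeftModuleMorphisms)
import Algebra.Properties.AbelianGroup as AbelianGroupProperties
import Algebra.Properties.CommutativeMonoid.Sum as CommutativeMonoidSum
import Algebra.Properties.Ring as RingProperties
import Algebra.Properties.Semiring.Mult as SemiringMult
import Algebra.Properties.Semiring.Sum as SemiringSum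
import Algebra.Solver.CommutativeMonoid as CommutativeMonoidSolver
open import Algebra.Structures using (IsCommutativeRing)
open import Data.Bool.Base using (Bool; true; false; T; _∨_; not; if_then_else_)
open import Data.Bool.Properties using (T?; T-∨)
open import Data.Empty using (⊥-elim)
open import Data.Fin.Base using (Fin; zero; suc; punchIn; funToFin; finToFun; combine)
import Data.Fin.Properties as Finₚ
open import Data.List.Base as List using (List; []; _∷_; length; allFin; filter; concatMap; deduplicate)
import Data.List.Properties as Listₚ
open import Data.List.Membership.Propositional using () renaming (_∈_ to _∈ₗ_)
import Data.List.Membership.Propositional.Properties as Memₚ
import Data.List.Membership.Setoid as SetoidMembership
import Data.List.Membership.Setoid.Properties as SetoidMembershipₚ
open import Data.List.Relation.Unary.All as All using (All; []; _∷_)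
import Data.List.Relation.Unary.All.Properties as Allₚ
open import Data.List.Relation.Unary.AllPairs using ([]; _∷_)
open import Data.List.Relation.Unary.Any as Any using (Any; here; there)
import Data.List.Relation.Unary.Any.Properties as Anyₚ
import Data.List.Relation.Unary.Unique.DecSetoid.Properties as UniqueDecₚ
import Data.List.Relation.Unary.Unique.Setoid as UniqueSetoid
open import Data.Nat.Base as ℕ using (ℕ; zero; suc; _∸_; _⊓_; z≤n; s≤s) renaming (_≤_ to _≤ℕ_; _<_ to _<ℕ_)
import Data.Nat.Properties as ℕₚ
open import Data.Product using (Σ-syntax; ∃; _×_; _,_; proj₁; proj₂)
open import Data.Rational.Base as ℚ using (ℚ; 0ℚ; 1ℚ; ½)
import Data.Rational.Properties as ℚₚ
open import Data.Sum.Base using (_⊎_; inj₁; inj₂)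
open import Data.Unit.Base using (tt)
open import Data.Vec.Functional using (Vector) renaming (_∷_ to _∷ᵥ_)
open import Function.Base using (_∘_)
open import Function.Bundles using (Func; Inverse; Equivalence; _↔_; _⇔_; _⟨$⟩_; mk↔ₛ′; mk⇔)
import Function.Construct.Identity as Identity
open import Relation.Binary.Bundles using (Setoid; DecSetoid)
open import Relation.Binary.PropositionalEquality as ≡ using (_≡_; refl; cong; cong₂; subst)
import Relation.Binary.Reasoning.Setoid as SetoidReasoning
open import Relation.Nullary using (Dec; yes; no; does; ¬_; ¬?)
open import Relation.Nullary.Construct.Add.Infimum using (_₋; ⊥₋; [_])
open import Relation.Nullary.Decidable using (_×-dec_; decidable-stable)

-- Counts are only ever divided by, so no Gaussian binomial is evaluated: it is enough that every
-- count is a unit, and each is built from differences of point numbers and their inverses. The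
-- combinatorics therefore runs over any commutative ring with invertible positive integers, and it
-- is never decided whether a real number is zero. The two halves of the degree formula meet at rank
-- n - k. In a rank s below it, s + k still fits into the rank n - 1 of a hyperplane, which is what
-- forces the weights of a series for `Φ(f)` onto subspaces through P; such a series then yields one
-- for f in rank s - 1, so minimality for f passes to `Φ(f)`. At s = n - k this argument stops, and
-- the expansion of arbitrary functions takes over. Rank 0 has to be treated apart, because no
-- subspace of rank 0 contains P: there f itself must vanish.

Enumeration : Setoid 0ℓ 0ℓ → Set
Enumeration S = Σ[ N ∈ ℕ ] Inverse (≡.setoid (Fin N)) S

finite : ∀ n → Enumeration (≡.setoid (Fin n))
finite n = n , Identity.inverse (≡.setoid (Fin n))

-- Indicators, units and finite sums in a commutative ring

module Sums (R : CommutativeRing 0ℓ 0ℓ) where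

  open CommutativeRing R hiding (refl; sym; trans; zero)
  private module R = CommutativeRing R
  open SemiringSum semiring
  open SemiringMult semiring public using () renaming (_×_ to _·_; ×-homo-+ to ·-homo-+)
  open AbelianGroupProperties +-abelianGroup using (∙-cancelˡ)
  open SetoidReasoning setoid

  opaque
    ι : ∀ {A : Set} → Dec A → Carrier
    ι d = if does d then 1# else 0#
    ι-unfold : ∀ {A : Set} (d : Dec A) → ι d ≈ (if does d then 1# else 0#)
    ι-unfold d = R.refl

    ι-yes : ∀ {A : Set} (d : Dec A) → A → ι d ≈ 1#
    ι-yes (yes _) _ = R.refl
    ι-yes (no ¬a) a = ⊥-elim (¬a a)
    ι-no : ∀ {A : Set} (d : Dec A) → ¬ A → ι d ≈ 0#
    ι-no (yes a) ¬a = ⊥-elim (¬a a)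
    ι-no (no _)  _  = R.refl
    ι-⇔ : ∀ {A B : Set} (d : Dec A) (e : Dec B) → (A → B) → (B → A) → ι d ≈ ι e
    ι-⇔ (yes a) e f _ = R.sym (ι-yes e (f a))
    ι-⇔ (no ¬a) e _ g = R.sym (ι-no e (¬a ∘ g))

  ι-yes-* : ∀ {A : Set} (d : Dec A) {x} → A → ι d * x ≈ x
  ι-yes-* d {x} a = R.trans (*-congʳ (ι-yes d a)) (*-identityˡ x)

  ι-no-* : ∀ {A : Set} (d : Dec A) {x} → ¬ A → ι d * x ≈ 0#
  ι-no-* d {x} ¬a = R.trans (*-congʳ (ι-no d ¬a)) (zeroˡ x)

  ι-*-cong : ∀ {A : Set} (d : Dec A) {x y} → (A → x ≈ y) → ι d * x ≈ ι d * y
  ι-*-cong (yes a) f = *-congˡ (f a)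
  ι-*-cong d@(no ¬a) f = R.trans (ι-no-* d ¬a) (R.sym (ι-no-* d ¬a))

  ι-split : ∀ {A : Set} (d : Dec A) x → ι d * x + ι (¬? d) * x ≈ x
  ι-split d@(yes a) x = R.trans (+-cong (ι-yes-* d a) (ι-no-* (¬? d) (λ ¬a → ¬a a))) (+-identityʳ x)
  ι-split d@(no ¬a) x = R.trans (+-cong (ι-no-* d ¬a) (ι-yes-* (¬? d) ¬a)) (+-identityˡ x)

  +-cancelˡ : ∀ x {y z} → x + y ≈ x + z → y ≈ z
  +-cancelˡ x {y} {z} = ∙-cancelˡ x y z

  *-swap : ∀ x y z → x * (y * z) ≈ y * (x * z)
  *-swap x y z = begin
    x * (y * z) ≈⟨ *-assoc x y z ⟨
    x * y * z   ≈⟨ *-congʳ (*-comm x y) ⟩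
    y * x * z   ≈⟨ *-assoc y x z ⟩
    y * (x * z) ∎

  -- The inverse is carried as data, so that division never requires a test for being nonzero.
  Unit : Carrier → Set
  Unit x = ∃ λ r → r * x ≈ 1#

  1-unit : Unit 1#
  1-unit = 1# , *-identityˡ 1#

  *-unit : ∀ {x y} → Unit x → Unit y → Unit (x * y)
  *-unit {x} {y} (r , rx) (s , sy) = s * r , (begin
    s * r * (x * y)   ≈⟨ *-assoc s r (x * y) ⟩
    s * (r * (x * y)) ≈⟨ *-congˡ (*-assoc r x y) ⟨
    s * (r * x * y)   ≈⟨ *-congˡ (*-congʳ rx) ⟩
    s * (1# * y)      ≈⟨ *-congˡ (*-identityˡ y) ⟩
    s * y             ≈⟨ sy ⟩
    1#                ∎)

  inverse-unit : ∀ {x} ((r , _) : Unit x) → Unit r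
  inverse-unit {x} (r , rx) = x , R.trans (*-comm x r) rx

  unit-cancel : ∀ {u x} → Unit u → u * x ≈ 0# → x ≈ 0#
  unit-cancel {u} {x} (r , ru) ux = begin
    x           ≈⟨ *-identityˡ x ⟨
    1# * x      ≈⟨ *-congʳ ru ⟨
    r * u * x   ≈⟨ *-assoc r u x ⟩
    r * (u * x) ≈⟨ *-congˡ ux ⟩
    r * 0#      ≈⟨ zeroʳ r ⟩
    0#          ∎

  unit-divide : ∀ {u x y} ((r , _) : Unit u) → u * x ≈ y → x ≈ r * y
  unit-divide {u} {x} {y} (r , ru) ux = begin
    x           ≈⟨ *-identityˡ x ⟨
    1# * x      ≈⟨ *-congʳ ru ⟨
    r * u * x   ≈⟨ *-assoc r u x ⟩
    r * (u * x) ≈⟨ *-congˡ ux ⟩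
    r * y       ∎

  private
    ∑-single′ : ∀ {n} (i : Fin n) (f : Fin n → Carrier) → (∀ j → ¬ j ≡ i → f j ≈ 0#) → sum f ≈ f i
    ∑-single′ {suc n} i f h = begin
      sum f                             ≈⟨ sum-remove {i = i} f ⟩
      f i + sum (λ j → f (punchIn i j)) ≈⟨ +-congˡ (sum-cong-≋ (λ j → h _ (Finₚ.punchInᵢ≢i i j))) ⟩
      f i + sum {n} (λ _ → 0#)          ≈⟨ +-congˡ (sum-replicate-zero n) ⟩
      f i + 0#                          ≈⟨ +-identityʳ (f i) ⟩
      f i                               ∎

  module _ {S : Setoid 0ℓ 0ℓ} where

    private module S = Setoid S

    opaque
      ∑ : Enumeration S → (S.Carrier → Carrier) → Carrier
      ∑ (_ , e) g = sum (λ j → g (Inverse.to e j))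

      ∑-unfold : ∀ e g → ∑ e g ≈ sum (λ j → g (Inverse.to (proj₂ e) j))
      ∑-unfold e g = R.refl

      ∑-cong : ∀ {e f g} → (∀ a → f a ≈ g a) → ∑ e f ≈ ∑ e g
      ∑-cong {_ , e} {f} {g} h =
        sum-cong-≋ {x = f ∘ Inverse.to e} {y = g ∘ Inverse.to e} (λ i → h (Inverse.to e i))

      ∑-*ˡ : ∀ {e} x f → ∑ e (λ a → x * f a) ≈ x * ∑ e f
      ∑-*ˡ {_ , e} x f = R.sym (*-distribˡ-sum x (f ∘ Inverse.to e))

      ∑-*ʳ : ∀ {e} x f → ∑ e (λ a → f a * x) ≈ ∑ e f * x
      ∑-*ʳ {_ , e} x f = R.sym (*-distribʳ-sum x (f ∘ Inverse.to e))

      ∑-+ : ∀ {e} f g → ∑ e (λ a → f a + g a) ≈ ∑ e f + ∑ e g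
      ∑-+ {_ , e} f g = ∑-distrib-+ (f ∘ Inverse.to e) (g ∘ Inverse.to e)

      ∑-zero : ∀ {e f} → (∀ a → f a ≈ 0#) → ∑ e f ≈ 0#
      ∑-zero {n , e} {f} h = R.trans (∑-cong {n , e} {f} {λ _ → 0#} h) (sum-replicate-zero n)

      ∑-single : ∀ {e} (g : S.Carrier → Carrier) a → (∀ {b} → b S.≈ a → g b ≈ g a) →
                 (∀ b → ¬ b S.≈ a → g b ≈ 0#) → ∑ e g ≈ g a
      ∑-single {_ , e} g a g-cong h = R.trans
        (∑-single′ (from a) (g ∘ to) (λ j j≢ → h (to j) (λ b≈a → j≢
          (≡.trans (≡.sym (strictlyInverseʳ j)) (from-cong b≈a)))))
        (g-cong (strictlyInverseˡ a))
        where open Inverse e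

  module _ {S T : Setoid 0ℓ 0ℓ} where

    private
      module S = Setoid S
      module T = Setoid T

    opaque
      unfolding ∑
      ∑-swap : ∀ {d : Enumeration S} {e : Enumeration T} (f : S.Carrier → T.Carrier → Carrier) →
               ∑ d (λ a → ∑ e (f a)) ≈ ∑ e (λ b → ∑ d (λ a → f a b))
      ∑-swap {_ , d} {_ , e} f = ∑-comm (λ i j → f (Inverse.to d i) (Inverse.to e j))

  module _ {S : Setoid 0ℓ 0ℓ} where

    private module S = Setoid S

    opaque
      unfolding ∑
      -- Two enumerations differ by the permutation `D.from ∘ E.to`. Needed because `HasWeights`
      -- lets every weight function come with an enumeration of its own.
      ∑-enumeration : ∀ (d e : Enumeration S) (g : S.Carrier → Carrier) →
                      (∀ {a b} → a S.≈ b → g a ≈ g b) → ∑ d g ≈ ∑ e g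
      ∑-enumeration d e g g-cong = R.sym (R.trans
        (sum-cong-≋ {x = λ i → g (E.to i)} {y = λ i → g (D.to (D.from (E.to i)))} (λ i → g-cong (S.sym (D.strictlyInverseˡ (E.to i)))))
        (R.sym (sum-permute (λ j → g (D.to j)) π)))
        where
        module D = Inverse (proj₂ d)
        module E = Inverse (proj₂ e)
        π : Fin (proj₁ e) ↔ Fin (proj₁ d)
        π = mk↔ₛ′ (D.from ∘ E.to) (E.from ∘ D.to)
          (λ j → ≡.trans (D.from-cong (E.strictlyInverseˡ (D.to j))) (D.strictlyInverseʳ j))
          (λ i → ≡.trans (E.from-cong (D.strictlyInverseˡ (E.to i))) (E.strictlyInverseʳ i))

  opaque
    unfolding ∑
    ∑-one : ∀ m → ∑ (finite m) (λ _ → 1#) ≈ m · 1#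
    ∑-one m = sum-replicate m

  -- Counts the pairs (x , l) with x = e l in two ways: a point satisfying A has exactly one
  -- preimage, any other point has none.
  ∑-image : ∀ {m n} {A : Fin n → Set} (A? : ∀ x → Dec (A x)) (e : Fin m → Fin n) →
            (∀ {l l′} → e l ≡ e l′ → l ≡ l′) → (∀ l → A (e l)) → (∀ x → A x → ∃ λ l → e l ≡ x) →
            ∑ (finite n) (λ x → ι (A? x)) ≈ m · 1#
  ∑-image {m} {n} {A} A? e injective inside onto = begin
    ∑ (finite n) (λ x → ι (A? x))                                 ≈⟨ ∑-cong (λ x → fibre x (A? x)) ⟨
    ∑ (finite n) (λ x → ∑ (finite m) (λ l → ι (x Finₚ.≟ e l)))    ≈⟨ ∑-swap (λ x l → ι (x Finₚ.≟ e l)) ⟩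
    ∑ (finite m) (λ l → ∑ (finite n) (λ x → ι (x Finₚ.≟ e l)))    ≈⟨ ∑-cong (λ l → R.trans
      (∑-single (λ x → ι (x Finₚ.≟ e l)) (e l) (λ { refl → R.refl }) (λ x → ι-no (x Finₚ.≟ e l)))
      (ι-yes (e l Finₚ.≟ e l) refl)) ⟩
    ∑ (finite m) (λ _ → 1#)                                       ≈⟨ ∑-one m ⟩
    m · 1#                                                        ∎
    where
    fibre : ∀ x (d : Dec (A x)) → ∑ (finite m) (λ l → ι (x Finₚ.≟ e l)) ≈ ι d
    fibre x d@(no ¬a) = R.trans (∑-zero (λ l → ι-no (x Finₚ.≟ e l) (λ { refl → ¬a (inside l) }))) (R.sym (ι-no d ¬a))
    fibre x d@(yes a) with onto x a
    ... | l , refl = R.trans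
      (∑-single (λ j → ι (e l Finₚ.≟ e j)) l (λ { refl → R.refl })
        (λ j j≢l → ι-no (e l Finₚ.≟ e j) (λ eq → j≢l (≡.sym (injective eq)))))
      (R.trans (ι-yes (e l Finₚ.≟ e l) refl) (R.sym (ι-yes d a)))

-- Points of subspaces: a common interface for both cases

-- Elements of the set (q = 1) and vectors (q ≥ 2) are numbered and treated
-- alike; size k is then k and q ^ k respectively.
record Points (W : Ambient) : Set₁ where
  infix 4 _∈_ _∈?_
  field
    number : ℕ
    size   : ℕ → ℕ
    size-< : ∀ k → size k <ℕ size (suc k)

  Point : Set
  Point = Fin number

  field
    _∈_  : ∀ {k} → Point → Gr W k → Set
    _∈?_ : ∀ {k} (x : Point) (K : Gr W k) → Dec (x ∈ K)

    ≤⇒∈ : ∀ {i k} (I : Gr W i) (K : Gr W k) → I ≤ K → ∀ x → x ∈ I → x ∈ K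

    members           : ∀ {k} → Gr W k → Fin (size k) → Point
    members-injective : ∀ {k} (K : Gr W k) {l l′} → members K l ≡ members K l′ → l ≡ l′
    members-∈         : ∀ {k} (K : Gr W k) l → members K l ∈ K
    members-onto      : ∀ {k} (K : Gr W k) x → x ∈ K → ∃ λ l → members K l ≡ x

    -- Besides `members`, which serves counting, a listing whose length is the rank itself: the
    -- number of points that must be prescribed to determine a subspace.
    generators   : ∀ {k} → Gr W k → Fin k → Point
    generators-∈ : ∀ {k} (K : Gr W k) l → generators K l ∈ K
    generated    : ∀ {i k} (I : Gr W i) (K : Gr W k) → (∀ l → generators I l ∈ K) → I ≤ K

    extend       : ∀ {k} (K : Gr W k) x → ¬ x ∈ K → Gr W (suc k)
    extend-≤     : ∀ {k} (K : Gr W k) x x∉K → K ≤ extend K x x∉K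
    extend-∈     : ∀ {k} (K : Gr W k) x x∉K → x ∈ extend K x x∉K
    extend-least : ∀ {k l} (K : Gr W k) x x∉K (L : Gr W l) → K ≤ L → x ∈ L → extend K x x∉K ≤ L
    -- The modular law K ∩ (J + x) ≤ (K ∩ J) + x for x in K, with M in the role of K ∩ J, phrased
    -- without presupposing that intersections have a rank.
    modular      : ∀ {j k m} (J : Gr W j) (K : Gr W k) (M : Gr W m) x x∉J x∉M →
                   x ∈ K → (∀ z → z ∈ K → z ∈ J → z ∈ M) →
                   ∀ y → y ∈ K → y ∈ extend J x x∉J → y ∈ extend M x x∉M

    bottom   : Gr W 0
    bottom-≤ : ∀ {k} (K : Gr W k) → bottom ≤ K
    top      : Gr W (rk W)
    ≤-top    : ∀ {k} (K : Gr W k) → K ≤ top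

module _ (S : DecSetoid 0ℓ 0ℓ) where

  open DecSetoid S hiding (refl)
  private
    open SetoidMembership setoid using () renaming (_∈_ to _∈ₛ_)
    open UniqueSetoid setoid using (Unique)

    lookup-index : ∀ {x xs} (p : x ∈ₛ xs) → List.lookup xs (Any.index p) ≈ x
    lookup-index (here eq) = sym eq
    lookup-index (there p) = lookup-index p

    lookup-≉ : ∀ {x xs} → All (λ y → ¬ x ≈ y) xs → ∀ j → ¬ x ≈ List.lookup xs j
    lookup-≉ (x≉y ∷ _) zero    = x≉y
    lookup-≉ (_ ∷ h)   (suc j) = lookup-≉ h j

    lookup-injective : ∀ {xs} → Unique xs → ∀ i j → List.lookup xs i ≈ List.lookup xs j → i ≡ j
    lookup-injective (_ ∷ _) zero    zero    _  = refl
    lookup-injective (h ∷ _) zero    (suc j) eq = ⊥-elim (lookup-≉ h j eq)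
    lookup-injective (h ∷ _) (suc i) zero    eq = ⊥-elim (lookup-≉ h i (sym eq))
    lookup-injective (_ ∷ u) (suc i) (suc j) eq = cong suc (lookup-injective u i j eq)

  enumerate : (xs : List Carrier) → (∀ x → x ∈ₛ xs) → Enumeration setoid
  enumerate xs complete = length ys , record
    { to = List.lookup ys
    ; from = λ x → Any.index (complete′ x)
    ; to-cong = λ { refl → Setoid.refl setoid }
    ; from-cong = λ {x} {y} x≈y → unique _ _
        (trans (lookup-index (complete′ x)) (trans x≈y (sym (lookup-index (complete′ y)))))
    ; inverse = (λ { {x} refl → lookup-index (complete′ x) })
              , (λ {i} {x} x≈ → unique _ i (trans (lookup-index (complete′ x)) x≈))
    }
    where
    ys = deduplicate _≟_ xs
    complete′ : ∀ x → x ∈ₛ ys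
    complete′ x = SetoidMembershipₚ.∈-deduplicate⁺ setoid _≟_
      (λ z≈y x≈y → trans x≈y (sym z≈y)) (complete x)
    unique : ∀ i j → List.lookup ys i ≈ List.lookup ys j → i ≡ j
    unique = lookup-injective (UniqueDecₚ.deduplicate-! S xs)

-- Ranks, spans, intersections and the finiteness of the subspaces

module Lattice {W : Ambient} (M : Points W) where

  open Points M public

  Gr-decSetoid : ℕ → DecSetoid 0ℓ 0ℓ
  Gr-decSetoid k = record
    { Carrier = Gr W k
    ; _≈_ = Setoid._≈_ (Gr-setoid W k)
    ; isDecEquivalence = record
      { isEquivalence = Setoid.isEquivalence (Gr-setoid W k)
      ; _≟_ = λ K L → (K ≤? L) ×-dec (L ≤? K) } }

  infix 4 _≅?_
  _≅?_ : ∀ {k} (K L : Gr W k) → Dec ((K ≤ L) × (L ≤ K))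
  _≅?_ {k} = DecSetoid._≟_ (Gr-decSetoid k)

  ∈⇒≤ : ∀ {i k} (I : Gr W i) (K : Gr W k) → (∀ x → x ∈ I → x ∈ K) → I ≤ K
  ∈⇒≤ I K h = generated I K (λ l → h _ (generators-∈ I l))

  size-injects : ∀ {i k} (I : Gr W i) (K : Gr W k) → I ≤ K → size i ≤ℕ size k
  size-injects {i} {k} I K I≤K = Finₚ.injective⇒≤ {f = λ l → proj₁ (preimage l)}
    (λ {l} {l′} eq → members-injective I (≡.trans (≡.sym (proj₂ (preimage l)))
      (≡.trans (cong (members K) eq) (proj₂ (preimage l′)))))
    where
    preimage : ∀ l → ∃ λ m → members K m ≡ members I l
    preimage l = members-onto K _ (≤⇒∈ I K I≤K _ (members-∈ I l))

  size-mono : ∀ {a b} → a ≤ℕ b → size a ≤ℕ size b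
  size-mono {a} {b} a≤b with ℕₚ.m≤n⇒m<n∨m≡n a≤b
  ... | inj₂ refl = ℕₚ.≤-refl
  ... | inj₁ (s≤s a≤b′) = ℕₚ.≤-trans (size-mono a≤b′) (ℕₚ.<⇒≤ (size-< _))

  size-strict : ∀ {a b} → a <ℕ b → size a <ℕ size b
  size-strict {a} a<b = ℕₚ.≤-trans (size-< a) (size-mono a<b)

  -- Ranks are compared by counting points: an inclusion injects the points of I into those of K,
  -- and `size` is strictly increasing. No exchange argument for bases is needed.
  rank-≤ : ∀ {i k} (I : Gr W i) (K : Gr W k) → I ≤ K → i ≤ℕ k
  rank-≤ {i} {k} I K I≤K with i ℕₚ.≤? k
  ... | yes i≤k = i≤k
  ... | no  i≰k = ⊥-elim (ℕₚ.<⇒≱ (size-strict (ℕₚ.≰⇒> i≰k)) (size-injects I K I≤K))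

  rank-≡ : ∀ {i k} (I : Gr W i) (K : Gr W k) → I ≤ K → K ≤ I → i ≡ k
  rank-≡ I K p q = ℕₚ.≤-antisym (rank-≤ I K p) (rank-≤ K I q)

  rank-<-extend : ∀ {i k} (I : Gr W i) (K : Gr W k) x → ¬ x ∈ I → I ≤ K → x ∈ K → i <ℕ k
  rank-<-extend I K x x∉I I≤K x∈K = rank-≤ (extend I x x∉I) K (extend-least I x x∉I K I≤K x∈K)

  -- A point of K outside I could be adjoined to I, giving rank i + 1 inside K.
  ≤-reverse : ∀ {i k} (I : Gr W i) (K : Gr W k) → I ≤ K → k ≤ℕ i → K ≤ I
  ≤-reverse I K I≤K k≤i = ∈⇒≤ K I (λ x x∈K → decidable-stable (x ∈? I)
    (λ x∉I → ℕₚ.<⇒≱ (rank-<-extend I K x x∉I I≤K x∈K) k≤i))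

  ≰⇒∃ : ∀ {i k} (I : Gr W i) (K : Gr W k) → ¬ I ≤ K → ∃ λ x → x ∈ I × ¬ x ∈ K
  ≰⇒∃ I K I≰K with Finₚ.any? (λ x → (x ∈? I) ×-dec ¬? (x ∈? K))
  ... | yes h = h
  ... | no ¬h = ⊥-elim (I≰K (∈⇒≤ I K (λ x x∈I →
                  decidable-stable (x ∈? K) (λ x∉K → ¬h (x , x∈I , x∉K)))))

  Within : ∀ {k} → Gr W k → List Point → Set
  Within K = All (_∈ K)

  within? : ∀ {k} (K : Gr W k) X → Dec (Within K X)
  within? K = All.all? (_∈? K)

  within-≤ : ∀ {i k} (I : Gr W i) (K : Gr W k) {X} → I ≤ K → Within I X → Within K X
  within-≤ I K I≤K = All.map (λ {x} → ≤⇒∈ I K I≤K x)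

  record Span (X : List Point) : Set where
    field
      {rank}   : ℕ
      span     : Gr W rank
      rank-≤-length : rank ≤ℕ length X
      contains : Within span X
      least    : ∀ {k} (K : Gr W k) → Within K X → span ≤ K

  spanOf : ∀ X → Span X
  spanOf [] = record { span = bottom ; rank-≤-length = z≤n ; contains = [] ; least = λ K _ → bottom-≤ K }
  spanOf (x ∷ X) with spanOf X
  ... | record { span = S ; rank-≤-length = s≤ ; contains = c ; least = l } with x ∈? S
  ...   | yes x∈S = record
    { span = S ; rank-≤-length = ℕₚ.m≤n⇒m≤1+n s≤ ; contains = x∈S ∷ c ; least = λ { K (_ ∷ h) → l K h } }
  ...   | no  x∉S = record
    { span = extend S x x∉S
    ; rank-≤-length = s≤s s≤
    ; contains = extend-∈ S x x∉S ∷ within-≤ S (extend S x x∉S) (extend-≤ S x x∉S) c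
    ; least = λ { K (h ∷ hs) → extend-least S x x∉S K (l K hs) h } }

  basis : ∀ {k} → Gr W k → List Point
  basis K = List.tabulate (generators K)

  basis-within : ∀ {k} (K : Gr W k) → Within K (basis K)
  basis-within K = Allₚ.tabulate⁺ (generators-∈ K)

  basis-generates : ∀ {i k} (I : Gr W i) (K : Gr W k) → Within K (basis I) → I ≤ K
  basis-generates I K h = generated I K (Allₚ.tabulate⁻ h)

  length-basis : ∀ {k} (K : Gr W k) → length (basis K) ≡ k
  length-basis K = Listₚ.length-tabulate (generators K)

  -- The span of the common points; being the least subspace that contains them, it lies in both J
  -- and K.
  meet : ∀ {j k} (J : Gr W j) (K : Gr W k) →
         Σ[ m ∈ ℕ ] Σ[ M ∈ Gr W m ] M ≤ K × M ≤ J × (∀ z → z ∈ K → z ∈ J → z ∈ M)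
  meet J K = rank , span , least K (All.map proj₁ both) , least J (All.map proj₂ both)
    , λ z z∈K z∈J → All.lookup contains (Memₚ.∈-filter⁺ P? (Memₚ.∈-allFin z) (z∈K , z∈J))
    where
    P? = λ x → (x ∈? K) ×-dec (x ∈? J)
    open Span (spanOf (filter P? (allFin number)))
    both = Allₚ.all-filter P? (allFin number)

  -- For x in K outside H, comparing ranks gives J ≤ H + x, so the modular law yields K = (K ∩ H) +
  -- x. Hence the intersection has rank exactly k.
  meet-hyperplane : ∀ {j k} (H : Gr W j) (J : Gr W (suc j)) (K : Gr W (suc k)) →
    H ≤ J → K ≤ J → ¬ K ≤ H → Σ[ M ∈ Gr W k ] M ≤ K × M ≤ H × (∀ z → z ∈ K → z ∈ H → z ∈ M)
  meet-hyperplane {j} {k} H J K H≤J K≤J K≰H with meet H K | ≰⇒∃ K H K≰H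
  ... | m , M , M≤K , M≤H , M-greatest | x , x∈K , x∉H with rank-≡ M+x K M+x≤K K≤M+x
    where
    x∉M : ¬ x ∈ M
    x∉M x∈M = x∉H (≤⇒∈ M H M≤H x x∈M)
    M+x = extend M x x∉M
    H+x = extend H x x∉H
    M+x≤K : M+x ≤ K
    M+x≤K = extend-least M x x∉M K M≤K x∈K
    J≤H+x : J ≤ H+x
    J≤H+x = ≤-reverse H+x J (extend-least H x x∉H J H≤J (≤⇒∈ K J K≤J x x∈K)) ℕₚ.≤-refl
    K≤M+x : K ≤ M+x
    K≤M+x = ∈⇒≤ K M+x (λ y y∈K → modular H K M x x∉H x∉M x∈K M-greatest y y∈K
      (≤⇒∈ J H+x J≤H+x y (≤⇒∈ K J K≤J y y∈K)))
  ...   | refl = M , M≤K , M≤H , M-greatest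

  private
    tuples : ℕ → List (List Point)
    tuples zero    = [] ∷ []
    tuples (suc k) = concatMap (λ X → List.map (_∷ X) (allFin number)) (tuples k)

    ∈-tuples : ∀ X → X ∈ₗ tuples (length X)
    ∈-tuples []      = here refl
    ∈-tuples (x ∷ X) = Memₚ.∈-concatMap⁺ _ (Any.map (λ { refl → Memₚ.∈-map⁺ (_∷ X) (Memₚ.∈-allFin x) }) (∈-tuples X))

    ofRank : ∀ {r} k → Gr W r → List (Gr W k)
    ofRank {r} k K with r ℕₚ.≟ k
    ... | yes refl = K ∷ []
    ... | no _     = []

    ofRank-refl : ∀ {k} (K : Gr W k) → K ∈ₗ ofRank k K
    ofRank-refl {k} K with k ℕₚ.≟ k
    ... | yes refl = here refl
    ... | no  k≢k  = ⊥-elim (k≢k refl)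

    -- Every subspace of rank k is the span of a k-tuple of points. Tuples spanning a smaller rank
    -- are dropped, and repetitions are removed later.
    candidates : ∀ k → List (Gr W k)
    candidates k = concatMap (λ X → ofRank k (Span.span (spanOf X))) (tuples k)

    complete : ∀ {k} (K : Gr W k) → Any (λ L → (K ≤ L) × (L ≤ K)) (candidates k)
    complete {k} K = Anyₚ.concat⁺ (Anyₚ.map⁺ (Any.map (λ { refl → found span S≤K K≤S }) K∈))
      where
      K∈ : basis K ∈ₗ tuples k
      K∈ = subst (λ l → basis K ∈ₗ tuples l) (length-basis K) (∈-tuples (basis K))
      open Span (spanOf (basis K))
      S≤K : span ≤ K
      S≤K = least K (basis-within K)
      K≤S : K ≤ span
      K≤S = basis-generates K span contains
      found : ∀ {r} (S : Gr W r) → S ≤ K → K ≤ S → Any (λ L → (K ≤ L) × (L ≤ K)) (ofRank k S)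
      found S S≤K K≤S with rank-≡ S K S≤K K≤S
      ... | refl = Any.map (λ { refl → K≤S , S≤K }) (ofRank-refl S)

  opaque
    enumeration : ∀ k → Enumeration (Gr-setoid W k)
    enumeration k = enumerate (Gr-decSetoid k) (candidates k) complete

-- Counting points and hyperplanes

module Counting (R : CommutativeRing 0ℓ 0ℓ)
                (invertible : ∀ n → Sums.Unit R (Sums._·_ R (suc n) (CommutativeRing.1# R)))
                {W : Ambient} (M : Points W) where

  open CommutativeRing R hiding (refl; sym; trans; zero)
  private module R = CommutativeRing R
  open Sums R
  open Lattice M
  open SetoidReasoning setoid

  points : Enumeration (≡.setoid Point)
  points = finite number

  -- The number of points of a subspace of rank k outside a subspace of it of rank s: k - s for sets
  -- and q ^ k - q ^ s for vector spaces.
  δ : ℕ → ℕ → Carrier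
  δ s k = (size k ∸ size s) · 1#

  δ-unit : ∀ {s k} → s <ℕ k → Unit (δ s k)
  δ-unit {s} {k} s<k with size k ∸ size s | ℕₚ.m<n⇒0<n∸m (size-strict s<k)
  ... | suc d | _ = invertible d

  size-δ : ∀ {s k} → s ≤ℕ k → size k · 1# ≈ size s · 1# + δ s k
  size-δ {s} {k} s≤k = R.trans (R.reflexive (cong (_· 1#) (≡.sym (ℕₚ.m+[n∸m]≡n (size-mono s≤k)))))
                               (·-homo-+ 1# (size s) (size k ∸ size s))

  δ-+ : ∀ {r s k} → r ≤ℕ s → s ≤ℕ k → δ r k ≈ δ r s + δ s k
  δ-+ {r} {s} {k} r≤s s≤k = +-cancelˡ (size r · 1#) (begin
    size r · 1# + δ r k           ≈⟨ size-δ (ℕₚ.≤-trans r≤s s≤k) ⟨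
    size k · 1#                   ≈⟨ size-δ s≤k ⟩
    size s · 1# + δ s k           ≈⟨ +-congʳ (size-δ r≤s) ⟩
    size r · 1# + δ r s + δ s k   ≈⟨ +-assoc _ _ _ ⟩
    size r · 1# + (δ r s + δ s k) ∎)

  ∑-∈ : ∀ {k} (K : Gr W k) → ∑ points (λ x → ι (x ∈? K)) ≈ size k · 1#
  ∑-∈ K = ∑-image (_∈? K) (members K) (members-injective K) (members-∈ K) (members-onto K)

  ∑-∉∈ : ∀ {s k} (S : Gr W s) (K : Gr W k) → S ≤ K →
         ∑ points (λ x → ι (¬? (x ∈? S)) * ι (x ∈? K)) ≈ δ s k
  ∑-∉∈ {s} {k} S K S≤K = +-cancelˡ (size s · 1#) (begin
    size s · 1# + outside                                ≈⟨ +-congʳ (∑-∈ S) ⟨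
    ∑ points (λ x → ι (x ∈? S)) + outside                     ≈⟨ ∑-+ (λ x → ι (x ∈? S)) _ ⟨
    ∑ points (λ x → ι (x ∈? S) + ι (¬? (x ∈? S)) * ι (x ∈? K)) ≈⟨ ∑-cong (λ x → +-congʳ (inside x)) ⟩
    ∑ points (λ x → ι (x ∈? S) * ι (x ∈? K) + ι (¬? (x ∈? S)) * ι (x ∈? K))
      ≈⟨ ∑-cong (λ x → ι-split (x ∈? S) (ι (x ∈? K))) ⟩
    ∑ points (λ x → ι (x ∈? K))                               ≈⟨ ∑-∈ K ⟩
    size k · 1#                                          ≈⟨ size-δ (rank-≤ S K S≤K) ⟩
    size s · 1# + δ s k                                  ∎)
    where
    outside = ∑ points (λ x → ι (¬? (x ∈? S)) * ι (x ∈? K))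
    inside : ∀ x → ι (x ∈? S) ≈ ι (x ∈? S) * ι (x ∈? K)
    inside x = R.trans (R.sym (*-identityʳ _))
      (ι-*-cong (x ∈? S) (λ x∈S → R.sym (ι-yes (x ∈? K) (≤⇒∈ S K S≤K x x∈S))))

  Respects : ∀ {i} → (Gr W i → Carrier) → Set
  Respects {i} w = ∀ (I J : Gr W i) → I ≤ J → J ≤ I → w I ≈ w J

  ι-≤-respectsʳ : ∀ {i k} (I : Gr W i) (K L : Gr W k) → K ≤ L → L ≤ K → ι (I ≤? K) ≈ ι (I ≤? L)
  ι-≤-respectsʳ I K L p q = ι-⇔ (I ≤? K) (I ≤? L) (λ h → ≤-trans I K L h p) (λ h → ≤-trans I L K h q)

  ι-≤-respectsˡ : ∀ {i k} (I J : Gr W i) (K : Gr W k) → I ≤ J → J ≤ I → ι (I ≤? K) ≈ ι (J ≤? K)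
  ι-≤-respectsˡ I J K p q = ι-⇔ (I ≤? K) (J ≤? K) (≤-trans J I K q) (≤-trans I J K p)

  ι-∈-respects : ∀ {k} x (K L : Gr W k) → K ≤ L → L ≤ K → ι (¬? (x ∈? K)) ≈ ι (¬? (x ∈? L))
  ι-∈-respects x K L p q = ι-⇔ (¬? (x ∈? K)) (¬? (x ∈? L)) (_∘ ≤⇒∈ L K q x) (_∘ ≤⇒∈ K L p x)

  ∑-Gr-single : ∀ {i} (g : Gr W i → Carrier) → Respects g → ∀ I →
                (∀ J → ¬ ((J ≤ I) × (I ≤ J)) → g J ≈ 0#) → ∑ (enumeration i) g ≈ g I
  ∑-Gr-single {i} g g-resp I = ∑-single g I (λ {J} (p , q) → g-resp J I p q)

  -- The number of hyperplanes of J through I, and of those among them that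
  -- avoid a given point outside I, depends on the rank i of I only.
  record Hyperplanes {j} (J : Gr W (suc j)) (i : ℕ) : Set where
    field
      through      : Carrier
      through-unit : Unit through
      ∑-through    : ∀ (I : Gr W i) → I ≤ J →
        ∑ (enumeration j) (λ H → ι (H ≤? J) * ι (I ≤? H)) ≈ through
      avoiding      : Carrier
      avoiding-unit : Unit avoiding
      ∑-avoiding    : ∀ (I : Gr W i) t → I ≤ J → t ∈ J → ¬ t ∈ I →
        ∑ (enumeration j) (λ H → ι (¬? (t ∈? H)) * (ι (H ≤? J) * ι (I ≤? H))) ≈ avoiding

  -- Induction on the gap d between the rank of I and that of a hyperplane of J. For d = 0 the only
  -- hyperplane through I is I itself; otherwise the count in rank i is reduced to the count in rank
  -- i + 1 by adjoining a point.
  hyperplanes : ∀ d i {j} (J : Gr W (suc j)) → d ℕ.+ i ≡ j → Hyperplanes J i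
  hyperplanes zero i J refl = record
    { through = 1# ; through-unit = 1-unit
    ; ∑-through = λ I I≤J → R.trans
        (∑-Gr-single (λ H → ι (H ≤? J) * ι (I ≤? H)) (resp I) I
          (λ H H≇I → R.trans (*-congˡ (ι-no (I ≤? H) (λ I≤H → H≇I (≤-reverse I H I≤H ℕₚ.≤-refl , I≤H)))) (zeroʳ _)))
        (one I I≤J)
    ; avoiding = 1# ; avoiding-unit = 1-unit
    ; ∑-avoiding = λ I t I≤J t∈J t∉I → R.trans
        (∑-Gr-single (λ H → ι (¬? (t ∈? H)) * (ι (H ≤? J) * ι (I ≤? H)))
          (λ H L p q → *-cong (ι-∈-respects t H L p q) (resp I H L p q)) I
          (λ H H≇I → R.trans (*-congˡ (R.trans (*-congˡ
            (ι-no (I ≤? H) (λ I≤H → H≇I (≤-reverse I H I≤H ℕₚ.≤-refl , I≤H)))) (zeroʳ _))) (zeroʳ _)))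
        (R.trans (ι-yes-* (¬? (t ∈? I)) t∉I) (one I I≤J))
    }
    where
    resp : ∀ I → Respects (λ H → ι (H ≤? J) * ι (I ≤? H))
    resp I H L p q = *-cong (ι-≤-respectsˡ H L J p q) (ι-≤-respectsʳ I H L p q)
    one : ∀ I → I ≤ J → ι (I ≤? J) * ι (I ≤? I) ≈ 1#
    one I I≤J = R.trans (ι-yes-* (I ≤? J) I≤J) (ι-yes (I ≤? I) (≤-refl I))
  hyperplanes (suc d) i {j} J d+i≡j = record
    -- The solution of δ i j * through = δ i (suc j) * c, where c counts the hyperplanes through a
    -- subspace of rank i + 1.
    { through = r * (δ i (suc j) * c)
    ; through-unit = *-unit (inverse-unit δ⁻¹) (*-unit (δ-unit (ℕₚ.m≤n⇒m≤1+n i<j)) through-unit)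
    ; ∑-through = λ I I≤J → unit-divide δ⁻¹ (double-count I I≤J)
    ; avoiding = r * (δ j (suc j) * c)
    ; avoiding-unit = *-unit (inverse-unit δ⁻¹) (*-unit (δ-unit (ℕₚ.n<1+n j)) through-unit)
    ; ∑-avoiding = ∑-avoiding′
    }
    where
    open Hyperplanes (hyperplanes d (suc i) J (≡.trans (ℕₚ.+-suc d i) d+i≡j)) renaming (through to c)

    i<j : i <ℕ j
    i<j = subst (i <ℕ_) d+i≡j (s≤s (ℕₚ.m≤n+m i d))

    δ⁻¹ = δ-unit i<j
    r = proj₁ δ⁻¹

    q : Gr W j → Carrier
    q H = ι (H ≤? J)

    through-extend : ∀ I t (t∉I : ¬ t ∈ I) → I ≤ J → t ∈ J →
      ∑ (enumeration j) (λ H → q H * (ι (I ≤? H) * ι (t ∈? H))) ≈ c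
    through-extend I t t∉I I≤J t∈J = R.trans (∑-cong (λ H → *-congˡ (both H)))
      (∑-through I+t (extend-least I t t∉I J I≤J t∈J))
      where
      I+t = extend I t t∉I
      both : ∀ H → ι (I ≤? H) * ι (t ∈? H) ≈ ι (I+t ≤? H)
      both H = begin
        ι (I ≤? H) * ι (t ∈? H)      ≈⟨ ι-*-cong (I ≤? H) (λ I≤H → ι-⇔ (t ∈? H) (I+t ≤? H)
                                          (extend-least I t t∉I H I≤H) (λ h → ≤⇒∈ I+t H h t (extend-∈ I t t∉I))) ⟩
        ι (I ≤? H) * ι (I+t ≤? H)    ≈⟨ *-comm _ _ ⟩
        ι (I+t ≤? H) * ι (I ≤? H)    ≈⟨ ι-*-cong (I+t ≤? H) (λ h → ι-yes (I ≤? H) (≤-trans I I+t H (extend-≤ I t t∉I) h)) ⟩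
        ι (I+t ≤? H) * 1#            ≈⟨ *-identityʳ _ ⟩
        ι (I+t ≤? H)                 ∎

    -- Both sides count the pairs (x , H) with x ∈ H, x ∉ I and I ≤ H ≤ J.
    double-count : ∀ I → I ≤ J → δ i j * ∑ (enumeration j) (λ H → q H * ι (I ≤? H)) ≈ δ i (suc j) * c
    double-count I I≤J = begin
      δ i j * ∑ (enumeration j) (λ H → q H * ι (I ≤? H))                  ≈⟨ ∑-*ˡ (δ i j) _ ⟨
      ∑ (enumeration j) (λ H → δ i j * (q H * ι (I ≤? H)))                ≈⟨ ∑-cong (λ H → expand H) ⟩
      ∑ (enumeration j) (λ H → ∑ points (λ x → ι (¬? (x ∈? I)) * (q H * (ι (I ≤? H) * ι (x ∈? H))))) ≈⟨ ∑-swap _ ⟩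
      ∑ points (λ x → ∑ (enumeration j) (λ H → ι (¬? (x ∈? I)) * (q H * (ι (I ≤? H) * ι (x ∈? H))))) ≈⟨ ∑-cong column ⟩
      ∑ points (λ x → ι (¬? (x ∈? I)) * ι (x ∈? J) * c)             ≈⟨ ∑-*ʳ c _ ⟩
      ∑ points (λ x → ι (¬? (x ∈? I)) * ι (x ∈? J)) * c             ≈⟨ *-congʳ (∑-∉∈ I J I≤J) ⟩
      δ i (suc j) * c                                          ∎
      where
      expand : ∀ H → δ i j * (q H * ι (I ≤? H)) ≈ ∑ points (λ x → ι (¬? (x ∈? I)) * (q H * (ι (I ≤? H) * ι (x ∈? H))))
      expand H = begin
        δ i j * (q H * ι (I ≤? H))       ≈⟨ *-swap _ _ _ ⟩
        q H * (δ i j * ι (I ≤? H))       ≈⟨ *-congˡ (*-comm _ _) ⟩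
        q H * (ι (I ≤? H) * δ i j)       ≈⟨ *-congˡ (ι-*-cong (I ≤? H) (λ I≤H → R.sym (∑-∉∈ I H I≤H))) ⟩
        q H * (ι (I ≤? H) * ∑ points (λ x → ι (¬? (x ∈? I)) * ι (x ∈? H))) ≈⟨ *-congˡ (∑-*ˡ _ _) ⟨
        q H * ∑ points (λ x → ι (I ≤? H) * (ι (¬? (x ∈? I)) * ι (x ∈? H))) ≈⟨ ∑-*ˡ _ _ ⟨
        ∑ points (λ x → q H * (ι (I ≤? H) * (ι (¬? (x ∈? I)) * ι (x ∈? H)))) ≈⟨ ∑-cong (λ x →
          R.trans (*-congˡ (*-swap _ _ _)) (*-swap _ _ _)) ⟩
        ∑ points (λ x → ι (¬? (x ∈? I)) * (q H * (ι (I ≤? H) * ι (x ∈? H)))) ∎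

      column : ∀ x → ∑ (enumeration j) (λ H → ι (¬? (x ∈? I)) * (q H * (ι (I ≤? H) * ι (x ∈? H))))
                   ≈ ι (¬? (x ∈? I)) * ι (x ∈? J) * c
      column x = begin
        ∑ (enumeration j) (λ H → ι (¬? (x ∈? I)) * (q H * (ι (I ≤? H) * ι (x ∈? H)))) ≈⟨ ∑-*ˡ _ _ ⟩
        ι (¬? (x ∈? I)) * ∑ (enumeration j) (λ H → q H * (ι (I ≤? H) * ι (x ∈? H)))
          ≈⟨ ι-*-cong (¬? (x ∈? I)) (λ x∉I → at x∉I (x ∈? J)) ⟩
        ι (¬? (x ∈? I)) * (ι (x ∈? J) * c)                                ≈⟨ *-assoc _ _ _ ⟨
        ι (¬? (x ∈? I)) * ι (x ∈? J) * c                                  ∎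
        where
        at : ¬ x ∈ I → (x∈?J : Dec (x ∈ J)) → ∑ (enumeration j) (λ H → q H * (ι (I ≤? H) * ι (x ∈? H))) ≈ ι x∈?J * c
        at x∉I d@(yes x∈J) = R.trans (through-extend I x x∉I I≤J x∈J) (R.sym (ι-yes-* d x∈J))
        at x∉I d@(no x∉J) = R.trans (∑-zero (λ H → R.trans
          (ι-*-cong (H ≤? J) (λ H≤J → R.trans (*-congˡ (ι-no (x ∈? H) (λ x∈H → x∉J (≤⇒∈ H J H≤J x x∈H)))) (zeroʳ _)))
          (zeroʳ _))) (R.sym (ι-no-* d x∉J))

    -- All hyperplanes through I, less the c of them that pass through I + t. Splitting δ i (suc j)
    -- into δ i j + δ j (suc j) makes the first part cancel against c, so the difference appears as
    -- a product of units instead of a subtraction.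
    ∑-avoiding′ : ∀ I t → I ≤ J → t ∈ J → ¬ t ∈ I →
      ∑ (enumeration j) (λ H → ι (¬? (t ∈? H)) * (q H * ι (I ≤? H))) ≈ r * (δ j (suc j) * c)
    ∑-avoiding′ I t I≤J t∈J t∉I = +-cancelˡ c (begin
      c + ∑ (enumeration j) (λ H → ι (¬? (t ∈? H)) * (q H * ι (I ≤? H)))
        ≈⟨ +-congʳ (through-extend I t t∉I I≤J t∈J) ⟨
      ∑ (enumeration j) (λ H → q H * (ι (I ≤? H) * ι (t ∈? H)))
        + ∑ (enumeration j) (λ H → ι (¬? (t ∈? H)) * (q H * ι (I ≤? H)))
        ≈⟨ ∑-+ _ _ ⟨
      ∑ (enumeration j) (λ H → q H * (ι (I ≤? H) * ι (t ∈? H)) + ι (¬? (t ∈? H)) * (q H * ι (I ≤? H)))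
        ≈⟨ ∑-cong (λ H → R.trans (+-congʳ (R.trans (R.sym (*-assoc _ _ _)) (*-comm _ _))) (ι-split (t ∈? H) _)) ⟩
      ∑ (enumeration j) (λ H → q H * ι (I ≤? H))
        ≈⟨ unit-divide δ⁻¹ (double-count I I≤J) ⟩
      r * (δ i (suc j) * c)
        ≈⟨ *-congˡ (*-congʳ (δ-+ (ℕₚ.<⇒≤ i<j) (ℕₚ.n≤1+n j))) ⟩
      r * ((δ i j + δ j (suc j)) * c)
        ≈⟨ *-congˡ (distribʳ _ _ _) ⟩
      r * (δ i j * c + δ j (suc j) * c)
        ≈⟨ distribˡ _ _ _ ⟩
      r * (δ i j * c) + r * (δ j (suc j) * c)
        ≈⟨ +-congʳ (R.trans (R.sym (*-assoc _ _ _)) (R.trans (*-congʳ (proj₂ δ⁻¹)) (*-identityˡ c))) ⟩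
      c + r * (δ j (suc j) * c) ∎)

-- Series: existence of expansions and vanishing of their weights

module Expansions (R : CommutativeRing 0ℓ 0ℓ)
                (invertible : ∀ n → Sums.Unit R (Sums._·_ R (suc n) (CommutativeRing.1# R)))
                {W : Ambient} (M : Points W) where

  open CommutativeRing R hiding (refl; sym; trans; zero)
  private module R = CommutativeRing R
  open Sums R
  open Lattice M
  open Counting R invertible M
  open SetoidReasoning setoid

  series : ∀ {i k} → (Gr W i → Carrier) → Gr W k → Carrier
  series {i} w K = ∑ (enumeration i) (λ I → w I * ι (I ≤? K))

  series-cong : ∀ {i k} {v w : Gr W i → Carrier} (K : Gr W k) → (∀ I → v I ≈ w I) → series v K ≈ series w K
  series-cong K h = ∑-cong (λ I → *-congʳ (h I))

  series-*ˡ : ∀ {i k} c (w : Gr W i → Carrier) (K : Gr W k) → series (λ I → c * w I) K ≈ c * series w K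
  series-*ˡ c w K = R.trans (∑-cong (λ I → *-assoc c (w I) (ι (I ≤? K)))) (∑-*ˡ c (λ I → w I * ι (I ≤? K)))

  series-+ : ∀ {i k} (v w : Gr W i → Carrier) (K : Gr W k) →
             series (λ I → v I + w I) K ≈ series v K + series w K
  series-+ v w K = R.trans (∑-cong (λ I → distribʳ (ι (I ≤? K)) (v I) (w I)))
                           (∑-+ (λ I → v I * ι (I ≤? K)) (λ I → w I * ι (I ≤? K)))

  series-∑ : ∀ {S : Setoid 0ℓ 0ℓ} {e : Enumeration S} {i k} (w : Setoid.Carrier S → Gr W i → Carrier) (K : Gr W k) →
             series (λ I → ∑ e (λ a → w a I)) K ≈ ∑ e (λ a → series (w a) K)
  series-∑ w K = R.trans (∑-cong (λ I → R.sym (∑-*ʳ (ι (I ≤? K)) (λ a → w a I))))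
                         (∑-swap (λ I a → w a I * ι (I ≤? K)))

  -- Membership in the span of the characteristic functions of rank i, with the coefficients given
  -- as one function on all subspaces of that rank. They can thus be added, restricted to subspaces
  -- through P, or extended by zero.
  record Expansion {k} i (f : Gr W k → Carrier) : Set where
    field
      weights  : Gr W i → Carrier
      respects : Respects weights
      expands  : ∀ K → f K ≈ series weights K

  open Expansion

  module _ {k i : ℕ} where

    expansion-≈ : {f g : Gr W k → Carrier} → (∀ K → f K ≈ g K) → Expansion i g → Expansion i f
    expansion-≈ f≈g e = record
      { weights = weights e ; respects = respects e ; expands = λ K → R.trans (f≈g K) (expands e K) }

    expansion-*ˡ : ∀ c {f : Gr W k → Carrier} → Expansion i f → Expansion i (λ K → c * f K)
    expansion-*ˡ c e = record
      { weights = λ I → c * weights e I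
      ; respects = λ I J p q → *-congˡ (respects e I J p q)
      ; expands = λ K → R.trans (*-congˡ (expands e K)) (R.sym (series-*ˡ c (weights e) K)) }

    expansion-+ : ∀ {f g : Gr W k → Carrier} → Expansion i f → Expansion i g → Expansion i (λ K → f K + g K)
    expansion-+ d e = record
      { weights = λ I → weights d I + weights e I
      ; respects = λ I J p q → +-cong (respects d I J p q) (respects e I J p q)
      ; expands = λ K → R.trans (+-cong (expands d K) (expands e K))
                                (R.sym (series-+ (weights d) (weights e) K)) }

    expansion-∑ : ∀ {S : Setoid 0ℓ 0ℓ} {e : Enumeration S} {f : Setoid.Carrier S → Gr W k → Carrier} →
                  (∀ a → Expansion i (f a)) → Expansion i (λ K → ∑ e (λ a → f a K))
    expansion-∑ E = record
      { weights = λ I → ∑ _ (λ a → weights (E a) I)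
      ; respects = λ I J p q → ∑-cong (λ a → respects (E a) I J p q)
      ; expands = λ K → R.trans (∑-cong (λ a → expands (E a) K)) (R.sym (series-∑ (λ a → weights (E a)) K)) }

    expansion-0 : Expansion {k} i (λ _ → 0#)
    expansion-0 = record
      { weights = λ _ → 0# ; respects = λ _ _ _ _ → R.refl
      ; expands = λ K → R.sym (∑-zero (λ I → zeroˡ (ι (I ≤? K)))) }

    expansion-χ : ∀ (I : Gr W i) → Expansion {k} i (λ K → ι (I ≤? K))
    expansion-χ I = record
      { weights = λ J → ι (J ≅? I)
      ; respects = λ J L p q → ι-⇔ (J ≅? I) (L ≅? I)
          (λ (a , b) → ≤-trans L J I q a , ≤-trans I J L b p) (λ (a , b) → ≤-trans J L I p a , ≤-trans I L J b q)
      ; expands = λ K → R.sym (R.trans (∑-single (λ J → ι (J ≅? I) * ι (J ≤? K)) I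
          (λ { {J} (p , q) → *-cong
                (ι-⇔ (J ≅? I) (I ≅? I) (λ _ → ≤-refl I , ≤-refl I) (λ _ → p , q))
                (ι-≤-respectsˡ J I K p q) })
          (λ J J≇I → ι-no-* (J ≅? I) J≇I))
          (ι-yes-* (I ≅? I) (≤-refl I , ≤-refl I))) }

  -- A subspace K above S has δ i k points x outside S, each with S + x ≤ K, while no S + x lies in
  -- K unless S does. So the characteristic function of S is the sum of those of all S + x, divided
  -- by δ i k, which is a unit because i < k.
  expansion-suc : ∀ {k i} {f : Gr W k → Carrier} → i <ℕ k → Expansion i f → Expansion (suc i) f
  expansion-suc {k} {i} {f} i<k E = expansion-≈ (expands E) (expansion-∑ (λ S → expansion-*ˡ (weights E S) (χ-up S)))
    where
    δ⁻¹ = δ-unit i<k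

    above : (S : Gr W i) (x : Point) → Dec (x ∈ S) → Gr W k → Carrier
    above S x (yes _)  K = 0#
    above S x (no x∉S) K = ι (extend S x x∉S ≤? K)

    above-expansion : ∀ S x d → Expansion (suc i) (above S x d)
    above-expansion S x (yes _)  = expansion-0
    above-expansion S x (no x∉S) = expansion-χ (extend S x x∉S)

    above-≤ : ∀ S x d K → S ≤ K → ι (¬? d) * ι (x ∈? K) ≈ above S x d K
    above-≤ S x d@(yes x∈S) K S≤K = ι-no-* (¬? d) (λ x∉S → x∉S x∈S)
    above-≤ S x d@(no x∉S)  K S≤K = R.trans (ι-yes-* (¬? d) x∉S)
      (ι-⇔ (x ∈? K) (extend S x x∉S ≤? K) (extend-least S x x∉S K S≤K)
        (λ h → ≤⇒∈ (extend S x x∉S) K h x (extend-∈ S x x∉S)))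

    above-≰ : ∀ S x d K → ¬ S ≤ K → above S x d K ≈ 0#
    above-≰ S x (yes _)  K S≰K = R.refl
    above-≰ S x (no x∉S) K S≰K = ι-no (extend S x x∉S ≤? K)
      (λ h → S≰K (≤-trans S (extend S x x∉S) K (extend-≤ S x x∉S) h))

    count : ∀ S K (d : Dec (S ≤ K)) → δ i k * ι d ≈ ∑ points (λ x → above S x (x ∈? S) K)
    count S K d@(yes S≤K) = begin
      δ i k * ι d                                         ≈⟨ R.trans (*-comm _ _) (ι-yes-* d S≤K) ⟩
      δ i k                                               ≈⟨ ∑-∉∈ S K S≤K ⟨
      ∑ points (λ x → ι (¬? (x ∈? S)) * ι (x ∈? K))       ≈⟨ ∑-cong (λ x → above-≤ S x (x ∈? S) K S≤K) ⟩
      ∑ points (λ x → above S x (x ∈? S) K)               ∎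
    count S K d@(no S≰K) = begin
      δ i k * ι d                                         ≈⟨ R.trans (*-comm _ _) (ι-no-* d S≰K) ⟩
      0#                                                  ≈⟨ ∑-zero (λ x → above-≰ S x (x ∈? S) K S≰K) ⟨
      ∑ points (λ x → above S x (x ∈? S) K)               ∎

    χ-up : ∀ S → Expansion (suc i) (λ K → ι (S ≤? K))
    χ-up S = expansion-≈ (λ K → unit-divide δ⁻¹ (count S K (S ≤? K)))
      (expansion-*ˡ (proj₁ δ⁻¹) (expansion-∑ (λ x → above-expansion S x (x ∈? S))))

  expansion-up : ∀ {k i j} {f : Gr W k → Carrier} → i ≤ℕ j → j ≤ℕ k → Expansion i f → Expansion j f
  expansion-up {j = zero} z≤n _ E = E
  expansion-up {i = i} {suc j} i≤j j<k E with ℕₚ.m≤n⇒m<n∨m≡n i≤j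
  ... | inj₂ refl      = E
  ... | inj₁ (s≤s i≤j′) = expansion-suc j<k (expansion-up i≤j′ (ℕₚ.<⇒≤ j<k) E)

  ι-within-∷ : ∀ {k} (K : Gr W k) x X → ι (within? K (x ∷ X)) ≈ ι (x ∈? K) * ι (within? K X)
  ι-within-∷ K x X = by (x ∈? K)
    where
    by : (d : Dec (x ∈ K)) → ι (within? K (x ∷ X)) ≈ ι d * ι (within? K X)
    by d@(yes h) = R.trans (ι-⇔ (within? K (x ∷ X)) (within? K X) (λ { (_ ∷ hs) → hs }) (h ∷_)) (R.sym (ι-yes-* d h))
    by d@(no ¬h) = R.trans (ι-no (within? K (x ∷ X)) (λ { (h ∷ _) → ¬h h })) (R.sym (ι-no-* d ¬h))

  -- The indicator of {K | X ⊆ K ≤ J} expands in rank i as soon as the corank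
  -- c of J is at most i - |X|: for a hyperplane H of J, the failure of K ≤ H is
  -- measured by the number of points of K outside H.
  expansion-interval : ∀ {k i} c {j} (J : Gr W j) X → j ℕ.+ c ≡ rk W → c ℕ.+ length X ≤ℕ i → i ≤ℕ k →
    Expansion {k} i (λ K → ι (within? K X) * ι (K ≤? J))
  expansion-interval {k} {i} zero J X j+0≡n X≤i i≤k =
    expansion-≈ (λ K → R.trans (*-comm _ _) (R.trans (ι-yes-* (K ≤? J) (K≤J K))
        (ι-⇔ (within? K X) (span ≤? K) (least K) (λ h → within-≤ span K h contains))))
      (expansion-up (ℕₚ.≤-trans rank-≤-length X≤i) i≤k (expansion-χ span))
    where
    open Span (spanOf X)
    top≤J : top ≤ J
    top≤J = ≤-reverse J top (≤-top J) (ℕₚ.≤-reflexive (≡.trans (≡.sym j+0≡n) (ℕₚ.+-identityʳ _)))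
    K≤J : ∀ K → K ≤ J
    K≤J K = ≤-trans K top J (≤-top K) top≤J
  expansion-interval {zero} (suc c) J X _ c≤i i≤k = ⊥-elim (ℕₚ.n≮0 (ℕₚ.≤-trans c≤i i≤k))
  expansion-interval {suc k} {i} (suc c) {j} H X j+c≡n c≤i i≤k =
    expansion-≈ (λ K → difference K (K ≤? J)) (expansion-+
      (expansion-interval c J X (≡.trans (≡.sym (ℕₚ.+-suc j c)) j+c≡n) (ℕₚ.<⇒≤ c≤i) i≤k)
      (expansion-*ˡ (- δ⁻¹) (expansion-∑ (λ x → expansion-*ˡ (ι (¬? (x ∈? H)))
        (expansion-interval c J (x ∷ X) (≡.trans (≡.sym (ℕₚ.+-suc j c)) j+c≡n)
          (subst (_≤ℕ i) (≡.sym (ℕₚ.+-suc c (length X))) c≤i) i≤k)))))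
    where
    outside : ∃ λ x → x ∈ top × ¬ x ∈ H
    outside = ≰⇒∃ top H (λ top≤H → ℕₚ.<⇒≱ (ℕₚ.m<m+n j ℕ.z<s) (subst (_≤ℕ j) (≡.sym j+c≡n) (rank-≤ top H top≤H)))
    J : Gr W (suc j)
    J = extend H (proj₁ outside) (proj₂ (proj₂ outside))
    H≤J : H ≤ J
    H≤J = extend-≤ H _ _

    δ-inverse = δ-unit (ℕₚ.n<1+n k)
    δ⁻¹ = proj₁ δ-inverse

    f : Gr W (suc k) → Carrier
    f K = ι (within? K X)

    -- If K is not inside H, then it meets H in a hyperplane M of K, and its points outside H are
    -- its points outside M. There are δ k (suc k) of these whatever K is, so dividing by that
    -- constant gives exactly 1.
    detected : ∀ K → K ≤ J → (d : Dec (K ≤ H)) →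
      ι d + δ⁻¹ * ∑ points (λ x → ι (¬? (x ∈? H)) * ι (x ∈? K)) ≈ 1#
    detected K K≤J d@(yes K≤H) = begin
      ι d + δ⁻¹ * ∑ points (λ x → ι (¬? (x ∈? H)) * ι (x ∈? K)) ≈⟨ +-cong (ι-yes d K≤H) (*-congˡ (∑-zero (λ x →
          R.trans (ι-*-cong (¬? (x ∈? H)) (λ x∉H → ι-no (x ∈? K) (x∉H ∘ ≤⇒∈ K H K≤H x))) (zeroʳ _)))) ⟩
      1# + δ⁻¹ * 0#   ≈⟨ +-congˡ (zeroʳ δ⁻¹) ⟩
      1# + 0#         ≈⟨ +-identityʳ 1# ⟩
      1#              ∎
    detected K K≤J d@(no K≰H) with meet-hyperplane H J K H≤J K≤J K≰H
    ... | M , M≤K , M≤H , M-greatest = begin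
      ι d + δ⁻¹ * ∑ points (λ x → ι (¬? (x ∈? H)) * ι (x ∈? K)) ≈⟨ +-cong (ι-no d K≰H) (*-congˡ (∑-cong same)) ⟩
      0# + δ⁻¹ * ∑ points (λ x → ι (¬? (x ∈? M)) * ι (x ∈? K))  ≈⟨ +-identityˡ _ ⟩
      δ⁻¹ * ∑ points (λ x → ι (¬? (x ∈? M)) * ι (x ∈? K))       ≈⟨ *-congˡ (∑-∉∈ M K M≤K) ⟩
      δ⁻¹ * δ k (suc k)                                       ≈⟨ proj₂ δ-inverse ⟩
      1#                                                     ∎
      where
      same : ∀ x → ι (¬? (x ∈? H)) * ι (x ∈? K) ≈ ι (¬? (x ∈? M)) * ι (x ∈? K)
      same x = R.trans (*-comm _ _) (R.trans (ι-*-cong (x ∈? K) (λ x∈K →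
        ι-⇔ (¬? (x ∈? H)) (¬? (x ∈? M)) (_∘ ≤⇒∈ M H M≤H x) (_∘ M-greatest x x∈K))) (*-comm _ _))

    cancel : ∀ a b c d → c + d ≈ 1# → a * c ≈ a * 1# + - d * a
    cancel a b c d c+d = begin
      a * c                     ≈⟨ +-identityʳ _ ⟨
      a * c + 0#                ≈⟨ +-congˡ (-‿inverseʳ (a * d)) ⟨
      a * c + (a * d + - (a * d)) ≈⟨ +-assoc _ _ _ ⟨
      a * c + a * d + - (a * d)   ≈⟨ +-congʳ (distribˡ a c d) ⟨
      a * (c + d) + - (a * d)     ≈⟨ +-cong (*-congˡ c+d) (-‿cong (*-comm a d)) ⟩
      a * 1# + - (d * a)          ≈⟨ +-congˡ (-‿distribˡ-* d a) ⟩
      a * 1# + - d * a            ∎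
      where open RingProperties ring using (-‿distribˡ-*)

    difference : ∀ K (d : Dec (K ≤ J)) → f K * ι (K ≤? H) ≈
      f K * ι d + (- δ⁻¹) * ∑ points (λ x → ι (¬? (x ∈? H)) * (ι (within? K (x ∷ X)) * ι d))
    difference K d@(yes K≤J) = begin
      f K * ι (K ≤? H) ≈⟨ cancel (f K) 0# (ι (K ≤? H)) _ (detected K K≤J (K ≤? H)) ⟩
      f K * 1# + - (δ⁻¹ * s) * f K     ≈⟨ +-cong (*-congˡ (R.sym (ι-yes d K≤J)))
        (R.trans (*-congʳ (-‿distribˡ-* δ⁻¹ s)) (R.trans (*-assoc _ _ _) (*-congˡ (R.trans (R.sym (∑-*ʳ (f K) _)) (∑-cong (λ x →
          R.trans (*-assoc _ _ _) (*-congˡ (R.trans (R.sym (ι-within-∷ K x X)) (R.sym (R.trans (*-comm _ _) (ι-yes-* d K≤J))))))))))) ⟩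
      f K * ι d + (- δ⁻¹) * ∑ points (λ x → ι (¬? (x ∈? H)) * (ι (within? K (x ∷ X)) * ι d)) ∎
      where
      s = ∑ points (λ x → ι (¬? (x ∈? H)) * ι (x ∈? K))
      open RingProperties ring using (-‿distribˡ-*)
    difference K d@(no K≰J) = begin
      f K * ι (K ≤? H) ≈⟨ *-congˡ (ι-no (K ≤? H) (λ K≤H → K≰J (≤-trans K H J K≤H H≤J))) ⟩
      f K * 0#         ≈⟨ zeroʳ _ ⟩
      0#               ≈⟨ +-identityʳ 0# ⟨
      0# + 0#          ≈⟨ +-cong (R.trans (*-congˡ (ι-no d K≰J)) (zeroʳ _)) (R.trans (*-congˡ (∑-zero (λ x →
                            R.trans (*-congˡ (R.trans (*-congˡ (ι-no d K≰J)) (zeroʳ _))) (zeroʳ _)))) (zeroʳ _)) ⟨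
      f K * ι d + (- δ⁻¹) * ∑ points (λ x → ι (¬? (x ∈? H)) * (ι (within? K (x ∷ X)) * ι d)) ∎

  -- f is the sum of f(J) times the indicator of K = J. As K and J have equal rank, that indicator
  -- is the one of K ≤ J, and J has corank i.
  expansion-all : ∀ {k i} → k ℕ.+ i ≡ rk W → i ≤ℕ k → (f : Gr W k → Carrier) → Respects f → Expansion i f
  expansion-all {k} {i} k+i≡n i≤k f f-resp = expansion-≈ (λ K → R.sym (delta K))
    (expansion-∑ (λ J → expansion-*ˡ (f J)
      (expansion-interval i J [] k+i≡n (ℕₚ.≤-reflexive (ℕₚ.+-identityʳ i)) i≤k)))
    where
    delta : ∀ K → ∑ (enumeration k) (λ J → f J * (ι (within? K []) * ι (K ≤? J))) ≈ f K
    delta K = R.trans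
      (∑-single (λ J → f J * (ι (within? K []) * ι (K ≤? J))) K
        (λ { {J} (p , q) → *-cong (f-resp J K p q) (*-congˡ (ι-≤-respectsʳ K J K p q)) })
        (λ J J≇K → R.trans (*-congˡ (R.trans (*-congˡ
          (ι-no (K ≤? J) (λ K≤J → J≇K (≤-reverse K J K≤J ℕₚ.≤-refl , K≤J)))) (zeroʳ _))) (zeroʳ _)))
      (R.trans (*-congˡ (R.trans (ι-yes-* (within? K []) []) (ι-yes (K ≤? K) (≤-refl K)))) (*-identityʳ _))

  module _ {i k j₀} (J₀ : Gr W j₀) {w : Gr W i → Carrier} (w-resp : Respects w) (i≤k : i ≤ℕ k)
           (vanishes : ∀ (K : Gr W k) → K ≤ J₀ → series w K ≈ 0#) where

    private
      exchange : ∀ {j} (q : Gr W j → Carrier) (v : Gr W i → Carrier) →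
        ∑ (enumeration j) (λ H → q H * series v H) ≈
        ∑ (enumeration i) (λ I → v I * ∑ (enumeration j) (λ H → q H * ι (I ≤? H)))
      exchange q v = begin
        ∑ _ (λ H → q H * series v H)                         ≈⟨ ∑-cong (λ H → ∑-*ˡ (q H) (λ I → v I * ι (I ≤? H))) ⟨
        ∑ _ (λ H → ∑ _ (λ I → q H * (v I * ι (I ≤? H))))     ≈⟨ ∑-swap (λ H I → q H * (v I * ι (I ≤? H))) ⟩
        ∑ _ (λ I → ∑ _ (λ H → q H * (v I * ι (I ≤? H))))     ≈⟨ ∑-cong (λ I → R.trans
          (∑-cong (λ H → *-swap (q H) (v I) (ι (I ≤? H)))) (∑-*ˡ (v I) (λ H → q H * ι (I ≤? H)))) ⟩
        ∑ _ (λ I → v I * ∑ _ (λ H → q H * ι (I ≤? H)))       ∎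

      -- Vanishing propagates upwards: summing the series over all hyperplanes of J counts every I ≤
      -- J the same number of times, `through`, and this number is a unit.
      series-above : ∀ d (J : Gr W (d ℕ.+ k)) → J ≤ J₀ → series w J ≈ 0#
      series-above zero    J J≤J₀ = vanishes J J≤J₀
      series-above (suc d) J J≤J₀ = unit-cancel through-unit (begin
        through * series w J   ≈⟨ ∑-*ˡ through (λ I → w I * ι (I ≤? J)) ⟨
        ∑ _ (λ I → through * (w I * ι (I ≤? J))) ≈⟨ ∑-cong (λ I → R.trans (*-swap _ _ _) (*-congˡ (term I (I ≤? J)))) ⟩
        ∑ _ (λ I → w I * ∑ _ (λ H → ι (H ≤? J) * ι (I ≤? H))) ≈⟨ exchange (λ H → ι (H ≤? J)) w ⟨
        ∑ _ (λ H → ι (H ≤? J) * series w H) ≈⟨ ∑-zero (λ H → R.trans (ι-*-cong (H ≤? J)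
          (λ H≤J → series-above d H (≤-trans H J J₀ H≤J J≤J₀))) (zeroʳ _)) ⟩
        0# ∎)
        where
        i≤j : i ≤ℕ d ℕ.+ k
        i≤j = ℕₚ.≤-trans i≤k (ℕₚ.m≤n+m k d)
        open Hyperplanes (hyperplanes (d ℕ.+ k ∸ i) i J (ℕₚ.m∸n+n≡m i≤j))
        term : ∀ I (e : Dec (I ≤ J)) → through * ι e ≈ ∑ _ (λ H → ι (H ≤? J) * ι (I ≤? H))
        term I e@(yes I≤J) = R.trans (*-comm _ _) (R.trans (ι-yes-* e I≤J) (R.sym (∑-through I I≤J)))
        term I e@(no I≰J) = R.trans (*-comm _ _) (R.trans (ι-no-* e I≰J) (R.sym (∑-zero (λ H →
          R.trans (ι-*-cong (H ≤? J) (λ H≤J → ι-no (I ≤? H) (λ I≤H → I≰J (≤-trans I H J I≤H H≤J)))) (zeroʳ _)))))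

      restricted : List Point → Gr W i → Carrier
      restricted X I = ι (within? I X) * w I

      -- For I ≤ J, the condition that t is not in I is, up to the unit `avoiding`, the number of
      -- hyperplanes H of J through I that miss t. The terms with t not in I therefore add up to
      -- series over smaller subspaces H, which vanish by induction. Each point of X costs one rank
      -- of J, hence the bound.
      series-restricted : ∀ X {j} (J : Gr W j) → J ≤ J₀ → length X ℕ.+ k ≤ℕ j → series (restricted X) J ≈ 0#
      series-restricted [] {j} J J≤J₀ k≤j with j ∸ k | ℕₚ.m∸n+n≡m k≤j
      ... | d | refl = R.trans (series-cong J (λ I → ι-yes-* (within? I []) [])) (series-above d J J≤J₀)
      series-restricted (t ∷ X) {suc j} J J≤J₀ (s≤s X≤j) = by (t ∈? J)
        where
        v = restricted X
        drop : ∀ I → restricted (t ∷ X) I ≈ ι (t ∈? I) * v I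
        drop I = R.trans (*-congʳ (ι-within-∷ I t X)) (*-assoc _ _ _)
        i≤j : i ≤ℕ j
        i≤j = ℕₚ.≤-trans i≤k (ℕₚ.≤-trans (ℕₚ.m≤n+m k (length X)) X≤j)
        open Hyperplanes (hyperplanes (j ∸ i) i J (ℕₚ.m∸n+n≡m i≤j))
        q : Gr W j → Carrier
        q H = ι (¬? (t ∈? H)) * ι (H ≤? J)
        γ⁻¹ = proj₁ avoiding-unit
        missing : ∀ I → t ∈ J → (d : Dec (t ∈ I)) (e : Dec (I ≤ J)) →
          ∑ (enumeration j) (λ H → ι (¬? (t ∈? H)) * (ι (H ≤? J) * ι (I ≤? H))) ≈ avoiding * (ι (¬? d) * ι e)
        missing I t∈J d e@(no I≰J) = R.trans (∑-zero (λ H → R.trans (*-congˡ (R.trans (ι-*-cong (H ≤? J)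
            (λ H≤J → ι-no (I ≤? H) (λ I≤H → I≰J (≤-trans I H J I≤H H≤J)))) (zeroʳ _))) (zeroʳ _)))
          (R.sym (R.trans (*-congˡ (R.trans (*-congˡ (ι-no e I≰J)) (zeroʳ _))) (zeroʳ _)))
        missing I t∈J d@(yes t∈I) e = R.trans (∑-zero (λ H → R.trans (ι-*-cong (¬? (t ∈? H))
            (λ t∉H → R.trans (*-congˡ (ι-no (I ≤? H) (λ I≤H → t∉H (≤⇒∈ I H I≤H t t∈I)))) (zeroʳ _))) (zeroʳ _)))
          (R.sym (R.trans (*-congˡ (ι-no-* (¬? d) (λ t∉I → t∉I t∈I))) (zeroʳ _)))
        missing I t∈J d@(no t∉I) e@(yes I≤J) = R.trans (∑-avoiding I t I≤J t∈J t∉I)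
          (R.sym (R.trans (*-congˡ (R.trans (ι-yes-* (¬? d) t∉I) (ι-yes e I≤J))) (*-identityʳ _)))

        by : Dec (t ∈ J) → series (restricted (t ∷ X)) J ≈ 0#
        by (no t∉J) = ∑-zero (λ I → R.trans (*-comm _ _) (R.trans (ι-*-cong (I ≤? J) (λ I≤J → R.trans (drop I)
          (ι-no-* (t ∈? I) (λ t∈I → t∉J (≤⇒∈ I J I≤J t t∈I))))) (zeroʳ _)))
        by (yes t∈J) = begin
          series (restricted (t ∷ X)) J                             ≈⟨ +-identityʳ _ ⟨
          series (restricted (t ∷ X)) J + 0#                        ≈⟨ +-cong (series-cong J drop) (R.sym rest) ⟩
          series (λ I → ι (t ∈? I) * v I) J + series (λ I → ι (¬? (t ∈? I)) * v I) J ≈⟨ series-+ _ _ J ⟨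
          series (λ I → ι (t ∈? I) * v I + ι (¬? (t ∈? I)) * v I) J ≈⟨ series-cong J (λ I → ι-split (t ∈? I) (v I)) ⟩
          series v J                                               ≈⟨ series-restricted X J J≤J₀ (ℕₚ.m≤n⇒m≤1+n X≤j) ⟩
          0#                                                       ∎
          where
          rest : series (λ I → ι (¬? (t ∈? I)) * v I) J ≈ 0#
          rest = unit-cancel avoiding-unit (begin
            avoiding * series (λ I → ι (¬? (t ∈? I)) * v I) J ≈⟨ ∑-*ˡ avoiding _ ⟨
            ∑ _ (λ I → avoiding * (ι (¬? (t ∈? I)) * v I * ι (I ≤? J))) ≈⟨ ∑-cong (λ I → R.trans
              (*-congˡ (R.trans (*-congʳ (*-comm _ _)) (*-assoc _ _ _))) (R.trans (*-swap _ _ _)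
              (*-congˡ (R.sym (missing I t∈J (t ∈? I) (I ≤? J)))))) ⟩
            ∑ _ (λ I → v I * ∑ _ (λ H → ι (¬? (t ∈? H)) * (ι (H ≤? J) * ι (I ≤? H)))) ≈⟨ ∑-cong (λ I →
              *-congˡ (∑-cong (λ H → *-assoc (ι (¬? (t ∈? H))) (ι (H ≤? J)) (ι (I ≤? H))))) ⟨
            ∑ _ (λ I → v I * ∑ _ (λ H → q H * ι (I ≤? H))) ≈⟨ exchange q v ⟨
            ∑ _ (λ H → q H * series v H) ≈⟨ ∑-zero (λ H → R.trans (*-assoc _ _ _) (R.trans (*-congˡ (R.trans
              (ι-*-cong (H ≤? J) (λ H≤J → series-restricted X H (≤-trans H J J₀ H≤J J≤J₀) X≤j)) (zeroʳ _))) (zeroʳ _))) ⟩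
            0# ∎)

    -- Restricting to the subspaces that contain the i basis points of T leaves only T, since all of
    -- them have rank i; the restricted series in J₀ is then w(T) alone.
    weights-vanish : i ℕ.+ k ≤ℕ j₀ → ∀ (T : Gr W i) → T ≤ J₀ → w T ≈ 0#
    weights-vanish i+k≤j₀ T T≤J₀ = begin
      w T                             ≈⟨ at-T ⟨
      restricted X T * ι (T ≤? J₀)    ≈⟨ ∑-single (λ I → restricted X I * ι (I ≤? J₀)) T
        (λ { {I} (p , q) → *-cong (*-cong (ι-⇔ (within? I X) (within? T X) (within-≤ I T p) (within-≤ T I q))
                                          (w-resp I T p q)) (ι-≤-respectsˡ I T J₀ p q) })
        (λ I I≇T → R.trans (*-congʳ (ι-no-* (within? I X) (λ h → I≇T
          (≤-reverse T I (basis-generates T I h) ℕₚ.≤-refl , basis-generates T I h)))) (zeroˡ _)) ⟨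
      series (restricted X) J₀        ≈⟨ series-restricted X J₀ (≤-refl J₀)
                                           (subst (λ l → l ℕ.+ k ≤ℕ j₀) (≡.sym (length-basis T)) i+k≤j₀) ⟩
      0#                              ∎
      where
      X = basis T
      at-T : restricted X T * ι (T ≤? J₀) ≈ w T
      at-T = R.trans (*-comm _ _) (R.trans (ι-yes-* (T ≤? J₀) T≤J₀) (ι-yes-* (within? T X) (basis-within T)))

-- The points of a finite set

T-does⁺ : ∀ {A : Set} (d : Dec A) → A → T (does d)
T-does⁺ (yes _) _ = tt
T-does⁺ (no ¬a) a = ¬a a

T-does⁻ : ∀ {A : Set} (d : Dec A) → T (does d) → A
T-does⁻ (yes a) _ = a

mkSize : ∀ {X : Set} {r} (U : Subsets.Subset X) (f : Fin r → X) → (∀ {i j} → f i ≡ f j → i ≡ j) →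
         (∀ i → T (U (f i))) → (∀ x → T (U x) → ∃ λ i → f i ≡ x) → Subsets.Size U r
mkSize U f injective inside onto = mk↔ₛ′
  (λ i → f i , inside i) (λ (x , x∈U) → proj₁ (onto x x∈U))
  (λ (x , x∈U) → Subsets.∈-≡ {B = U} (proj₂ (onto x x∈U)))
  (λ i → injective (proj₂ (onto (f i) (inside i))))

module FiniteSet (X : Set) (n : ℕ) (e : Subsets.Size {X} Subsets.full n) where

  open Subsets using (Subset; Size; ∈-≡)

  W : Ambient
  W = finiteSet X n e

  point : Fin n → X
  point m = proj₁ (Inverse.to e m)

  index : X → Fin n
  index x = Inverse.from e (x , tt)

  point-index : ∀ x → point (index x) ≡ x
  point-index x = cong proj₁ (Inverse.strictlyInverseˡ e (x , tt))

  index-point : ∀ m → index (point m) ≡ m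
  index-point = Inverse.strictlyInverseʳ e

  _∈_ : ∀ {k} → Fin n → Gr W k → Set
  m ∈ K = T (sub K (point m))

  listing : ∀ {k} → Gr W k → Fin k → X
  listing K l = proj₁ (Inverse.to (hasRank K) l)

  listing-injective : ∀ {k} (K : Gr W k) {l l′} → listing K l ≡ listing K l′ → l ≡ l′
  listing-injective K {l} {l′} eq = ≡.trans (≡.sym (strictlyInverseʳ l))
    (≡.trans (cong from (∈-≡ {B = sub K} eq)) (strictlyInverseʳ l′))
    where open Inverse (hasRank K)

  listing-∈ : ∀ {k} (K : Gr W k) l → T (sub K (listing K l))
  listing-∈ K l = proj₂ (Inverse.to (hasRank K) l)

  listing-onto : ∀ {k} (K : Gr W k) x → T (sub K x) → ∃ λ l → listing K l ≡ x
  listing-onto K x x∈K = from (x , x∈K) , cong proj₁ (strictlyInverseˡ (x , x∈K))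
    where open Inverse (hasRank K)

  members : ∀ {k} → Gr W k → Fin k → Fin n
  members K l = index (listing K l)

  members-∈ : ∀ {k} (K : Gr W k) l → members K l ∈ K
  members-∈ K l = subst (T ∘ sub K) (≡.sym (point-index _)) (listing-∈ K l)

  members-onto : ∀ {k} (K : Gr W k) m → m ∈ K → ∃ λ l → members K l ≡ m
  members-onto K m m∈K = let l , eq = listing-onto K (point m) m∈K in
    l , ≡.trans (cong index eq) (index-point m)

  members-injective : ∀ {k} (K : Gr W k) {l l′} → members K l ≡ members K l′ → l ≡ l′
  members-injective K eq = listing-injective K (≡.trans (≡.sym (point-index _))
    (≡.trans (cong point eq) (point-index _)))

  module _ {k} (K : Gr W k) (x : Fin n) (x∉K : ¬ x ∈ K) where

    adjoin : Subset X
    adjoin y = does (index y Finₚ.≟ x) ∨ sub K y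

    adjoin⁻ : ∀ y → T (adjoin y) → index y ≡ x ⊎ T (sub K y)
    adjoin⁻ y h with Equivalence.to (T-∨ {does (index y Finₚ.≟ x)}) h
    ... | inj₁ p = inj₁ (T-does⁻ (index y Finₚ.≟ x) p)
    ... | inj₂ q = inj₂ q

    adjoin-old : ∀ y → T (sub K y) → T (adjoin y)
    adjoin-old y h = Equivalence.from (T-∨ {does (index y Finₚ.≟ x)}) (inj₂ h)

    adjoin-new : T (adjoin (point x))
    adjoin-new = Equivalence.from (T-∨ {does (index (point x) Finₚ.≟ x)})
      (inj₁ (T-does⁺ (index (point x) Finₚ.≟ x) (index-point x)))

    extend : Gr W (suc k)
    extend = gr adjoin (mkSize adjoin list injective inside onto)
      where
      list : Fin (suc k) → X
      list zero    = point x
      list (suc l) = listing K l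
      injective : ∀ {i j} → list i ≡ list j → i ≡ j
      injective {zero}  {zero}  _  = refl
      injective {zero}  {suc j} eq = ⊥-elim (x∉K (subst (T ∘ sub K) (≡.sym eq) (listing-∈ K j)))
      injective {suc i} {zero}  eq = ⊥-elim (x∉K (subst (T ∘ sub K) eq (listing-∈ K i)))
      injective {suc i} {suc j} eq = cong suc (listing-injective K eq)
      inside : ∀ i → T (adjoin (list i))
      inside zero    = adjoin-new
      inside (suc l) = adjoin-old (listing K l) (listing-∈ K l)
      onto : ∀ y → T (adjoin y) → ∃ λ i → list i ≡ y
      onto y h with adjoin⁻ y h
      ... | inj₁ eq  = zero , ≡.trans (cong point (≡.sym eq)) (point-index y)
      ... | inj₂ y∈K = let l , eq = listing-onto K y y∈K in suc l , eq

  model : Points W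
  model = record
    { number = n ; size = λ k → k ; size-< = λ k → ℕₚ.≤-refl
    ; _∈_ = λ m K → m ∈ K
    ; _∈?_ = λ m K → T? (sub K (point m))
    ; ≤⇒∈ = λ I K I≤K m → I≤K (point m)
    ; members = members ; members-injective = members-injective
    ; members-∈ = members-∈ ; members-onto = members-onto
    ; generators = members ; generators-∈ = members-∈
    ; generated = λ I K h y y∈I → let l , eq = listing-onto I y y∈I in
        subst (T ∘ sub K) (≡.trans (point-index _) eq) (h l)
    ; extend = extend
    ; extend-≤ = λ K x x∉K → adjoin-old K x x∉K
    ; extend-∈ = λ K x x∉K → adjoin-new K x x∉K
    ; extend-least = λ K x x∉K L K≤L x∈L y h → case-least K x x∉K L K≤L x∈L y (adjoin⁻ K x x∉K y h)
    ; modular = λ J K M x x∉J x∉M x∈K h y y∈K y∈J+x →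
        case-modular J K M x x∉M h y y∈K (adjoin⁻ J x x∉J (point y) y∈J+x)
    ; bottom = gr (λ _ → false) (mkSize (λ _ → false) (λ ()) (λ {i} → ⊥-elim (Finₚ.¬Fin0 i)) (λ ()) (λ _ ()))
    ; bottom-≤ = λ K x ()
    ; top = gr Subsets.full e
    ; ≤-top = λ K x _ → tt
    }
    where
    case-least : ∀ {k l} (K : Gr W k) x (x∉K : ¬ x ∈ K) (L : Gr W l) → K ≤ L → x ∈ L →
                 ∀ y → index y ≡ x ⊎ T (sub K y) → T (sub L y)
    case-least K x x∉K L K≤L x∈L y (inj₁ refl) = subst (T ∘ sub L) (point-index y) x∈L
    case-least K x x∉K L K≤L x∈L y (inj₂ y∈K) = K≤L y y∈K
    case-modular : ∀ {j k m} (J : Gr W j) (K : Gr W k) (M : Gr W m) x (x∉M : ¬ x ∈ M) →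
                   (∀ z → z ∈ K → z ∈ J → z ∈ M) → ∀ y → y ∈ K →
                   index (point y) ≡ x ⊎ T (sub J (point y)) → y ∈ extend M x x∉M
    case-modular J K M x x∉M h y y∈K (inj₁ eq) =
      subst (λ z → z ∈ extend M x x∉M) (≡.trans (≡.sym eq) (index-point y)) (adjoin-new M x x∉M)
    case-modular J K M x x∉M h y y∈K (inj₂ y∈J) = adjoin-old M x x∉M (point y) (h y y∈K y∈J)

-- The points of a finite vector space

module FiniteVectorSpace (F : FiniteField) (V : VectorSpace F) (n : ℕ)
                         (B : Linear.Basis F V (Linear.full F) n) where

  private module F = FiniteField F
  open F using (0#; 1#; q)
  open LeftModule V
  open Linear F
  open Linear.Subspace
  open SetoidReasoning ≈ᴹ-setoid
  private module E = Inverse F.enumeration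

  W : Ambient
  W = vectorSpace F V n B

  -- The number whose base-q digits are the codes of the coefficients; applied to coordinates in a
  -- basis, it numbers the vectors of a subspace.
  code : ∀ {r} → Vector F.Carrier r → Fin (q ℕ.^ r)
  code c = funToFin (E.from ∘ c)

  decode : ∀ {r} → Fin (q ℕ.^ r) → Vector F.Carrier r
  decode m = E.to ∘ finToFun m

  decode-code : ∀ {r} (c : Vector F.Carrier r) i → decode (code c) i F.≈ c i
  decode-code c i = F.trans (E.to-cong (Finₚ.finToFun-funToFin (E.from ∘ c) i)) (E.strictlyInverseˡ (c i))

  funToFin-cong : ∀ {m r} {f g : Fin r → Fin m} → (∀ i → f i ≡ g i) → funToFin f ≡ funToFin g
  funToFin-cong {r = zero}  h = refl
  funToFin-cong {r = suc r} h = cong₂ combine (h zero) (funToFin-cong (h ∘ suc))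

  code-cong : ∀ {r} {c d : Vector F.Carrier r} → (∀ i → c i F.≈ d i) → code c ≡ code d
  code-cong h = funToFin-cong (λ i → E.from-cong (h i))

  code-decode : ∀ {r} (m : Fin (q ℕ.^ r)) → code {r} (decode m) ≡ m
  code-decode {r} m = ≡.trans (funToFin-cong {r = r} (λ i → E.strictlyInverseʳ (finToFun m i))) (Finₚ.funToFin-finToFin {r} m)

  coefficients-unique : ∀ {r} {U : Subspace V} (BU : Basis V U r) c d →
    combination V c (Basis.vectors BU) ≈ᴹ combination V d (Basis.vectors BU) → ∀ i → c i F.≈ d i
  coefficients-unique BU c d eq i = G.begin
    c i                                      G.≈⟨ F.+-identityʳ _ ⟨
    c i F.+ 0#                               G.≈⟨ F.+-congˡ (F.-‿inverseˡ (d i)) ⟨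
    c i F.+ (F.- d i F.+ d i)                G.≈⟨ F.+-assoc _ _ _ ⟨
    c i F.+ F.- d i F.+ d i                  G.≈⟨ F.+-congʳ (F.+-congˡ (-1*x≈-x (d i))) ⟨
    c i F.+ F.- 1# F.* d i F.+ d i           G.≈⟨ F.+-congʳ (Basis.independent BU _ zero-combination i) ⟩
    0# F.+ d i                               G.≈⟨ F.+-identityˡ _ ⟩
    d i                                      G.∎
    where
    module G = SetoidReasoning F.setoid
    open RingProperties F.ring using (-1*x≈-x)
    b = Basis.vectors BU
    zero-combination : combination V (λ j → c j F.+ F.- 1# F.* d j) b ≈ᴹ 0ᴹ
    zero-combination = begin
      combination V (λ j → c j F.+ F.- 1# F.* d j) b           ≈⟨ combination-+* {V = V} c d (F.- 1#) b ⟨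
      combination V c b +ᴹ F.- 1# *ₗ combination V d b         ≈⟨ +ᴹ-congʳ (≈ᴹ-trans eq (≈ᴹ-sym (*ₗ-identityˡ _))) ⟩
      1# *ₗ combination V d b +ᴹ F.- 1# *ₗ combination V d b   ≈⟨ cancel {V = V} 1# (combination V d b) ⟩
      0ᴹ                                                       ∎

  module B = Basis B

  point : Fin (q ℕ.^ n) → Carrierᴹ
  point m = combination V (decode m) B.vectors

  index : Carrierᴹ → Fin (q ℕ.^ n)
  index x = code (proj₁ (B.spanning x tt))

  point-index : ∀ x → point (index x) ≈ᴹ x
  point-index x = ≈ᴹ-trans
    (combination-cong {V = V} B.vectors (decode-code (proj₁ (B.spanning x tt))))
    (≈ᴹ-sym (proj₂ (B.spanning x tt)))

  index-cong : ∀ {x y} → x ≈ᴹ y → index x ≡ index y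
  index-cong {x} {y} x≈y = code-cong (coefficients-unique B _ _
    (≈ᴹ-trans (≈ᴹ-sym (proj₂ (B.spanning x tt))) (≈ᴹ-trans x≈y (proj₂ (B.spanning y tt)))))

  index-point : ∀ m → index (point m) ≡ m
  index-point m = ≡.trans (code-cong (coefficients-unique B _ _
    (≈ᴹ-sym (proj₂ (B.spanning (point m) tt))))) (code-decode {n} m)

  _∈ₚ_ : ∀ {k} → Fin (q ℕ.^ n) → Gr W k → Set
  m ∈ₚ K = T (member (sub K) (point m))

  index-∈ : ∀ {k} (K : Gr W k) {x} → x ∈ sub K → index x ∈ₚ K
  index-∈ K {x} = resp (sub K) (≈ᴹ-sym (point-index x))

  ∈-index : ∀ {k} (K : Gr W k) {x} → index x ∈ₚ K → x ∈ sub K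
  ∈-index K {x} = resp (sub K) (point-index x)

  module _ {k} (K : Gr W k) where

    open Basis (hasRank K)

    members : Fin (q ℕ.^ k) → Fin (q ℕ.^ n)
    members l = index (combination V (decode l) vectors)

    members-∈ : ∀ l → members l ∈ₚ K
    members-∈ l = index-∈ K (combination-closed (sub K) (decode l) vectors inside)

    members-injective : ∀ {l l′} → members l ≡ members l′ → l ≡ l′
    members-injective {l} {l′} eq = ≡.trans (≡.sym (code-decode {k} l)) (≡.trans
      (code-cong (coefficients-unique (hasRank K) (decode l) (decode l′) same)) (code-decode {k} l′))
      where
      same : combination V (decode l) vectors ≈ᴹ combination V (decode l′) vectors
      same = ≈ᴹ-trans (≈ᴹ-sym (point-index _)) (≈ᴹ-trans (≈ᴹ-reflexive (cong point eq)) (point-index _))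

    members-onto : ∀ m → m ∈ₚ K → ∃ λ l → members l ≡ m
    members-onto m m∈K = let c , eq = spanning (point m) m∈K in
      code c , ≡.trans (index-cong (≈ᴹ-trans (combination-cong {V = V} vectors (decode-code c)) (≈ᴹ-sym eq)))
                       (index-point m)

    generated : ∀ {l} (L : Gr W l) → (∀ i → index (vectors i) ∈ₚ L) → sub K ⊆ sub L
    generated L h x x∈K = let c , eq = spanning x x∈K in
      resp (sub L) (≈ᴹ-sym eq) (combination-closed (sub L) c vectors (λ i → ∈-index L (h i)))

  -- Since 0 and 1 differ, they have different codes. This makes q ^ k strictly increasing in k.
  q>1 : 1 <ℕ q
  q>1 = two-elements (E.from 0#) (E.from 1#) (λ eq → F.0≉1
      (F.trans (F.sym (E.strictlyInverseˡ 0#)) (F.trans (E.to-cong eq) (E.strictlyInverseˡ 1#))))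
    where
    two-elements : ∀ {m} (i j : Fin m) → ¬ i ≡ j → 1 <ℕ m
    two-elements {suc zero}    zero zero i≢j = ⊥-elim (i≢j refl)
    two-elements {suc (suc m)} _    _    _   = s≤s (s≤s z≤n)

  x+0y≈x : ∀ x y → x +ᴹ 0# *ₗ y ≈ᴹ x
  x+0y≈x x y = ≈ᴹ-trans (+ᴹ-congˡ (*ₗ-zeroˡ y)) (+ᴹ-identityʳ x)

  [y+ax]-ax≈y : ∀ y a x → (y +ᴹ a *ₗ x) +ᴹ (F.- a) *ₗ x ≈ᴹ y
  [y+ax]-ax≈y y a x = ≈ᴹ-trans (+ᴹ-assoc _ _ _) (≈ᴹ-trans (+ᴹ-congˡ (cancel {V = V} a x)) (+ᴹ-identityʳ y))

  module _ {k} (K : Gr W k) (x : Fin (q ℕ.^ n)) (x∉K : ¬ x ∈ₚ K) where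

    private
      K′ = sub K
      v = point x
      open Basis (hasRank K)

    -- Membership of y in the sum of K and the line of v, decided by running through the finitely
    -- many scalars. The scalar found is the negative of the coefficient of v in y.
    adjoined? : ∀ y → Dec (∃ λ i → (y +ᴹ E.to i *ₗ v) ∈ K′)
    adjoined? y = Finₚ.any? (λ i → T? (member K′ (y +ᴹ E.to i *ₗ v)))

    adjoin⁺ : ∀ {y} a → (y +ᴹ a *ₗ v) ∈ K′ → T (does (adjoined? y))
    adjoin⁺ {y} a h = T-does⁺ (adjoined? y)
      (E.from a , resp K′ (+ᴹ-congˡ (*ₗ-congʳ (F.sym (E.strictlyInverseˡ a)))) h)

    adjoin⁻ : ∀ {y} → T (does (adjoined? y)) → ∃ λ a → (y +ᴹ a *ₗ v) ∈ K′
    adjoin⁻ {y} h = let i , p = T-does⁻ (adjoined? y) h in E.to i , p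

    adjoin : Subspace V
    adjoin = record
      { member = λ y → does (adjoined? y)
      ; resp = λ y≈z h → let a , p = adjoin⁻ h in adjoin⁺ a (resp K′ (+ᴹ-congʳ y≈z) p)
      ; 0-closed = adjoin⁺ 0# (resp K′ (≈ᴹ-sym (x+0y≈x 0ᴹ v)) (0-closed K′))
      ; +-closed = λ {y} {z} h h′ → let a , p = adjoin⁻ h ; b , p′ = adjoin⁻ h′ in
          adjoin⁺ (a F.+ b) (resp K′ (≈ᴹ-trans (interchange y (a *ₗ v) z (b *ₗ v))
            (+ᴹ-congˡ (≈ᴹ-sym (*ₗ-distribʳ v a b)))) (+-closed K′ p p′))
      ; *-closed = λ c {y} h → let a , p = adjoin⁻ h in
          adjoin⁺ (c F.* a) (resp K′ (≈ᴹ-trans (*ₗ-distribˡ c y (a *ₗ v))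
            (+ᴹ-congˡ (≈ᴹ-sym (*ₗ-assoc c a v)))) (*-closed K′ c p)) }
      where
      interchange : ∀ w x y z → (w +ᴹ x) +ᴹ (y +ᴹ z) ≈ᴹ (w +ᴹ y) +ᴹ (x +ᴹ z)
      interchange = solve 4 (λ w x y z → (w ⊕ x) ⊕ (y ⊕ z) ⊜ (w ⊕ y) ⊕ (x ⊕ z)) ≈ᴹ-refl
        where open CommutativeMonoidSolver +ᴹ-commutativeMonoid

    adjoin-old : K′ ⊆ adjoin
    adjoin-old y y∈K = adjoin⁺ 0# (resp K′ (≈ᴹ-sym (x+0y≈x y v)) y∈K)

    adjoin-new : v ∈ adjoin
    adjoin-new = adjoin⁺ (F.- 1#) (resp K′
      (≈ᴹ-sym (≈ᴹ-trans (+ᴹ-congʳ (≈ᴹ-sym (*ₗ-identityˡ v))) (cancel {V = V} 1# v))) (0-closed K′))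

    adjoin-least : ∀ (L : Subspace V) → K′ ⊆ L → v ∈ L → adjoin ⊆ L
    adjoin-least L K≤L v∈L y h = let a , p = adjoin⁻ h in
      resp L ([y+ax]-ax≈y y a v) (+-closed L (K≤L _ p) (*-closed L (F.- a) v∈L))

    extend : Gr W (suc k)
    extend = gr adjoin (record
      { vectors = v ∷ᵥ vectors
      ; inside = λ { zero → adjoin-new ; (suc i) → adjoin-old _ (inside i) }
      ; independent = independent′
      ; spanning = λ y h → let a , p = adjoin⁻ h ; c , eq = spanning _ p in
          (F.- a) ∷ᵥ c , ≈ᴹ-trans (≈ᴹ-sym ([y+ax]-ax≈y y a v)) (≈ᴹ-trans (+ᴹ-congʳ eq) (+ᴹ-comm _ _)) })
      where
      independent′ : ∀ c → combination V c (v ∷ᵥ vectors) ≈ᴹ 0ᴹ → ∀ i → c i F.≈ 0#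
      independent′ c eq = λ { zero → c₀≈0 ; (suc i) → independent (c ∘ suc) rest≈0 i }
        where
        a = c zero
        rest = combination V (c ∘ suc) vectors
        rest∈K : rest ∈ K′
        rest∈K = combination-closed K′ (c ∘ suc) vectors inside
        av∈K : (a *ₗ v) ∈ K′
        av∈K = resp K′ (≈ᴹ-trans (≈ᴹ-sym (+ᴹ-identityˡ _)) (≈ᴹ-trans (+ᴹ-congʳ (≈ᴹ-sym eq)) (begin
            (a *ₗ v +ᴹ rest) +ᴹ -ᴹ rest   ≈⟨ +ᴹ-assoc _ _ _ ⟩
            a *ₗ v +ᴹ (rest +ᴹ -ᴹ rest)   ≈⟨ +ᴹ-congˡ (-ᴹ‿inverseʳ rest) ⟩
            a *ₗ v +ᴹ 0ᴹ                  ≈⟨ +ᴹ-identityʳ _ ⟩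
            a *ₗ v                        ∎))) (neg-closed K′ rest∈K)
        c₀≈0 : a F.≈ 0#
        c₀≈0 with E.from a Finₚ.≟ E.from 0#
        ... | yes eq′ = F.trans (F.sym (E.strictlyInverseˡ a)) (F.trans (E.to-cong eq′) (E.strictlyInverseˡ 0#))
        -- A nonzero coefficient could be divided out of `av∈K`, which would put v into K.
        ... | no neq = ⊥-elim (x∉K (resp K′ (begin
            a⁻¹ *ₗ (a *ₗ v)   ≈⟨ *ₗ-assoc a⁻¹ a v ⟨
            (a⁻¹ F.* a) *ₗ v  ≈⟨ *ₗ-congʳ (F.trans (F.*-comm a⁻¹ a) (proj₂ inv)) ⟩
            1# *ₗ v           ≈⟨ *ₗ-identityˡ v ⟩
            v                 ∎) (*-closed K′ a⁻¹ av∈K)))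
          where
          inv = F.inverse a (λ a≈0 → neq (E.from-cong a≈0))
          a⁻¹ = proj₁ inv
        rest≈0 : rest ≈ᴹ 0ᴹ
        rest≈0 = ≈ᴹ-trans (≈ᴹ-sym (+ᴹ-identityˡ rest)) (≈ᴹ-trans
          (+ᴹ-congʳ (≈ᴹ-sym (≈ᴹ-trans (*ₗ-congʳ c₀≈0) (*ₗ-zeroˡ v)))) eq)

  zeroSubspace : Gr W 0
  zeroSubspace = gr
    (record
      { member = λ y → does (zero? y)
      ; resp = λ {x} {y} x≈y h → zero⁺ (≈ᴹ-trans (≈ᴹ-sym x≈y) (zero⁻ h))
      ; 0-closed = zero⁺ ≈ᴹ-refl
      ; +-closed = λ h h′ → zero⁺ (≈ᴹ-trans (+ᴹ-cong (zero⁻ h) (zero⁻ h′)) (+ᴹ-identityˡ 0ᴹ))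
      ; *-closed = λ a h → zero⁺ (≈ᴹ-trans (*ₗ-congˡ (zero⁻ h)) (*ₗ-zeroʳ a)) })
    (record { vectors = λ () ; inside = λ () ; independent = λ _ _ () ; spanning = λ y h → (λ ()) , zero⁻ h })
    where
    zero? : ∀ y → Dec (index y ≡ index 0ᴹ)
    zero? y = index y Finₚ.≟ index 0ᴹ
    zero⁺ : ∀ {y} → y ≈ᴹ 0ᴹ → T (does (zero? y))
    zero⁺ {y} h = T-does⁺ (zero? y) (index-cong h)
    zero⁻ : ∀ {y} → T (does (zero? y)) → y ≈ᴹ 0ᴹ
    zero⁻ {y} h = ≈ᴹ-trans (≈ᴹ-sym (point-index y)) (≈ᴹ-trans
      (≈ᴹ-reflexive (cong point (T-does⁻ (zero? y) h))) (point-index 0ᴹ))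

  model : Points W
  model = record
    { number = q ℕ.^ n ; size = q ℕ.^_
    ; size-< = λ k → ℕₚ.^-monoʳ-< q q>1 (ℕₚ.n<1+n k)
    ; _∈_ = λ m K → m ∈ₚ K
    ; _∈?_ = λ m K → T? (member (sub K) (point m))
    ; ≤⇒∈ = λ I K I≤K m → I≤K (point m)
    ; members = members ; members-injective = members-injective
    ; members-∈ = members-∈ ; members-onto = members-onto
    ; generators = λ K l → index (Basis.vectors (hasRank K) l)
    ; generators-∈ = λ K l → index-∈ K (Basis.inside (hasRank K) l)
    ; generated = λ I K → generated I K
    ; extend = extend
    ; extend-≤ = λ K x x∉K → adjoin-old K x x∉K
    ; extend-∈ = adjoin-new
    ; extend-least = λ K x x∉K L → adjoin-least K x x∉K (sub L)
    -- With y + a x in J, the same vector lies in K because x and y do; so it lies in M, and the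
    -- same scalar a puts y into M + x.
    ; modular = λ J K M x x∉J x∉M x∈K h y y∈K y∈J+x →
        let a , p = adjoin⁻ J x x∉J y∈J+x in
        adjoin⁺ M x x∉M a (∈-index M (h (index (point y +ᴹ a *ₗ point x))
          (index-∈ K (+-closed (sub K) y∈K (*-closed (sub K) a x∈K))) (index-∈ J p)))
    ; bottom = zeroSubspace
    ; bottom-≤ = λ K → generated zeroSubspace K (λ ())
    ; top = gr full B
    ; ≤-top = λ K x _ → tt
    }

-- Subspaces of the quotient as subspaces through P

points-of : ∀ W → Points W
points-of (finiteSet X n e)     = FiniteSet.model X n e
points-of (vectorSpace F V n B) = FiniteVectorSpace.model F V n B

-- The preimage in V of a subspace of V / P, that is, K ∪ P when q = 1.
lift : ∀ {V k} (P : Gr V 1) → Gr (V / P) k → Gr V (suc k)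
lift {finiteSet X n e} {k} P K = gr U (mkSize U list injective inside onto)
  where
  open Subsets using (T-not; not-T; ∈-≡)
  open Inverse (hasRank P) using () renaming (to to toP; from to fromP; strictlyInverseˡ to toP∘fromP)

  p : X
  p = proj₁ (toP zero)

  p∈P : T (sub P p)
  p∈P = proj₂ (toP zero)

  P-unique : ∀ x → T (sub P x) → p ≡ x
  P-unique x x∈P with fromP (x , x∈P) | toP∘fromP (x , x∈P)
  ... | zero | eq = cong proj₁ eq

  member : ∀ x → Dec (T (not (sub P x))) → Bool
  member x (yes x∉P) = sub K (x , x∉P)
  member x (no _)    = true

  U : Subsets.Subset X
  U x = member x (T? (not (sub P x)))

  U⁺ : ∀ y → T (sub K y) → T (U (proj₁ y))
  U⁺ (x , x∉P) h with T? (not (sub P x))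
  ... | yes x∉P′ = subst (T ∘ sub K) (∈-≡ {B = not ∘ sub P} refl) h
  ... | no  _    = tt

  list : Fin (suc k) → X
  list zero    = p
  list (suc l) = proj₁ (proj₁ (Inverse.to (hasRank K) l))

  list∉P : ∀ l → ¬ p ≡ list (suc l)
  list∉P l eq = not-T {X} {b = sub P (list (suc l))} (proj₂ (proj₁ (Inverse.to (hasRank K) l))) (subst (T ∘ sub P) eq p∈P)

  injective : ∀ {i j} → list i ≡ list j → i ≡ j
  injective {zero}  {zero}  _  = refl
  injective {zero}  {suc j} eq = ⊥-elim (list∉P j eq)
  injective {suc i} {zero}  eq = ⊥-elim (list∉P i (≡.sym eq))
  injective {suc i} {suc j} eq = cong suc (≡.trans (≡.sym (strictlyInverseʳ i))
    (≡.trans (cong from (∈-≡ {B = sub K} (∈-≡ {B = not ∘ sub P} eq))) (strictlyInverseʳ j)))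
    where open Inverse (hasRank K)

  inside : ∀ i → T (U (list i))
  inside zero with T? (not (sub P p))
  ... | yes p∉P = ⊥-elim (not-T {X} {b = sub P p} p∉P p∈P)
  ... | no  _   = tt
  inside (suc l) = U⁺ _ (proj₂ (Inverse.to (hasRank K) l))

  onto : ∀ x → T (U x) → ∃ λ i → list i ≡ x
  onto x h with T? (not (sub P x))
  ... | yes x∉P = suc (from ((x , x∉P) , h)) , cong (proj₁ ∘ proj₁) (strictlyInverseˡ ((x , x∉P) , h))
    where open Inverse (hasRank K)
  ... | no ¬x∉P = zero , P-unique x (decidable-stable (T? _) (¬x∉P ∘ T-not {X} {b = sub P x}))
lift {vectorSpace F V n B} {k} P K = gr U (record
  { vectors = p ∷ᵥ vectors
  ; inside = λ { zero → P⊆U p p∈P ; (suc i) → inside i }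
  ; independent = independent′
  ; spanning = λ y h → let c , eq = spanning y h ; a , eq′ = P-multiple _ eq in
      a ∷ᵥ c , ≈ᴹ-trans (≈ᴹ-sym (minus-plus y (combination V c vectors))) (+ᴹ-congʳ eq′) })
  where
  module F = FiniteField F
  open LeftModule V
  open Linear F
  open Linear.Subspace
  open Basis (hasRank K)
  open SetoidReasoning ≈ᴹ-setoid

  P′ : Subspace V
  P′ = sub P

  p : Carrierᴹ
  p = Basis.vectors (hasRank P) zero

  p∈P : p ∈ P′
  p∈P = Basis.inside (hasRank P) zero

  P-multiple : ∀ x → x ∈ P′ → ∃ λ a → x ≈ᴹ a *ₗ p
  P-multiple x h = let c , eq = Basis.spanning (hasRank P) x h in c zero , ≈ᴹ-trans eq (+ᴹ-identityʳ _)

  minus-plus : ∀ x y → (x +ᴹ -ᴹ y) +ᴹ y ≈ᴹ x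
  minus-plus x y = ≈ᴹ-trans (+ᴹ-assoc x (-ᴹ y) y) (≈ᴹ-trans (+ᴹ-congˡ (-ᴹ‿inverseˡ y)) (+ᴹ-identityʳ x))

  minus-0 : ∀ x → x ≈ᴹ x +ᴹ -ᴹ 0ᴹ
  minus-0 x = ≈ᴹ-trans (≈ᴹ-sym (minus-plus x 0ᴹ)) (+ᴹ-identityʳ _)

  U : Subspace V
  U = record
    { member = member (sub K)
    ; resp = λ {x} {y} x≈y → resp (sub K) (resp P′
        (≈ᴹ-sym (≈ᴹ-trans (+ᴹ-congʳ x≈y) (-ᴹ‿inverseʳ y))) (0-closed P′))
    ; 0-closed = 0-closed (sub K) ; +-closed = +-closed (sub K) ; *-closed = *-closed (sub K) }

  -- In the quotient every vector of P equals 0, so a subspace of V / P already has all of P among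
  -- its members.
  P⊆U : P′ ⊆ U
  P⊆U x x∈P = resp (sub K) {0ᴹ} {x} (resp P′ (≈ᴹ-sym (+ᴹ-identityˡ _)) (neg-closed P′ x∈P)) (0-closed (sub K))

  -- The part without p equals a multiple of p, hence is 0 in the quotient, where `vectors` are
  -- independent. What remains is a multiple of p that equals 0.
  independent′ : ∀ c → combination V c (p ∷ᵥ vectors) ≈ᴹ 0ᴹ → ∀ i → c i F.≈ F.0#
  independent′ c eq = λ
    { zero    → Basis.independent (hasRank P) (λ _ → a) (≈ᴹ-trans (+ᴹ-identityʳ _) ap≈0) zero
    ; (suc i) → rest-zero i }
    where
    a = c zero
    rest = combination V (c ∘ suc) vectors
    -ap≈rest : (F.- a) *ₗ p ≈ᴹ rest
    -ap≈rest = begin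
      (F.- a) *ₗ p                       ≈⟨ +ᴹ-identityʳ _ ⟨
      (F.- a) *ₗ p +ᴹ 0ᴹ                 ≈⟨ +ᴹ-congˡ eq ⟨
      (F.- a) *ₗ p +ᴹ (a *ₗ p +ᴹ rest)   ≈⟨ +ᴹ-assoc _ _ _ ⟨
      (F.- a) *ₗ p +ᴹ a *ₗ p +ᴹ rest     ≈⟨ +ᴹ-congʳ (≈ᴹ-trans (+ᴹ-comm _ _) (cancel {V = V} a p)) ⟩
      0ᴹ +ᴹ rest                         ≈⟨ +ᴹ-identityˡ rest ⟩
      rest                               ∎
    rest-zero : ∀ i → c (suc i) F.≈ F.0#
    rest-zero = independent (c ∘ suc)
      (resp P′ (≈ᴹ-trans -ap≈rest (minus-0 rest)) (*-closed P′ (F.- a) p∈P))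
    ap≈0 : a *ₗ p ≈ᴹ 0ᴹ
    ap≈0 = ≈ᴹ-trans (≈ᴹ-sym (+ᴹ-identityʳ _)) (≈ᴹ-trans
      (+ᴹ-congˡ (≈ᴹ-sym (combination-0 {V = V} (c ∘ suc) vectors rest-zero))) eq)

≤-lift : ∀ {V k} (P : Gr V 1) (K : Gr (V / P) k) → P ≤ lift P K
≤-lift {finiteSet X n e} P K x x∈P with T? (not (sub P x))
... | yes x∉P = ⊥-elim (Subsets.not-T {X} {b = sub P x} x∉P x∈P)
... | no _    = tt
≤-lift {vectorSpace F V n B} P K x x∈P = Subspace.resp (sub K) {0ᴹ} {x}
  (Subspace.resp (sub P) (≈ᴹ-sym (+ᴹ-identityˡ _)) (Linear.neg-closed F (sub P) x∈P)) (Subspace.0-closed (sub K))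
  where
  open LeftModule V
  open Linear F using (module Subspace)

quotient-lift-≤ : ∀ {V k} (P : Gr V 1) (K : Gr (V / P) k) (h : P ≤ lift P K) → quotientBy (lift P K) P h ≤ K
quotient-lift-≤ {finiteSet X n e} P K h (x , x∉P) x∈K with T? (not (sub P x))
... | yes x∉P′ = subst (T ∘ sub K) (Subsets.∈-≡ {B = not ∘ sub P} refl) x∈K
... | no ¬x∉P  = ⊥-elim (¬x∉P x∉P)
quotient-lift-≤ {vectorSpace F V n B} P K h x x∈K = x∈K

≤-quotient-lift : ∀ {V k} (P : Gr V 1) (K : Gr (V / P) k) (h : P ≤ lift P K) → K ≤ quotientBy (lift P K) P h
≤-quotient-lift {finiteSet X n e} P K h (x , x∉P) x∈K with T? (not (sub P x))
... | yes x∉P′ = subst (T ∘ sub K) (Subsets.∈-≡ {B = not ∘ sub P} refl) x∈K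
... | no ¬x∉P  = tt
≤-quotient-lift {vectorSpace F V n B} P K h x x∈K = x∈K

-- What the quotient forgets of K is P, which L contains anyway. Together with `quotientBy-mono`
-- this makes the subspaces through P order-isomorphic to those of V / P.
quotientBy-reflects : ∀ {V k l} (K : Gr V k) (L : Gr V l) (P : Gr V 1) (P≤K : P ≤ K) (P≤L : P ≤ L) →
                      quotientBy K P P≤K ≤ quotientBy L P P≤L → K ≤ L
quotientBy-reflects {finiteSet X n e} K L P P≤K P≤L h x x∈K with T? (not (sub P x))
... | yes x∉P = h (x , x∉P) x∈K
... | no ¬x∉P = P≤L x (decidable-stable (T? _) (¬x∉P ∘ Subsets.T-not {X} {b = sub P x}))
quotientBy-reflects {vectorSpace F V n B} K L P P≤K P≤L h = h

rk-/ : ∀ V (P : Gr V 1) → rk (V / P) ≡ rk V ∸ 1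
rk-/ (finiteSet _ _ _)     P = refl
rk-/ (vectorSpace _ _ _ _) P = refl

-- Series against explicit finite sums; uniqueness of weights

module Weights (R : CommutativeRing 0ℓ 0ℓ)
               (invertible : ∀ n → Sums.Unit R (Sums._·_ R (suc n) (CommutativeRing.1# R)))
               (W : Ambient) where

  open CommutativeRing R hiding (refl; sym; trans; zero)
  private module R = CommutativeRing R
  open SemiringSum semiring using (sum; sum-cong-≋)
  open Sums R
  open Lattice (points-of W) public
  open Counting R invertible (points-of W) public
  open Expansions R invertible (points-of W) public
  open SetoidReasoning setoid

  indicator : ∀ {i k} → Gr W i → Gr W k → Carrier
  indicator I K = if does (I ≤? K) then 1# else 0#

  series-respects : ∀ {i k} (w : Gr W i → Carrier) → Respects {k} (series w)
  series-respects w K L p q = ∑-cong (λ I → *-congˡ (ι-≤-respectsʳ I K L p q))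

  ∑-indicator : ∀ {i k} (w : Gr W i → Carrier) (e : Enumeration (Gr-setoid W i)) (K : Gr W k) →
    ∑ e (λ I → w I * ι (I ≤? K)) ≈ sum (λ j → w (Inverse.to (proj₂ e) j) * indicator (Inverse.to (proj₂ e) j) K)
  ∑-indicator {i} {k} w e K = R.trans (∑-unfold e (λ I → w I * ι (I ≤? K)))
    (sum-cong-≋ {x = λ j → w (Inverse.to (proj₂ e) j) * ι (Inverse.to (proj₂ e) j ≤? K)}
                {y = λ j → w (Inverse.to (proj₂ e) j) * indicator (Inverse.to (proj₂ e) j) K}
                (λ j → *-congˡ (ι-unfold (Inverse.to (proj₂ e) j ≤? K))))

  series-sum : ∀ {i k} (w : Gr W i → Carrier) → Respects w → (e : Enumeration (Gr-setoid W i)) (K : Gr W k) →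
    series w K ≈ sum (λ j → w (Inverse.to (proj₂ e) j) * indicator (Inverse.to (proj₂ e) j) K)
  series-sum {i} w w-resp e K = R.trans
    (∑-enumeration (enumeration i) e (λ I → w I * ι (I ≤? K))
      (λ {I} {J} (p , q) → *-cong (w-resp I J p q) (ι-≤-respectsˡ I J K p q)))
    (∑-indicator w e K)

  -- The family I may contain repetitions: each term is expanded by itself, and the weights are
  -- added.
  sum-expansion : ∀ {i k r} (I : Fin r → Gr W i) (c : Fin r → Carrier) →
    Expansion {k} i (λ K → sum (λ j → c j * indicator (I j) K))
  sum-expansion {r = r} I c = expansion-≈
    (λ K → R.sym (R.trans (∑-unfold (finite r) (λ j → c j * ι (I j ≤? K)))
      (sum-cong-≋ {x = λ j → c j * ι (I j ≤? K)} {y = λ j → c j * indicator (I j) K}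
        (λ j → *-congˡ (ι-unfold (I j ≤? K))))))
    (expansion-∑ {e = finite r} (λ j → expansion-*ˡ (c j) (expansion-χ (I j))))

  -- Apply `weights-vanish` to the difference of the weights, with the whole space as J₀. The two
  -- bounds say that i is at most min(k , n - k).
  series-unique : ∀ {i k} (v w : Gr W i → Carrier) → Respects v → Respects w → i ≤ℕ k → i ℕ.+ k ≤ℕ rk W →
    (∀ (K : Gr W k) → series v K ≈ series w K) → ∀ I → v I ≈ w I
  series-unique {i} {k} v w v-resp w-resp i≤k i+k≤n h I = begin
    v I                            ≈⟨ +-identityʳ _ ⟨
    v I + 0#                       ≈⟨ +-congˡ (-‿inverseˡ (w I)) ⟨
    v I + (- w I + w I)            ≈⟨ +-assoc _ _ _ ⟨
    v I + - w I + w I              ≈⟨ +-congʳ (+-congˡ (-1*x≈-x (w I))) ⟨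
    v I + - 1# * w I + w I         ≈⟨ +-congʳ (weights-vanish top difference-resp i≤k difference i+k≤n I (≤-top I)) ⟩
    0# + w I                       ≈⟨ +-identityˡ _ ⟩
    w I                            ∎
    where
    open RingProperties ring using (-1*x≈-x)
    difference-resp : Respects (λ J → v J + - 1# * w J)
    difference-resp J L p q = +-cong (v-resp J L p q) (*-congˡ (w-resp J L p q))
    difference : ∀ (K : Gr W k) → K ≤ top → series (λ J → v J + - 1# * w J) K ≈ 0#
    difference K _ = begin
      series (λ J → v J + - 1# * w J) K            ≈⟨ series-+ v (λ J → - 1# * w J) K ⟩
      series v K + series (λ J → - 1# * w J) K     ≈⟨ +-cong (h K) (series-*ˡ (- 1#) w K) ⟩
      series w K + - 1# * series w K               ≈⟨ +-congˡ (-1*x≈-x (series w K)) ⟩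
      series w K + - series w K                    ≈⟨ -‿inverseʳ _ ⟩
      0#                                           ∎

-- Extension by zero from V / P to V, and its effect on expansions

module Quotient (R : CommutativeRing 0ℓ 0ℓ)
                (invertible : ∀ n → Sums.Unit R (Sums._·_ R (suc n) (CommutativeRing.1# R)))
                {V : Ambient} (P : Gr V 1) where

  open CommutativeRing R hiding (refl; sym; trans; zero)
  private
    module R = CommutativeRing R
    module V = Weights R invertible V
    module Q = Weights R invertible (V / P)
  open Sums R
  open SetoidReasoning setoid

  lift-mono : ∀ {i j} (I : Gr (V / P) i) (J : Gr (V / P) j) → I ≤ J → lift P I ≤ lift P J
  lift-mono I J I≤J = quotientBy-reflects (lift P I) (lift P J) P (≤-lift P I) (≤-lift P J)
    (≤-trans I/ I J/ (quotient-lift-≤ P I (≤-lift P I)) (≤-trans I J J/ I≤J (≤-quotient-lift P J (≤-lift P J))))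
    where
    I/ = quotientBy (lift P I) P (≤-lift P I)
    J/ = quotientBy (lift P J) P (≤-lift P J)

  lift-quotient-≤ : ∀ {k} (K : Gr V (suc k)) (h : P ≤ K) → lift P (quotientBy K P h) ≤ K
  lift-quotient-≤ K h = quotientBy-reflects (lift P (quotientBy K P h)) K P (≤-lift P (quotientBy K P h)) h
    (quotient-lift-≤ P (quotientBy K P h) (≤-lift P (quotientBy K P h)))

  ≤-lift-quotient : ∀ {k} (K : Gr V (suc k)) (h : P ≤ K) → K ≤ lift P (quotientBy K P h)
  ≤-lift-quotient K h = quotientBy-reflects K (lift P (quotientBy K P h)) P h (≤-lift P (quotientBy K P h))
    (≤-quotient-lift P (quotientBy K P h) (≤-lift P (quotientBy K P h)))

  lift-≤⇒ : ∀ {i k} (I : Gr (V / P) i) (K : Gr V (suc k)) (h : P ≤ K) → lift P I ≤ K → I ≤ quotientBy K P h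
  lift-≤⇒ I K h I≤K = ≤-trans I I/ (quotientBy K P h) (≤-quotient-lift P I (≤-lift P I))
    (quotientBy-mono (lift P I) K P (≤-lift P I) h I≤K)
    where I/ = quotientBy (lift P I) P (≤-lift P I)

  lift-≤⇐ : ∀ {i k} (I : Gr (V / P) i) (K : Gr V (suc k)) (h : P ≤ K) → I ≤ quotientBy K P h → lift P I ≤ K
  lift-≤⇐ I K h I≤K = ≤-trans (lift P I) (lift P (quotientBy K P h)) K
    (lift-mono I (quotientBy K P h) I≤K) (lift-quotient-≤ K h)

  -- φ = Φ(f), stated by its values so as to apply to any such function.
  record Extends {k} (f : Gr (V / P) k → Carrier) (φ : Gr V (suc k) → Carrier) : Set where
    field
      on  : ∀ K (h : P ≤ K) → φ K ≈ f (quotientBy K P h)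
      off : ∀ K → ¬ P ≤ K → φ K ≈ 0#

  open Extends

  extends-unique : ∀ {k} {f g : Gr (V / P) k → Carrier} {φ ψ : Gr V (suc k) → Carrier} →
    Extends f φ → Extends g ψ → (∀ K → f K ≈ g K) → ∀ K → φ K ≈ ψ K
  extends-unique {φ = φ} {ψ} φ-ext ψ-ext f≈g K = by (P ≤? K)
    where
    by : Dec (P ≤ K) → φ K ≈ ψ K
    by (yes h) = R.trans (on φ-ext K h) (R.trans (f≈g _) (R.sym (on ψ-ext K h)))
    by (no ¬h) = R.trans (off φ-ext K ¬h) (R.sym (off ψ-ext K ¬h))

  module _ {k} {f g : Gr (V / P) k → Carrier} {φ ψ : Gr V (suc k) → Carrier} where

    extends-+ : Extends f φ → Extends g ψ → Extends (λ K → f K + g K) (λ K → φ K + ψ K)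
    extends-+ φ-ext ψ-ext = record
      { on = λ K h → +-cong (on φ-ext K h) (on ψ-ext K h)
      ; off = λ K ¬h → R.trans (+-cong (off φ-ext K ¬h) (off ψ-ext K ¬h)) (+-identityˡ 0#) }

  module _ {k} {f : Gr (V / P) k → Carrier} {φ : Gr V (suc k) → Carrier} where

    extends-*ˡ : ∀ a → Extends f φ → Extends (λ K → a * f K) (λ K → a * φ K)
    extends-*ˡ a φ-ext = record
      { on = λ K h → *-congˡ (on φ-ext K h)
      ; off = λ K ¬h → R.trans (*-congˡ (off φ-ext K ¬h)) (zeroʳ a) }

    extends-neg : Extends f φ → Extends (λ K → - f K) (λ K → - φ K)
    extends-neg φ-ext = record
      { on = λ K h → -‿cong (on φ-ext K h)
      ; off = λ K ¬h → R.trans (-‿cong (off φ-ext K ¬h)) -0#≈0# }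
      where open RingProperties ring using (-0#≈0#)

  extends-0 : ∀ {k} → Extends {k} (λ _ → 0#) (λ _ → 0#)
  extends-0 = record { on = λ _ _ → R.refl ; off = λ _ _ → R.refl }

  -- Every subspace of V / P is the quotient of its lift, so f can be read off from φ. Injectivity
  -- of `Φ` rests on this.
  at-lift : ∀ {k} {f : Gr (V / P) k → Carrier} {φ : Gr V (suc k) → Carrier} → Q.Respects f → Extends f φ →
    ∀ K → φ (lift P K) ≈ f K
  at-lift f-resp φ-ext K = R.trans (on φ-ext (lift P K) (≤-lift P K))
    (f-resp (quotientBy (lift P K) P (≤-lift P K)) K (quotient-lift-≤ P K (≤-lift P K)) (≤-quotient-lift P K (≤-lift P K)))

  extends-injective : ∀ {k} {f g : Gr (V / P) k → Carrier} {φ ψ : Gr V (suc k) → Carrier} →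
    Q.Respects f → Q.Respects g → Extends f φ → Extends g ψ → (∀ K → φ K ≈ ψ K) → ∀ K → f K ≈ g K
  extends-injective f-resp g-resp φ-ext ψ-ext φ≈ψ K =
    R.trans (R.sym (at-lift f-resp φ-ext K)) (R.trans (φ≈ψ (lift P K)) (at-lift g-resp ψ-ext K))

  restriction-extends : ∀ {k} {φ : Gr V (suc k) → Carrier} → V.Respects φ → (∀ K → ¬ P ≤ K → φ K ≈ 0#) →
    Extends (φ ∘ lift P) φ
  restriction-extends φ-resp φ-off = record
    { on = λ K h → φ-resp K (lift P (quotientBy K P h)) (≤-lift-quotient K h) (lift-quotient-≤ K h)
    ; off = φ-off }

  module _ {k} (f : Gr (V / P) k → Carrier) where

    private
      value : ∀ (K : Gr V (suc k)) → Dec (P ≤ K) → Carrier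
      value K (yes h) = f (quotientBy K P h)
      value K (no _)  = 0#

    extension : Gr V (suc k) → Carrier
    extension K = value K (P ≤? K)

    module _ (f-resp : Q.Respects f) where

      extension-extends : Extends f extension
      extension-extends = record { on = λ K → on′ K (P ≤? K) ; off = λ K → off′ K (P ≤? K) }
        where
        on′ : ∀ K (d : Dec (P ≤ K)) h → value K d ≈ f (quotientBy K P h)
        on′ K (yes h′) h = f-resp (quotientBy K P h′) (quotientBy K P h)
          (quotientBy-mono K K P h′ h (≤-refl K)) (quotientBy-mono K K P h h′ (≤-refl K))
        on′ K (no ¬h)  h = ⊥-elim (¬h h)
        off′ : ∀ K (d : Dec (P ≤ K)) → ¬ P ≤ K → value K d ≈ 0#
        off′ K (yes h) ¬h = ⊥-elim (¬h h)
        off′ K (no _)  ¬h = R.refl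

      extension-respects : V.Respects extension
      extension-respects K L p q = respects (P ≤? K) (P ≤? L)
        where
        respects : ∀ (d : Dec (P ≤ K)) (e : Dec (P ≤ L)) → value K d ≈ value L e
        respects (yes h) (yes h′) = f-resp (quotientBy K P h) (quotientBy L P h′)
          (quotientBy-mono K L P h h′ p) (quotientBy-mono L K P h′ h q)
        respects (yes h) (no ¬h)  = ⊥-elim (¬h (≤-trans P K L h p))
        respects (no ¬h) (yes h)  = ⊥-elim (¬h (≤-trans P L K h q))
        respects (no _)  (no _)   = R.refl

  -- Reindexing along the bijection between subspaces of V / P and subspaces through P, done as a
  -- double sum over the pairs (E , I) in which E is the lift of I.
  ∑-lift : ∀ {e} (g : Gr V (suc e) → Carrier) → V.Respects g → (∀ E → ¬ P ≤ E → g E ≈ 0#) →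
    ∑ (V.enumeration (suc e)) g ≈ ∑ (Q.enumeration e) (g ∘ lift P)
  ∑-lift {e} g g-resp g-off = begin
    ∑ _ g                                                 ≈⟨ ∑-cong (λ E → row E (P ≤? E)) ⟩
    ∑ _ (λ E → ∑ (Q.enumeration e) (λ I → ι (E V.≅? lift P I) * g E)) ≈⟨ ∑-swap (λ E I → ι (E V.≅? lift P I) * g E) ⟩
    ∑ _ (λ I → ∑ _ (λ E → ι (E V.≅? lift P I) * g E))     ≈⟨ ∑-cong column ⟩
    ∑ _ (g ∘ lift P)                                      ∎
    where
    row : ∀ E → Dec (P ≤ E) → g E ≈ ∑ (Q.enumeration e) (λ I → ι (E V.≅? lift P I) * g E)
    row E (no ¬h) = R.trans (g-off E ¬h) (R.sym (∑-zero (λ I → R.trans (*-congˡ (g-off E ¬h)) (zeroʳ _))))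
    row E (yes h) = R.sym (R.trans
      (∑-single (λ I → ι (E V.≅? lift P I) * g E) E/
        (λ { {I} (p , q) → *-congʳ (ι-⇔ (E V.≅? lift P I) (E V.≅? lift P E/)
          (λ _ → ≤-lift-quotient E h , lift-quotient-≤ E h)
          (λ _ → ≤-trans E (lift P E/) (lift P I) (≤-lift-quotient E h) (lift-mono E/ I q)
               , ≤-trans (lift P I) (lift P E/) E (lift-mono I E/ p) (lift-quotient-≤ E h))) })
        (λ I I≇E/ → ι-no-* (E V.≅? lift P I) (λ (p , q) → I≇E/ (lift-≤⇒ I E h q ,
          ≤-trans E/ I/ I (quotientBy-mono E (lift P I) P h (≤-lift P I) p) (quotient-lift-≤ P I (≤-lift P I))))))
      (ι-yes-* (E V.≅? lift P E/) (≤-lift-quotient E h , lift-quotient-≤ E h)))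
      where
      E/ = quotientBy E P h
      I/ = λ {I} → quotientBy (lift P I) P (≤-lift P I)
    column : ∀ I → ∑ (V.enumeration (suc e)) (λ E → ι (E V.≅? lift P I) * g E) ≈ g (lift P I)
    column I = R.trans
      (∑-single (λ E → ι (E V.≅? lift P I) * g E) (lift P I)
        (λ { {E} (p , q) → *-cong
          (ι-⇔ (E V.≅? lift P I) (lift P I V.≅? lift P I) (λ _ → ≤-refl (lift P I) , ≤-refl (lift P I)) (λ _ → p , q))
          (g-resp E (lift P I) p q) })
        (λ E → ι-no-* (E V.≅? lift P I)))
      (ι-yes-* (lift P I V.≅? lift P I) (≤-refl (lift P I) , ≤-refl (lift P I)))

  -- Forming a series commutes with extension by zero: only the lifts of subspaces I of V / P
  -- contribute, and such a lift lies in K exactly if P ≤ K and I ≤ K / P. Both the upper bound for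
  -- the degree and the weight formula come from here.
  series-extends : ∀ {e k} (w : Gr (V / P) e → Carrier) (w′ : Gr V (suc e) → Carrier) → Q.Respects w → V.Respects w′ →
    Extends w w′ → Extends {k} (Q.series w) (V.series w′)
  series-extends {e} {k} w w′ w-resp w′-resp w′-ext = record
    { on = λ K h → R.trans (lifted K) (∑-cong (λ I → *-cong (at-lift w-resp w′-ext I)
        (ι-⇔ (lift P I ≤? K) (I ≤? quotientBy K P h) (lift-≤⇒ I K h) (lift-≤⇐ I K h))))
    ; off = λ K ¬h → R.trans (lifted K) (∑-zero (λ I → R.trans (*-congˡ (ι-no (lift P I ≤? K)
        (λ h → ¬h (≤-trans P (lift P I) K (≤-lift P I) h)))) (zeroʳ _))) }
    where
    lifted : ∀ (K : Gr V (suc k)) → V.series w′ K ≈ ∑ (Q.enumeration e) (λ I → w′ (lift P I) * ι (lift P I ≤? K))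
    lifted K = ∑-lift (λ E → w′ E * ι (E ≤? K))
      (λ E D p q → *-cong (w′-resp E D p q) (V.ι-≤-respectsˡ E D K p q))
      (λ E ¬h → R.trans (*-congʳ (off w′-ext E ¬h)) (zeroˡ _))

  module _ {k} {f : Gr (V / P) k → Carrier} {φ : Gr V (suc k) → Carrier} (f-resp : Q.Respects f) (φ-ext : Extends f φ) where

    expansion-extends : ∀ {e} → Q.Expansion e f → V.Expansion (suc e) φ
    expansion-extends E = record
      { weights = extension weights
      ; respects = extension-respects weights respects
      ; expands = extends-unique φ-ext (series-extends weights (extension weights) respects
          (extension-respects weights respects) (extension-extends weights respects)) expands }
      where open Q.Expansion E

    module _ {s} (E : V.Expansion s φ) (s≤k : s ≤ℕ suc k) (s+k<n : s ℕ.+ suc k <ℕ rk V) where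

      open V.Expansion E

      private
        n′ = rk V ∸ 1
        n≡ : rk V ≡ suc n′
        n≡ = ≡.sym (ℕₚ.m+[n∸m]≡n {1} (ℕₚ.≤-trans (s≤s z≤n) s+k<n))
        -- Here the strict bound is essential: `weights-vanish` will be used inside hyperplanes of
        -- rank n - 1, so both ranks together must fit into n - 1.
        s+k≤n′ : s ℕ.+ suc k ≤ℕ n′
        s+k≤n′ = ℕₚ.≤-pred (subst (s ℕ.+ suc k <ℕ_) n≡ s+k<n)

        whole : ∀ {m} → rk V ≡ m → Σ[ J ∈ Gr V m ] (∀ {i} (I : Gr V i) → I ≤ J)
        whole refl = V.top , V.≤-top

        J : Gr V (suc n′)
        J = proj₁ (whole n≡)

        ≤J : ∀ {i} (I : Gr V i) → I ≤ J
        ≤J = proj₂ (whole n≡)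

        p : V.Point
        p = V.generators P zero

        P≤ : ∀ {i} (I : Gr V i) → p V.∈ I → P ≤ I
        P≤ I p∈I = V.generated P I (λ { zero → p∈I })

        p∈ : ∀ {i} (I : Gr V i) → P ≤ I → p V.∈ I
        p∈ I P≤I = V.≤⇒∈ P I P≤I p (V.generators-∈ P zero)

      -- Φ(f) vanishes inside each hyperplane that avoids P, hence so do its weights.
      weights-off : ∀ I → ¬ P ≤ I → weights I ≈ 0#
      weights-off I P≰I = unit-cancel avoiding-unit (begin
        avoiding * weights I   ≈⟨ *-congʳ (∑-avoiding I p (≤J I) (p∈ J (≤J P)) (P≰I ∘ P≤ I)) ⟨
        ∑ _ through-I * weights I ≈⟨ ∑-*ʳ (weights I) through-I ⟨
        ∑ _ (λ H → through-I H * weights I) ≈⟨ ∑-zero term ⟩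
        0# ∎)
        where
        open V.Hyperplanes (V.hyperplanes (n′ ∸ s) s J (ℕₚ.m∸n+n≡m (ℕₚ.≤-trans (ℕₚ.m≤m+n s (suc k)) s+k≤n′)))
        through-I : Gr V n′ → Carrier
        through-I H = ι (¬? (p V.∈? H)) * (ι (H ≤? J) * ι (I ≤? H))
        term : ∀ H → through-I H * weights I ≈ 0#
        term H = begin
          ι (¬? (p V.∈? H)) * (ι (H ≤? J) * ι (I ≤? H)) * weights I ≈⟨ *-assoc _ _ _ ⟩
          ι (¬? (p V.∈? H)) * (ι (H ≤? J) * ι (I ≤? H) * weights I) ≈⟨ ι-*-cong (¬? (p V.∈? H)) (λ p∉H →
            R.trans (*-assoc _ _ _) (R.trans (*-congˡ (R.trans (ι-*-cong (I ≤? H) (λ I≤H →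
              V.weights-vanish H respects s≤k
                (λ K K≤H → R.trans (R.sym (expands K)) (off φ-ext K (λ h → p∉H (p∈ H (≤-trans P K H h K≤H)))))
                s+k≤n′ I I≤H)) (zeroʳ _))) (zeroʳ _))) ⟩
          ι (¬? (p V.∈? H)) * 0# ≈⟨ zeroʳ _ ⟩
          0# ∎

    -- The weights vanish on subspaces not through P, and in rank 0 these are all the subspaces.
    expansion-0-extends : V.Expansion 0 φ → suc k <ℕ rk V → ∀ K → f K ≈ 0#
    expansion-0-extends E k<n K = R.trans (R.sym (at-lift f-resp φ-ext K)) (R.trans (expands (lift P K))
      (∑-zero (λ I → R.trans (*-congʳ (weights-off E z≤n k<n I
        (λ P≤I → ℕₚ.n≮0 (V.rank-≤ P I P≤I)))) (zeroˡ _))))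
      where open V.Expansion E

    -- By `weights-off` the weights are themselves an extension by zero, namely of
    -- `weights ∘ lift P`. So their series extends the series of the latter, and evaluating at lifts
    -- recovers f.
    expansion-restricts : ∀ {s} → V.Expansion (suc s) φ → suc s ≤ℕ suc k → suc s ℕ.+ suc k <ℕ rk V → Q.Expansion s f
    expansion-restricts {s} E s≤k s+k<n = record
      { weights = weights ∘ lift P
      ; respects = restricted-resp
      ; expands = λ K → begin
          f K                                        ≈⟨ at-lift f-resp φ-ext K ⟨
          φ (lift P K)                               ≈⟨ expands (lift P K) ⟩
          V.series weights (lift P K)                ≈⟨ at-lift (Q.series-respects (weights ∘ lift P))
              (series-extends (weights ∘ lift P) weights restricted-resp respects
                (restriction-extends respects (weights-off E s≤k s+k<n))) K ⟩
          Q.series (weights ∘ lift P) K              ∎ }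
      where
      open V.Expansion E
      restricted-resp : Q.Respects (weights ∘ lift P)
      restricted-resp I J p q = respects (lift P I) (lift P J) (lift-mono I J p) (lift-mono J I q)

-- The real numbers as a coefficient ring

open CommutativeRing ℝ-commutativeRing using ()
  renaming (refl to ≈ᴿ-refl; sym to ≈ᴿ-sym; trans to ≈ᴿ-trans)

-- x ≈ᴿ y is a function type from which x and y cannot be recovered by
-- unification; wrapping it makes general ring lemmas applicable.
infix 4 _≃_
record _≃_ (x y : ℝ) : Set where
  constructor wrap
  field unwrap : x ≈ᴿ y
open _≃_

≃-sym : ∀ {x y} → x ≃ y → y ≃ x
≃-sym {x} {y} (wrap p) = wrap (≈ᴿ-sym {x} {y} p)

≃-trans : ∀ {x y z} → x ≃ y → y ≃ z → x ≃ z
≃-trans {x} {y} {z} (wrap p) (wrap q) = wrap (≈ᴿ-trans {x} {y} {z} p q)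

-- The operations are opaque: at the record type ℝ, comparing two unfolded
-- sums or products would also compare their Cauchy moduli.
opaque
  _⊕_ _⊗_ : ℝ → ℝ → ℝ
  _⊕_ = _+ᴿ_
  _⊗_ = _*ᴿ_

  ⊖_ : ℝ → ℝ
  ⊖_ = -ᴿ_

  ℝ-isCommutativeRing : IsCommutativeRing _≃_ _⊕_ _⊗_ ⊖_ 0ᴿ 1ᴿ
  ℝ-isCommutativeRing = record
    { isRing = record
      { +-isAbelianGroup = record
        { isGroup = record
          { isMonoid = record
            { isSemigroup = record
              { isMagma = record
                { isEquivalence = record
                  { refl = λ {x} → wrap (ℝR.refl {x})
                  ; sym = λ {x} {y} (wrap p) → wrap (ℝR.sym {x} {y} p)
                  ; trans = λ {x} {y} {z} (wrap p) (wrap q) → wrap (ℝR.trans {x} {y} {z} p q) }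
                ; ∙-cong = λ {x} {x′} {y} {y′} (wrap p) (wrap q) → wrap (+ᴿ-cong {x} {x′} {y} {y′} p q) }
              ; assoc = λ x y z → wrap (ℝR.+-assoc x y z) }
            ; identity = (λ x → wrap (ℝR.+-identityˡ x)) , (λ x → wrap (ℝR.+-identityʳ x)) }
          ; inverse = (λ x → wrap (ℝR.-‿inverseˡ x)) , (λ x → wrap (ℝR.-‿inverseʳ x))
          ; ⁻¹-cong = λ {x} {y} (wrap p) → wrap (-ᴿ-cong {x} {y} p) }
        ; comm = λ x y → wrap (ℝR.+-comm x y) }
      ; *-cong = λ {x} {x′} {y} {y′} (wrap p) (wrap q) → wrap (*ᴿ-cong {x} {x′} {y} {y′} p q)
      ; *-assoc = λ x y z → wrap (ℝR.*-assoc x y z)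
      ; *-identity = (λ x → wrap (ℝR.*-identityˡ x)) , (λ x → wrap (ℝR.*-identityʳ x))
      ; distrib = (λ x y z → wrap (ℝR.distribˡ x y z)) , (λ x y z → wrap (ℝR.distribʳ x y z)) }
    ; *-comm = λ x y → wrap (ℝR.*-comm x y) }
    where module ℝR = CommutativeRing ℝ-commutativeRing

ℝ-ring : CommutativeRing 0ℓ 0ℓ
ℝ-ring = record { isCommutativeRing = ℝ-isCommutativeRing }

open CommutativeMonoidSum (CommutativeRing.+-commutativeMonoid ℝ-commutativeRing) using () renaming (sum to ∑ᴿ)
open SemiringSum (CommutativeRing.semiring ℝ-ring) using (sum; sum-cong-≋)

private
  module E = CommutativeRing ℝ-ring
  module ℝS = Sums ℝ-ring

opaque
  unfolding _⊕_

  +≃⊕ : ∀ x y → x +ᴿ y ≃ x ⊕ y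
  +≃⊕ x y = wrap (≈ᴿ-refl {x +ᴿ y})

  *≃⊗ : ∀ x y → x *ᴿ y ≃ x ⊗ y
  *≃⊗ x y = wrap (≈ᴿ-refl {x *ᴿ y})

  -≃⊖ : ∀ x → -ᴿ x ≃ ⊖ x
  -≃⊖ x = wrap (≈ᴿ-refl { -ᴿ x})

  ∑ᴿ≃sum : ∀ {r} (g : Fin r → ℝ) → ∑ᴿ g ≃ sum g
  ∑ᴿ≃sum g = E.refl

  natural-positive : ∀ n → 0ℚ ℚ.≤ seq (n ℝS.· 1ᴿ) 0
  natural-positive zero    = ℚₚ.≤-refl
  natural-positive (suc n) = ℚₚ.+-mono-≤ (ℚₚ.nonNegative⁻¹ 1ℚ) (natural-positive n)

  natural-constant : ∀ n m → seq (n ℝS.· 1ᴿ) m ≡ seq (n ℝS.· 1ᴿ) 0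
  natural-constant zero    m = refl
  natural-constant (suc n) m = cong (1ℚ ℚ.+_) (natural-constant n m)

  -- A multiple of 1 is a constant sequence, here with a positive rational value t, so the constant
  -- sequence 1/t is its inverse.
  naturals-invertible : ∀ n → Sums.Unit ℝ-ring (Sums._·_ ℝ-ring (suc n) (CommutativeRing.1# ℝ-ring))
  naturals-invertible n = fromℚ (ℚ.1/ t) , wrap (pointwise {fromℚ (ℚ.1/ t) *ᴿ (suc n ℝS.· 1ᴿ)} {1ᴿ}
    (λ m → ≡.trans (cong ((ℚ.1/ t) ℚ.*_) (natural-constant (suc n) m)) (ℚₚ.*-inverseˡ t)))
    where
    t : ℚ
    t = seq (suc n ℝS.· 1ᴿ) 0
    instance
      t≢0 : ℚ.NonZero t
      t≢0 = ℚₚ.pos⇒nonZero t {{ℚ.positive (ℚₚ.+-mono-<-≤ (ℚₚ.positive⁻¹ 1ℚ) (natural-positive n))}}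

∑-*-same : ∀ {r} (c x y : Fin r → ℝ) → (∀ j → x j ≃ y j) →
  ∑ᴿ (λ j → c j *ᴿ x j) ≃ sum (λ j → c j ⊗ y j)
∑-*-same c x y h = E.trans (∑ᴿ≃sum (λ j → c j *ᴿ x j))
  (sum-cong-≋ {x = λ j → c j *ᴿ x j} {y = λ j → c j ⊗ y j}
    (λ j → E.trans (*≃⊗ (c j) (x j)) (E.*-congˡ (h j))))

-- If |x_N| ≥ ε/2 for an N past which x varies by less than ε/4, then x does not tend to 0.
≈0-stable : ∀ x → ¬ ¬ x ≈ᴿ 0ᴿ → x ≈ᴿ 0ᴿ
≈0-stable x ¬¬x≈0 ε 0<ε = decide (ℚ.∣ seq x N ℚ.- 0ℚ ∣ ℚₚ.<? ε′)
  where
  ε′ = ½ ℚ.* ε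
  0<ε′ = half-pos 0<ε
  N = proj₁ (cauchy x (½ ℚ.* ε′) (half-pos 0<ε′))
  close = proj₂ (cauchy x (½ ℚ.* ε′) (half-pos 0<ε′))
  half< : ½ ℚ.* ε′ ℚ.< ε′
  half< = ≡.subst₂ ℚ._<_ (ℚₚ.+-identityʳ (½ ℚ.* ε′)) (half+half ε′)
    (ℚₚ.+-monoʳ-< (½ ℚ.* ε′) (half-pos 0<ε′))
  decide : Dec (ℚ.∣ seq x N ℚ.- 0ℚ ∣ ℚ.< ε′) → Σ[ M ∈ ℕ ] ∀ n → M ℕ.≤ n → Near ε (seq x n) 0ℚ
  decide (yes small) = N , λ n N≤n → near-trans {p = seq x n} {q = seq x N} {r = 0ℚ}
    (ℚₚ.<-trans (close n N N≤n ℕₚ.≤-refl) half<) small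
  decide (no ¬small) = ⊥-elim (¬¬x≈0 (λ x≈0 →
    let M , tiny = x≈0 (½ ℚ.* ε′) (half-pos 0<ε′) ; l = N ℕ.⊔ M in
    ¬small (near-trans {p = seq x N} {q = seq x l} {r = 0ℚ}
      (close N l ℕₚ.≤-refl (ℕₚ.m≤m⊔n N M)) (tiny l (ℕₚ.m≤n⊔m N M)))))

-- Spans and weight distributions of real functions as expansions

module _ (W : Ambient) where

  open Weights ℝ-ring naturals-invertible W

  fun-respects : ∀ {k} (f : Fun W k) → Respects (f ⟨$⟩_)
  fun-respects f K L p q = wrap (Func.cong f {K} {L} (p , q))

  fun : ∀ {k} (f : Gr W k → ℝ) → Respects f → Fun W k
  fun f f-resp = record { to = f ; cong = λ {K} {L} (p , q) → unwrap (f-resp K L p q) }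

  χ≃indicator : ∀ {i k} (I : Gr W i) (K : Gr W k) → (χ k I ⟨$⟩ K) ≃ indicator I K
  χ≃indicator I K = E.refl

  opaque
    combination : ∀ {i k r} → (Fin r → ℝ) → (Fin r → Gr W i) → Gr W k → ℝ
    combination {k = k} c I K = ∑ᴿ (λ j → c j *ᴿ (χ k (I j) ⟨$⟩ K))

    ⇒combination : ∀ {i k r} {x : ℝ} (c : Fin r → ℝ) (I : Fin r → Gr W i) (K : Gr W k) →
      x ≈ᴿ ∑ᴿ (λ j → c j *ᴿ (χ k (I j) ⟨$⟩ K)) → x ≃ combination c I K
    ⇒combination c I K h = wrap h

    combination⇒ : ∀ {i k r} {x : ℝ} (c : Fin r → ℝ) (I : Fin r → Gr W i) (K : Gr W k) →
      x ≃ combination c I K → x ≈ᴿ ∑ᴿ (λ j → c j *ᴿ (χ k (I j) ⟨$⟩ K))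
    combination⇒ c I K (wrap h) = h

    combination-sum : ∀ {i k r} (c : Fin r → ℝ) (I : Fin r → Gr W i) (K : Gr W k) →
      combination c I K ≃ sum (λ j → c j ⊗ indicator (I j) K)
    combination-sum {k = k} c I K =
      ∑-*-same c (λ j → χ k (I j) ⟨$⟩ K) (λ j → indicator (I j) K) (λ j → χ≃indicator (I j) K)

  series-combination : ∀ {i k} (w : Gr W i → ℝ) → Respects w → (e : Enumeration (Gr-setoid W i)) (K : Gr W k) →
    series w K ≃ combination (λ j → w (Inverse.to (proj₂ e) j)) (Inverse.to (proj₂ e)) K
  series-combination w w-resp e K = ≃-trans (series-sum w w-resp e K)
    (≃-sym (combination-sum (λ j → w (Inverse.to (proj₂ e) j)) (Inverse.to (proj₂ e)) K))

  span⇒expansion : ∀ {i k} (f : Fun W k) → InSpan i f → Expansion i (f ⟨$⟩_)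
  span⇒expansion f (r , I , c , h) = expansion-≈
    (λ K → ≃-trans (⇒combination {x = f ⟨$⟩ K} c I K (h K)) (combination-sum c I K))
    (sum-expansion I c)

  expansion⇒span : ∀ {i k} (f : Fun W k) → Expansion i (f ⟨$⟩_) → InSpan i f
  expansion⇒span {i} f E = proj₁ (enumeration i) , I , c , λ K →
    combination⇒ {x = f ⟨$⟩ K} c I K (≃-trans (expands K) (series-combination weights respects (enumeration i) K))
    where
    open Expansion E
    I : Fin (proj₁ (enumeration i)) → Gr W i
    I = Inverse.to (proj₂ (enumeration i))
    c : Fin (proj₁ (enumeration i)) → ℝ
    c j = weights (I j)

  series⇒weights : ∀ {i k} (f : Fun W k) (w : Fun W i) →
    (∀ K → f ⟨$⟩ K ≃ series (w ⟨$⟩_) K) → HasWeights i f w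
  series⇒weights {i} f w h = proj₁ (enumeration i) , proj₂ (enumeration i) , λ K →
    combination⇒ {x = f ⟨$⟩ K} (λ j → w ⟨$⟩ Inverse.to (proj₂ (enumeration i)) j) (Inverse.to (proj₂ (enumeration i))) K
      (≃-trans (h K) (series-combination (w ⟨$⟩_) (fun-respects w) (enumeration i) K))

  weights⇒series : ∀ {i k} (f : Fun W k) (w : Fun W i) →
    HasWeights i f w → ∀ K → f ⟨$⟩ K ≃ series (w ⟨$⟩_) K
  weights⇒series f w (N , e , h) K = ≃-trans
    (⇒combination {x = f ⟨$⟩ K} (λ j → w ⟨$⟩ Inverse.to e j) (Inverse.to e) K (h K))
    (≃-sym (series-combination (w ⟨$⟩_) (fun-respects w) (N , e) K))

  isWeightDistribution : ∀ {i k} (f : Fun W k) (w : Fun W i) → i ≤ℕ k → i ℕ.+ k ≤ℕ rk W →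
    (∀ K → f ⟨$⟩ K ≃ series (w ⟨$⟩_) K) → IsWeightDistribution i f w
  isWeightDistribution f w i≤k i+k≤n h = record
    { hasWeights = series⇒weights f w h
    ; unique = λ w′ h′ I → unwrap (series-unique (w′ ⟨$⟩_) (w ⟨$⟩_) (fun-respects w′) (fun-respects w) i≤k i+k≤n
        (λ K → ≃-trans (≃-sym (weights⇒series f w′ h′ K)) (h K)) I) }

-- Linearity, injectivity and image of the map

module _ {V : Ambient} (P : Gr V 1) where

  private
    module V = Weights ℝ-ring naturals-invertible V
    module Q = Weights ℝ-ring naturals-invertible (V / P)
  open Quotient ℝ-ring naturals-invertible P

  Φ-extends : ∀ {k} (f : Fun (V / P) k) → Extends (f ⟨$⟩_) (Φ P (suc k) f ⟨$⟩_)
  Φ-extends {k} f = record { on = on ; off = off }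
    where
    on : ∀ K h → (Φ P (suc k) f ⟨$⟩ K) ≃ (f ⟨$⟩ quotientBy K P h)
    on K h with P ≤? K
    ... | yes h′ = wrap (Func.cong f (quotientBy-mono K K P h′ h (≤-refl K) , quotientBy-mono K K P h h′ (≤-refl K)))
    ... | no ¬h  = ⊥-elim (¬h h)
    off : ∀ K → ¬ P ≤ K → (Φ P (suc k) f ⟨$⟩ K) ≃ 0ᴿ
    off K ¬h with P ≤? K
    ... | yes h = ⊥-elim (¬h h)
    ... | no _  = wrap (≈ᴿ-refl {0ᴿ})

  module _ {k : ℕ} where

    open RawLeftModule (ℝ^Gr (V / P) k) using (_+ᴹ_; -ᴹ_; _*ₗ_)
    open RawLeftModule (ℝ^Gr V (suc k)) using () renaming (_+ᴹ_ to _+ⱽ_; -ᴹ_ to -ⱽ_; _*ₗ_ to _*ⱽ_)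

    Φ-+ : ∀ f g → Φ P (suc k) (f +ᴹ g) ≗ Φ P (suc k) f +ⱽ Φ P (suc k) g
    Φ-+ f g K = unwrap {Φ P (suc k) (f +ᴹ g) ⟨$⟩ K} {(Φ P (suc k) f +ⱽ Φ P (suc k) g) ⟨$⟩ K} (≃-trans
      (extends-unique (Φ-extends (f +ᴹ g)) (extends-+ (Φ-extends f) (Φ-extends g))
        (λ I → +≃⊕ (f ⟨$⟩ I) (g ⟨$⟩ I)) K)
      (≃-sym (+≃⊕ (Φ P (suc k) f ⟨$⟩ K) (Φ P (suc k) g ⟨$⟩ K))))

    Φ-*ₗ : ∀ a f → Φ P (suc k) (a *ₗ f) ≗ a *ⱽ Φ P (suc k) f
    Φ-*ₗ a f K = unwrap {Φ P (suc k) (a *ₗ f) ⟨$⟩ K} {(a *ⱽ Φ P (suc k) f) ⟨$⟩ K} (≃-trans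
      (extends-unique (Φ-extends (a *ₗ f)) (extends-*ˡ a (Φ-extends f)) (λ I → *≃⊗ a (f ⟨$⟩ I)) K)
      (≃-sym (*≃⊗ a (Φ P (suc k) f ⟨$⟩ K))))

    Φ-neg : ∀ f → Φ P (suc k) (-ᴹ f) ≗ -ⱽ Φ P (suc k) f
    Φ-neg f K = unwrap {Φ P (suc k) (-ᴹ f) ⟨$⟩ K} {(-ⱽ Φ P (suc k) f) ⟨$⟩ K} (≃-trans
      (extends-unique (Φ-extends (-ᴹ f)) (extends-neg (Φ-extends f)) (λ I → -≃⊖ (f ⟨$⟩ I)) K)
      (≃-sym (-≃⊖ (Φ P (suc k) f ⟨$⟩ K))))

    Φ-0 : Φ P (suc k) 𝟎 ≗ 𝟎
    Φ-0 K = unwrap {Φ P (suc k) 𝟎 ⟨$⟩ K} {0ᴿ} (extends-unique (Φ-extends 𝟎) extends-0 (λ _ → wrap (≈ᴿ-refl {0ᴿ})) K)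

    Φ-cong : ∀ f g → f ≗ g → Φ P (suc k) f ≗ Φ P (suc k) g
    Φ-cong f g f≗g K = unwrap (extends-unique (Φ-extends f) (Φ-extends g) (λ I → wrap (f≗g I)) K)

    Φ-injective : ∀ f g → Φ P (suc k) f ≗ Φ P (suc k) g → f ≗ g
    Φ-injective f g Φf≗Φg K = unwrap (extends-injective (fun-respects (V / P) f) (fun-respects (V / P) g)
      (Φ-extends f) (Φ-extends g) (λ I → wrap (Φf≗Φg I)) K)

    Φ-isMonomorphism :
      LeftModuleMorphisms.IsLeftModuleMonomorphism (ℝ^Gr (V / P) k) (ℝ^Gr V (suc k)) (Φ P (suc k))
    Φ-isMonomorphism = record
      { isLeftModuleHomomorphism = record
        { +ᴹ-isGroupHomomorphism = record
          { isMonoidHomomorphism = record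
            { isMagmaHomomorphism = record
              { isRelHomomorphism = record { cong = λ {f} {g} → Φ-cong f g }
              ; homo = Φ-+ }
            ; ε-homo = Φ-0 }
          ; ⁻¹-homo = Φ-neg }
        ; *ₗ-homo = Φ-*ₗ }
      ; injective = λ {f} {g} → Φ-injective f g }

  Φ-image : ∀ {k} (g : Fun V (suc k)) →
    (Σ[ f ∈ Fun (V / P) k ] Φ P (suc k) f ≗ g) ⇔ ((K : Gr V (suc k)) → Support g K → P ≤ K)
  Φ-image {k} g = mk⇔ (λ (f , Φf≗g) K → support f Φf≗g K (P ≤? K)) (λ h → preimage , preimage-image h)
    where
    support : ∀ f → Φ P (suc k) f ≗ g → ∀ K → Dec (P ≤ K) → Support g K → P ≤ K
    support f Φf≗g K (yes h) _ = h
    support f Φf≗g K (no ¬h) s = ⊥-elim (s (unwrap {g ⟨$⟩ K} {0ᴿ}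
      (≃-trans (≃-sym (wrap {Φ P (suc k) f ⟨$⟩ K} {g ⟨$⟩ K} (Φf≗g K))) (Extends.off (Φ-extends f) K ¬h))))

    preimage : Fun (V / P) k
    preimage = fun (V / P) (λ K → g ⟨$⟩ lift P K)
      (λ I J p q → wrap (Func.cong g (lift-mono I J p , lift-mono J I q)))

    preimage-image : (∀ K → Support g K → P ≤ K) → Φ P (suc k) preimage ≗ g
    preimage-image h K = unwrap {Φ P (suc k) preimage ⟨$⟩ K} {g ⟨$⟩ K} (extends-unique (Φ-extends preimage)
      -- The condition on the support only refutes that g(I) differs from 0 when P is not in I;
      -- stability of equality to 0 turns this into g(I) = 0.
      (restriction-extends (fun-respects V g) (λ I ¬h → wrap (≈0-stable (g ⟨$⟩ I) (¬h ∘ h I))))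
      (λ I → wrap (≈ᴿ-refl {g ⟨$⟩ lift P I})) K)

  -- Degree and weights of the image of a function

  module _ {k} (k<n : suc k ≤ℕ rk V) (f : Fun (V / P) k) where

    private
      m = rk V ∸ suc k

      beyond : ∀ {s} → s ≤ℕ m → s ℕ.+ suc k ≤ℕ rk V
      beyond {s} s≤m = subst (s ℕ.+ suc k ≤ℕ_) (ℕₚ.m∸n+n≡m k<n) (ℕₚ.+-monoˡ-≤ (suc k) s≤m)

      Φf = Φ P (suc k) f
      f-resp = fun-respects (V / P) f
      Φf-ext = Φ-extends f

    Φ-zero : f ≗ 𝟎 → Φf ≗ 𝟎
    Φ-zero f≗0 K = unwrap {Φf ⟨$⟩ K} {0ᴿ} (extends-unique Φf-ext extends-0 (λ I → wrap (f≗0 I)) K)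

    Φ-nonzero : Φf ≗ 𝟎 → f ≗ 𝟎
    Φ-nonzero Φf≗0 K = unwrap {f ⟨$⟩ K} {0ᴿ}
      (extends-injective f-resp (λ _ _ _ _ → wrap (≈ᴿ-refl {0ᴿ})) Φf-ext extends-0 (λ I → wrap (Φf≗0 I)) K)

    Φ-span : ∀ {t} → InSpan t f → InSpan (suc t) Φf
    Φ-span f∈ = expansion⇒span V Φf (expansion-extends f-resp Φf-ext (span⇒expansion (V / P) f f∈))

    Φ-span-corank : m ≤ℕ suc k → InSpan m Φf
    Φ-span-corank m≤k = expansion⇒span V Φf
      (V.expansion-all (ℕₚ.m+[n∸m]≡n k<n) m≤k (Φf ⟨$⟩_) (fun-respects V Φf))

    Φ-span-0 : InSpan 0 Φf → suc k <ℕ rk V → f ≗ 𝟎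
    Φ-span-0 Φf∈ k<n K = unwrap {f ⟨$⟩ K} {0ᴿ}
      (expansion-0-extends f-resp Φf-ext (span⇒expansion V Φf Φf∈) k<n K)

    Φ-span-suc : ∀ {s} → InSpan (suc s) Φf → s ≤ℕ k → suc s ℕ.+ suc k <ℕ rk V → InSpan s f
    Φ-span-suc Φf∈ s≤k s+k<n = expansion⇒span (V / P) f
      (expansion-restricts f-resp Φf-ext (span⇒expansion V Φf Φf∈) (s≤s s≤k) s+k<n)

    -- If the corank m is the smaller one, the span of f is irrelevant: every function lies in the
    -- span of rank m, because m ≤ t + 1 ≤ k + 1.
    Φ-span-⊓ : ∀ {t} → t ≤ℕ k → InSpan t f → InSpan (suc t ⊓ m) Φf
    Φ-span-⊓ {t} t≤k f∈ = by (ℕₚ.≤-total (suc t) m)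
      where
      move : ∀ {i j} → i ≡ j → InSpan i Φf → InSpan j Φf
      move refl Φf∈ = Φf∈
      by : suc t ≤ℕ m ⊎ m ≤ℕ suc t → InSpan (suc t ⊓ m) Φf
      by (inj₁ t<m) = move (≡.sym (ℕₚ.m≤n⇒m⊓n≡m t<m)) (Φ-span {t} f∈)
      by (inj₂ m≤t) = move (≡.sym (ℕₚ.m≥n⇒m⊓n≡n m≤t)) (Φ-span-corank (ℕₚ.≤-trans m≤t (s≤s t≤k)))

    Φ-not-span-0 : ¬ f ≗ 𝟎 → 0 ℕ.+ suc k <ℕ rk V → ¬ InSpan 0 Φf
    Φ-not-span-0 f≢0 k<n Φf∈ = f≢0 (Φ-span-0 Φf∈ k<n)

    Φ-not-span-suc : ∀ s → ¬ InSpan s f → s ≤ℕ k → suc s ℕ.+ suc k <ℕ rk V → ¬ InSpan (suc s) Φf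
    Φ-not-span-suc s f∉ s≤k s+k<n Φf∈ = f∉ (Φ-span-suc {s} Φf∈ s≤k s+k<n)

    -- Separates the two bounds in s < min(t + 1 , m): the first gives s - 1 < t for positive s, the
    -- second the strict inequality on which `weights-off` depends.
    below-degree : ∀ {t} (A : ℕ → Set) → (0 ℕ.+ suc k <ℕ rk V → A 0) →
      (∀ s → s <ℕ t → suc s ℕ.+ suc k <ℕ rk V → A (suc s)) → ∀ s → s <ℕ suc t ⊓ m → A s
    below-degree {t} A A0 Asuc s s< = by s (ℕₚ.≤-pred (ℕₚ.≤-trans s< (ℕₚ.m⊓n≤m (suc t) m)))
        (beyond (ℕₚ.≤-trans s< (ℕₚ.m⊓n≤n (suc t) m)))
      where
      by : ∀ s → s ≤ℕ t → s ℕ.+ suc k <ℕ rk V → A s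
      by zero    _   = A0
      by (suc s) s<t = Asuc s s<t

    Φ-minimal : ∀ {t} → ¬ f ≗ 𝟎 → t ≤ℕ k → (∀ s → s <ℕ t → ¬ InSpan s f) →
      ∀ s → s <ℕ suc t ⊓ m → ¬ InSpan s Φf
    Φ-minimal {t} f≢0 t≤k minimal = below-degree {t} (λ s → ¬ InSpan s Φf) (Φ-not-span-0 f≢0)
      (λ s s<t s+k<n → Φ-not-span-suc s (minimal s s<t) (ℕₚ.≤-trans (ℕₚ.<⇒≤ s<t) t≤k) s+k<n)

    Φ-degree : ∀ d → IsDegree f d → IsDegree Φf (suc₋ d ⊓₋ m)
    Φ-degree ⊥₋ f≗0 = Φ-zero f≗0
    Φ-degree [ t ] (f≢0 , t≤ , f∈ , minimal) =
      f≢0 ∘ Φ-nonzero , ℕₚ.⊓-monoˡ-≤ m (s≤s t≤k) , Φ-span-⊓ {t} t≤k f∈ , Φ-minimal {t} f≢0 t≤k minimal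
      where
      t≤k : t ≤ℕ k
      t≤k = ℕₚ.≤-trans t≤ (ℕₚ.m⊓n≤m k _)

    zero-expansion : ∀ {e} → f ≗ 𝟎 → Q.Expansion e (f ⟨$⟩_)
    zero-expansion f≗0 = Q.expansion-≈ {g = λ _ → 0ᴿ} (λ K → wrap {f ⟨$⟩ K} {0ᴿ} (f≗0 K)) Q.expansion-0

    span-expansion : ∀ t {e} → InSpan t f → t ≤ℕ e → e ≤ℕ k → Q.Expansion e (f ⟨$⟩_)
    span-expansion t f∈ t≤e e≤k = Q.expansion-up {i = t} t≤e e≤k (span⇒expansion (V / P) {t} f f∈)

    -- The zero function expands in every rank, with zero weights, so its degree may be replaced by
    -- 0 here.
    expansion-beyond : ∀ d → IsDegree f d → ∀ {e} → max₀ d ≤ℕ e → e ≤ℕ k → Q.Expansion e (f ⟨$⟩_)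
    expansion-beyond ⊥₋    f≗0              _   _   = zero-expansion f≗0
    expansion-beyond [ t ] (_ , _ , f∈ , _) t≤e e≤k = span-expansion t f∈ t≤e e≤k

    -- The weights of `Φ(f)` are `Φ` of the weights of f, one rank higher: this choice of `w′` gives
    -- the case distinction at once, and the bounds on e make both weight distributions unique.
    Φ-weights : ∀ {e} → Q.Expansion e (f ⟨$⟩_) → suc e ≤ℕ suc k ⊓ m →
      Σ[ w ∈ Fun (V / P) e ] Σ[ w′ ∈ Fun V (suc e) ]
        IsWeightDistribution e f w
        × IsWeightDistribution (suc e) Φf w′
        × ((E : Gr V (suc e)) →
            ((P≤E : P ≤ E) → (w′ ⟨$⟩ E) ≈ᴿ (w ⟨$⟩ quotientBy E P P≤E))
            × (¬ (P ≤ E) → (w′ ⟨$⟩ E) ≈ᴿ 0ᴿ))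
    Φ-weights {e} expansion e< =
        w , w′
      , isWeightDistribution (V / P) f w (ℕₚ.≤-pred e<k) e+k≤n expands
      , isWeightDistribution V Φf w′ e<k e+k<n
          (extends-unique Φf-ext (series-extends (w ⟨$⟩_) (w′ ⟨$⟩_) (fun-respects (V / P) w) (fun-respects V w′) w′-ext) expands)
      , (λ E → (λ P≤E → unwrap {w′ ⟨$⟩ E} {w ⟨$⟩ quotientBy E P P≤E} (Extends.on w′-ext E P≤E))
             , (λ P≰E → unwrap {w′ ⟨$⟩ E} {0ᴿ} (Extends.off w′-ext E P≰E)))
      where
      open Q.Expansion expansion
      w : Fun (V / P) e
      w = fun (V / P) weights respects
      w′ : Fun V (suc e)
      w′ = Φ P (suc e) w
      w′-ext = Φ-extends w
      e<k : suc e ≤ℕ suc k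
      e<k = ℕₚ.≤-trans e< (ℕₚ.m⊓n≤m (suc k) m)
      e+k<n : suc e ℕ.+ suc k ≤ℕ rk V
      e+k<n = beyond (ℕₚ.≤-trans e< (ℕₚ.m⊓n≤n (suc k) m))
      e+k≤n : e ℕ.+ k ≤ℕ rk (V / P)
      e+k≤n = subst (e ℕ.+ k ≤ℕ_) (≡.sym (rk-/ V P))
        (ℕₚ.≤-trans (ℕₚ.+-monoʳ-≤ e (ℕₚ.n≤1+n k)) (ℕₚ.∸-monoˡ-≤ 1 e+k<n))

theorem6p3 : (V : Ambient) → 1 ≤ℕ rk V →
    (P : Gr V 1) (k : ℕ) → 1 ≤ℕ k → k ≤ℕ rk V →
    LeftModuleMorphisms.IsLeftModuleMonomorphism (ℝ^Gr (V / P) (k ∸ 1)) (ℝ^Gr V k) (Φ P k)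
    × ((g : Fun V k) →
    (Σ[ f ∈ Fun (V / P) (k ∸ 1) ] Φ P k f ≗ g) ⇔ ((K : Gr V k) → Support g K → P ≤ K))
    × ((f : Fun (V / P) (k ∸ 1)) (d : ℕ ₋) → IsDegree f d →
    IsDegree (Φ P k f) (suc₋ d ⊓₋ (rk V ∸ k))
    × ((e : ℕ) → suc (max₀ d) ≤ℕ e → e ≤ℕ k ⊓ (rk V ∸ k) →
    Σ[ w ∈ Fun (V / P) (e ∸ 1) ] Σ[ w′ ∈ Fun V e ]
    IsWeightDistribution (e ∸ 1) f w
    × IsWeightDistribution e (Φ P k f) w′
    × ((E : Gr V e) →
    ((P≤E : P ≤ E) → (w′ ⟨$⟩ E) ≈ᴿ (w ⟨$⟩ quotientBy E P P≤E))
    × (¬ (P ≤ E) → (w′ ⟨$⟩ E) ≈ᴿ 0ᴿ))))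
theorem6p3 V _ P (suc k) _ k<n =
    Φ-isMonomorphism P
  , Φ-image P
  , λ f d f-degree → Φ-degree P k<n f d f-degree
  , λ { (suc e) (s≤s d≤e) e≤ → Φ-weights P k<n f
          (expansion-beyond P k<n f d f-degree d≤e (ℕₚ.≤-pred (ℕₚ.≤-trans e≤ (ℕₚ.m⊓n≤m (suc k) _)))) e≤ }
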